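{- Let $n \ge 1$ and $n-1 \le k \le 2n-3$, and let $X$ be the set of non-crossing connected graphs on $n$ vertices with $k$ edges. Let $$c(n,k;q) = \frac{1}{[n-1]_q}{3n-3 \brack n+k}_q {k-1 \brack n-2}_q,$$ which is a polynomial in $q$. If $d \ge 1$ divides $n$ and $\omega$ is a primitive $d$-th root of unity, then $$c(n,k;\omega) = s_d(n,k),$$ where $s_d(n,k)$ is the number of $x \in X$ that are fixed under rotation by $\frac{2\pi}{d}$.
   Context: A non-crossing graph on $\{1,\ldots,n\}$ is a simple graph whose vertices $1,\ldots,n$ are placed in this order around a circle, edges drawn as straight chords, such that no two edges cross. Rotation by $\frac{2\pi}{d}$ (for $d \mid n$) sends vertex $i$ to vertex $i + n/d$ (indices taken modulo $n$ in $\{1,\ldots,n\}$), acting on edges accordingly. Notation: $[m]_q = 1+q+\cdots+q^{m-1}$, $[m]!_q = [m]_q[m-1]_q\cdots[1]_q$, and ${a \brack b}_q = \frac{[a]!_q}{[b]!_q[a-b]!_q}$ for $0\le b\le a$, and ${a \brack b}_q=0$ otherwise. -}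

module Defs where

open import Level using (Level; _⊔_)
open import Data.Bool using (Bool; true; false; _∧_; if_then_else_)
open import Data.Nat using (ℕ; zero; suc; _+_; _*_; _∸_; _<_; _<ᵇ_)
open import Data.Nat.DivMod using (_mod_)
open import Data.Integer using (ℤ; +_; -[1+_]) renaming (_+_ to _+ℤ_; _*_ to _*ℤ_)
open import Data.Fin using (Fin; toℕ)
open import Data.List using (List; []; _∷_; map; replicate; allFin)
open import Data.Nat.ListAction using (sum)
open import Data.Vec using (Vec; lookup)
open import Data.Sum using (_⊎_)
open import Data.Empty using (⊥)
open import Data.Product using (_×_)
open import Relation.Nullary using (¬_)
open import Relation.Binary.PropositionalEquality using (_≡_)
open import Algebra.Bundles using (CommutativeRing)

-- Polynomials in q with integer coefficients: little-endian coefficient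
-- lists (the list a₀ ∷ a₁ ∷ … represents a₀ + a₁ q + …).

Poly : Set
Poly = List ℤ

infixl 6 _+ₚ_
infixl 7 _*ₚ_

_+ₚ_ : Poly → Poly → Poly
[]      +ₚ g       = g
(a ∷ f) +ₚ []      = a ∷ f
(a ∷ f) +ₚ (b ∷ g) = (a +ℤ b) ∷ (f +ₚ g)

_*ₚ_ : Poly → Poly → Poly
[]      *ₚ g = []
(a ∷ f) *ₚ g = map (a *ℤ_) g +ₚ ((+ 0) ∷ (f *ₚ g))

coeff : Poly → ℕ → ℤ
coeff []      _       = + 0
coeff (a ∷ f) zero    = a
coeff (a ∷ f) (suc i) = coeff f i

qint : ℕ → Poly
qint m = replicate m (+ 1)

qfact : ℕ → Poly
qfact zero    = + 1 ∷ []
qfact (suc m) = qint (suc m) *ₚ qfact m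

-- c(n,k;q) = [3n-3]! [k-1]! / ( [n-1] [n+k]! [2n-3-k]! [n-2]! [k-n+1]! )
-- (this is the given formula with both q-binomials written via q-factorials;
--  in the range n-1 ≤ k ≤ 2n-3 both binomials have 0 ≤ b ≤ a).
cNumer : ℕ → ℕ → Poly
cNumer n k = qfact (3 * n ∸ 3) *ₚ qfact (k ∸ 1)

cDenom : ℕ → ℕ → Poly
cDenom n k = qint (n ∸ 1) *ₚ qfact (n + k) *ₚ qfact ((3 * n ∸ 3) ∸ (n + k))
             *ₚ qfact (n ∸ 2) *ₚ qfact ((k ∸ 1) ∸ (n ∸ 2))

module _ {c ℓ : Level} (R : CommutativeRing c ℓ) where
  open CommutativeRing R using (Carrier; _≈_; 0#; 1#; -_) renaming (_+_ to _+R_; _*_ to _*R_)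

  natR : ℕ → Carrier
  natR zero    = 0#
  natR (suc m) = 1# +R natR m

  intR : ℤ → Carrier
  intR (+ m)      = natR m
  intR -[1+ m ]   = - natR (suc m)

  evalP : Poly → Carrier → Carrier
  evalP []      ω = 0#
  evalP (a ∷ f) ω = intR a +R ω *R evalP f ω

  pow : Carrier → ℕ → Carrier
  pow x zero    = 1#
  pow x (suc m) = x *R pow x m

  IsDomainChar0 : Set (c ⊔ ℓ)
  IsDomainChar0 =
    (∀ x y → x *R y ≈ 0# → x ≈ 0# ⊎ y ≈ 0#) ×
    (∀ m → natR m ≈ 0# → m ≡ 0)

  PrimitiveRoot : ℕ → Carrier → Set ℓ
  PrimitiveRoot d ω = (pow ω d ≈ 1#) × (∀ j → 0 < j → j < d → ¬ (pow ω j ≈ 1#))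

-- Graphs on the vertex set Fin n (vertex i ↔ vertex i+1 of the paper),
-- given by adjacency matrices.

Adj : ℕ → Set
Adj n = Vec (Vec Bool n) n

entry : ∀ {n} → Adj n → Fin n → Fin n → Bool
entry A i j = lookup (lookup A i) j

Edge : ∀ {n} → Adj n → Fin n → Fin n → Set
Edge A i j = entry A i j ≡ true

Simple : ∀ {n} → Adj n → Set
Simple A = (∀ i j → entry A i j ≡ entry A j i) × (∀ i → entry A i i ≡ false)

edgeCount : ∀ {n} → Adj n → ℕ
edgeCount {n} A =
  sum (map (λ i → sum (map (λ j → if (toℕ i <ᵇ toℕ j) ∧ entry A i j then 1 else 0)
                           (allFin n)))
           (allFin n))

data Path {n} (A : Adj n) : Fin n → Fin n → Set where
  here : ∀ {i} → Path A i i
  step : ∀ {i j l} → Edge A i j → Path A j l → Path A i l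

Connected : ∀ {n} → Adj n → Set
Connected A = ∀ i j → Path A i j

-- two straight chords {a,b}, {c,d} between points in circular order cross
-- iff their endpoints strictly interleave: a < c < b < d.
NonCrossing : ∀ {n} → Adj n → Set
NonCrossing A = ∀ a b c d → Edge A a b → Edge A c d →
  toℕ a < toℕ c → toℕ c < toℕ b → toℕ b < toℕ d → ⊥

InX : (n k : ℕ) → Adj n → Set
InX n k A = Simple A × NonCrossing A × Connected A × (edgeCount A ≡ k)

rot : ∀ {n} → ℕ → Fin n → Fin n
rot {suc m} s i = (toℕ i + s) mod (suc m)

FixedBy : ∀ {n} → ℕ → Adj n → Set
FixedBy s A = ∀ i j → entry A (rot s i) (rot s j) ≡ entry A i j

{-# OPTIONS --safe #-}
-- Polynomiality and values.  Put N = n - 1.  The elements [N] c, [k] c and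
-- [n+k] c are products of Gaussian binomials, and 1 = [n+k] - q [N] - q^(N+1) [k],
-- so c is a polynomial with [N] c = [3N, n+k] [k-1, N-1].  At a primitive d-th root
-- of unity the right-hand side is evaluated by the q-Lucas theorem.
--
-- Counting.  The edges of a connected non-crossing graph on an interval that no
-- other edge passes over form a path, so with F counting the graphs that contain
-- the edge joining the two ends (z for length, y for edges) connected graphs are
-- counted by C = 1 / (1 - F).  Cutting at the least other neighbour of the right
-- end gives F = y z C + (1 + y) F².  Stacks of i connected graphs and j arcs thus
-- satisfy linear recursions, and by induction along them the sum of the span of any
-- fixed member of the stack is a product of two binomial coefficients.
--
-- Symmetry.  Let d ≥ 2 and m = n / d.  An edge that is too long crosses its own
-- rotation, so all edges have length at most m.  By connectedness the edges that no
-- other edge passes over form a polygon around the centre (for d = 2 possibly a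
-- diameter), hence the graph is the m-periodic repetition of a connected graph on an
-- interval [v , v + m] whose last arc passes over the origin.  So these graphs are
-- counted by sums of spans of the last arc in a stack.
module Submission where

-- Nothing is ever divided: Gaussian binomials are given by q-Pascal in any commutative ring, so one
-- and the same expression `cPoly` is read both in the polynomial ring and at ω, and evaluation
-- carries one reading to the other. The factor [n-1] can be cancelled at a primitive d-th root of
-- unity with d dividing n: for d ≥ 2 it has the value [d-1], which is not 0, and for d = 1 it is n
-- - 1 in characteristic 0. Two statistics describe a tree: its length and its number of marks, a
-- mark being the optional edge behind the 1 + y in the equation for F. A connected piece of length
-- N with t marks has N + t edges, so t fixes k. The number of stacks carries a denominator, the
-- total span; the sum of the spans of one chosen member does not. This sum is also what symmetric
-- graphs need: such a graph is a tree of length n / d together with the position of the origin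
-- under its last arc, one choice for each unit of that arc's span. For d = 1 the number of graphs
-- is recovered from these sums by double counting the total span.

module Gauss where
  open import Defs
  open import Level using (Level)
  open import Data.Nat using (ℕ; zero; suc; _<_; _≤_; s≤s) renaming (_+_ to _+ℕ_; _*_ to _*ℕ_; _∸_ to _∸ℕ_)
  import Data.Nat.Properties as ℕₚ
  open import Data.Product using (_,_)
  open import Relation.Nullary using (yes; no)
  import Relation.Binary.PropositionalEquality as ≡
  open import Algebra.Bundles using (CommutativeRing)
  import Algebra.Solver.Ring.NaturalCoefficients.Default as NatSolver
  import Algebra.Properties.Ring as RingProps
  import Relation.Binary.Reasoning.Setoid as SetoidReasoning

  binom : ℕ → ℕ → ℕ
  binom _       zero    = 1
  binom zero    (suc _) = 0
  binom (suc a) (suc b) = binom a b +ℕ binom a (suc b)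

  -- Gaussian binomials in a commutative ring, and the quotient as a polynomial expression.

  module GaussianBinomials {c ℓ : Level} (R : CommutativeRing c ℓ) (q : CommutativeRing.Carrier R) where
    open CommutativeRing R hiding (zero)

    open NatSolver commutativeSemiring using (solve; _:+_; _:*_; _:=_)
    open SetoidReasoning setoid

    natR-+ : ∀ a b → natR R (a +ℕ b) ≈ natR R a + natR R b
    natR-+ zero    b = sym (+-identityˡ _)
    natR-+ (suc a) b = trans (+-congˡ (natR-+ a b)) (sym (+-assoc _ _ _))

    natR-* : ∀ a b → natR R (a *ℕ b) ≈ natR R a * natR R b
    natR-* zero    b = sym (zeroˡ _)
    natR-* (suc a) b = begin
      natR R (b +ℕ a *ℕ b)              ≈⟨ natR-+ b (a *ℕ b) ⟩
      natR R b + natR R (a *ℕ b)        ≈⟨ +-congˡ (natR-* a b) ⟩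
      natR R b + natR R a * natR R b    ≈⟨ +-congʳ (*-identityˡ _) ⟨
      1# * natR R b + natR R a * natR R b  ≈⟨ distribʳ _ _ _ ⟨
      (1# + natR R a) * natR R b        ∎

    qnum : ℕ → Carrier
    qnum zero    = 0#
    qnum (suc m) = 1# + q * qnum m

    qfac : ℕ → Carrier
    qfac zero    = 1#
    qfac (suc m) = qnum (suc m) * qfac m

    -- q-Pascal rather than a quotient of `qfac`s, so that it makes sense without division.
    gauss : ℕ → ℕ → Carrier
    gauss _       zero    = 1#
    gauss zero    (suc _) = 0#
    gauss (suc a) (suc b) = gauss a b + pow R q (suc b) * gauss a (suc b)

    pow-+ : ∀ a b → pow R q (a +ℕ b) ≈ pow R q a * pow R q b
    pow-+ zero    b = sym (*-identityˡ _)
    pow-+ (suc a) b = trans (*-congˡ (pow-+ a b)) (sym (*-assoc _ _ _))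

    qnum-+ : ∀ a b → qnum (a +ℕ b) ≈ qnum a + pow R q a * qnum b
    qnum-+ zero    b = sym (trans (+-identityˡ _) (*-identityˡ _))
    qnum-+ (suc a) b = begin
      1# + q * qnum (a +ℕ b)                          ≈⟨ +-congˡ (*-congˡ (qnum-+ a b)) ⟩
      1# + q * (qnum a + pow R q a * qnum b)
        ≈⟨ solve 5 (λ o x y z w → o :+ x :* (y :+ z :* w) := o :+ x :* y :+ x :* z :* w) refl 1# q _ _ _ ⟩
      1# + q * qnum a + q * pow R q a * qnum b        ∎

    qnum-1 : qnum 1 ≈ 1#
    qnum-1 = trans (+-congˡ (zeroʳ q)) (+-identityʳ 1#)

    gauss-> : ∀ a b → a < b → gauss a b ≈ 0#
    gauss-> zero    (suc b) _         = refl
    gauss-> (suc a) (suc b) (s≤s a<b) = begin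
      gauss a b + pow R q (suc b) * gauss a (suc b)
        ≈⟨ +-cong (gauss-> a b a<b) (*-congˡ (gauss-> a (suc b) (ℕₚ.m≤n⇒m≤1+n a<b))) ⟩
      0# + pow R q (suc b) * 0#  ≈⟨ +-identityˡ _ ⟩
      pow R q (suc b) * 0#       ≈⟨ zeroʳ _ ⟩
      0#                         ∎

    gauss-diag : ∀ a → gauss a a ≈ 1#
    gauss-diag zero    = refl
    gauss-diag (suc a) = begin
      gauss a a + pow R q (suc a) * gauss a (suc a)
        ≈⟨ +-cong (gauss-diag a) (*-congˡ (gauss-> a (suc a) ℕₚ.≤-refl)) ⟩
      1# + pow R q (suc a) * 0#  ≈⟨ +-congˡ (zeroʳ _) ⟩
      1# + 0#                    ≈⟨ +-identityʳ _ ⟩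
      1#                         ∎

    mutual
      -- Proved together with the absorption law, since R has no division.
      gauss-ratio : ∀ b e → qnum (suc b) * gauss (b +ℕ e) (suc b) ≈ qnum e * gauss (b +ℕ e) b
      gauss-ratio b zero = begin
        qnum (suc b) * gauss (b +ℕ 0) (suc b)
          ≈⟨ *-congˡ (gauss-> (b +ℕ 0) (suc b) (s≤s (ℕₚ.≤-reflexive (ℕₚ.+-identityʳ b)))) ⟩
        qnum (suc b) * 0#         ≈⟨ zeroʳ _ ⟩
        0#                        ≈⟨ zeroˡ _ ⟨
        0# * gauss (b +ℕ 0) b     ∎
      gauss-ratio zero (suc e) = gauss-absorb′ 0 e
      gauss-ratio (suc b) (suc e) rewrite ℕₚ.+-suc b e = begin
        qnum (2 +ℕ b) * gauss (2 +ℕ (b +ℕ e)) (2 +ℕ b)  ≈⟨ gauss-absorb′ (suc b) e ⟩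
        qnum (2 +ℕ (b +ℕ e)) * gauss (1 +ℕ (b +ℕ e)) (suc b)  ≈⟨ *-congʳ (qnum-split b e) ⟩
        (qnum (suc b) + pow R q (suc b) * qnum (suc e)) * gauss (1 +ℕ (b +ℕ e)) (suc b)
          ≈⟨ solve 4 (λ x y z g → (x :+ y :* z) :* g := x :* g :+ y :* z :* g) refl _ _ _ _ ⟩
        qnum (suc b) * gauss (1 +ℕ (b +ℕ e)) (suc b) + pow R q (suc b) * qnum (suc e) * gauss (1 +ℕ (b +ℕ e)) (suc b)
          ≈⟨ +-congʳ (≡.subst (λ z → qnum (suc b) * gauss z (suc b) ≈ qnum (suc e) * gauss z b) (ℕₚ.+-suc b e) (gauss-ratio b (suc e))) ⟩
        qnum (suc e) * gauss (1 +ℕ (b +ℕ e)) b + pow R q (suc b) * qnum (suc e) * gauss (1 +ℕ (b +ℕ e)) (suc b)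
          ≈⟨ solve 4 (λ x y g h → x :* g :+ y :* x :* h := x :* (g :+ y :* h)) refl _ _ _ _ ⟩
        qnum (suc e) * gauss (2 +ℕ (b +ℕ e)) (suc b)  ∎

      qnum-split : ∀ b e → qnum (2 +ℕ (b +ℕ e)) ≈ qnum (suc b) + pow R q (suc b) * qnum (suc e)
      qnum-split b e = ≡.subst (λ z → qnum (suc z) ≈ qnum (suc b) + pow R q (suc b) * qnum (suc e))
                    (ℕₚ.+-suc b e) (qnum-+ (suc b) (suc e))

      -- Pascal splits the upper binomial, the ratio identity turns its second half into [e] times
      -- the lower one, and [b+1] + q^(b+1) [e] = [b+1+e].
      gauss-absorb′ : ∀ b e → qnum (suc b) * gauss (suc (b +ℕ e)) (suc b) ≈ qnum (suc (b +ℕ e)) * gauss (b +ℕ e) b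
      gauss-absorb′ b e = begin
        qnum (suc b) * (gauss (b +ℕ e) b + pow R q (suc b) * gauss (b +ℕ e) (suc b))
          ≈⟨ solve 4 (λ x g y h → x :* (g :+ y :* h) := x :* g :+ y :* (x :* h)) refl _ _ _ _ ⟩
        qnum (suc b) * gauss (b +ℕ e) b + pow R q (suc b) * (qnum (suc b) * gauss (b +ℕ e) (suc b))
          ≈⟨ +-congˡ (*-congˡ (gauss-ratio b e)) ⟩
        qnum (suc b) * gauss (b +ℕ e) b + pow R q (suc b) * (qnum e * gauss (b +ℕ e) b)
          ≈⟨ solve 4 (λ x y z g → x :* g :+ y :* (z :* g) := (x :+ y :* z) :* g) refl _ _ _ _ ⟩
        (qnum (suc b) + pow R q (suc b) * qnum e) * gauss (b +ℕ e) b
          ≈⟨ *-congʳ (qnum-+ (suc b) e) ⟨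
        qnum (suc b +ℕ e) * gauss (b +ℕ e) b ∎

    gauss-absorb : ∀ a b → qnum (suc b) * gauss (suc a) (suc b) ≈ qnum (suc a) * gauss a b
    gauss-absorb a b with b ℕₚ.≤? a
    ... | yes b≤a with ℕₚ.m≤n⇒∃[o]m+o≡n b≤a
    ...   | e , ≡.refl = gauss-absorb′ b e
    gauss-absorb a b | no b≰a = begin
      qnum (suc b) * gauss (suc a) (suc b)  ≈⟨ *-congˡ (gauss-> (suc a) (suc b) (s≤s (ℕₚ.≰⇒> b≰a))) ⟩
      qnum (suc b) * 0#                     ≈⟨ zeroʳ _ ⟩
      0#                                    ≈⟨ zeroʳ _ ⟨
      qnum (suc a) * 0#                     ≈⟨ *-congˡ (gauss-> a b (ℕₚ.≰⇒> b≰a)) ⟨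
      qnum (suc a) * gauss a b              ∎

    gauss-qfac : ∀ a b → gauss (a +ℕ b) b * (qfac a * qfac b) ≈ qfac (a +ℕ b)
    gauss-qfac a zero rewrite ℕₚ.+-identityʳ a = trans (*-identityˡ _) (*-identityʳ _)
    gauss-qfac a (suc b) rewrite ℕₚ.+-suc a b = begin
      gauss (suc (a +ℕ b)) (suc b) * (qfac a * (qnum (suc b) * qfac b))
        ≈⟨ solve 4 (λ g x y z → g :* (x :* (y :* z)) := (y :* g) :* (x :* z)) refl _ _ _ _ ⟩
      qnum (suc b) * gauss (suc (a +ℕ b)) (suc b) * (qfac a * qfac b)
        ≈⟨ *-congʳ (gauss-absorb (a +ℕ b) b) ⟩
      qnum (suc (a +ℕ b)) * gauss (a +ℕ b) b * (qfac a * qfac b)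
        ≈⟨ *-assoc _ _ _ ⟩
      qnum (suc (a +ℕ b)) * (gauss (a +ℕ b) b * (qfac a * qfac b))
        ≈⟨ *-congˡ (gauss-qfac a b) ⟩
      qnum (suc (a +ℕ b)) * qfac (a +ℕ b)  ∎

    -- The quotient of cNumer by cDenom for n = N + 1, k = K + 1 and N = M + 1:
    -- the three summands are [n+k] c, [N] c and [k] c, and
    -- 1 = [n+k] - q [N] - q^(N+1) [k].
    cB : ℕ → ℕ → Carrier
    cB M K = gauss (3 *ℕ suc M) (suc M +ℕ suc (suc K)) * gauss K M

    cA cD cPoly : ℕ → ℕ → Carrier
    cA M K = (1# + pow R q (suc M) + pow R q (suc M +ℕ suc M)) * (gauss (2 +ℕ 3 *ℕ M) (suc M +ℕ suc K) * gauss K M)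
    cD M K = gauss (3 *ℕ suc M) (suc M +ℕ suc (suc K)) * gauss (suc K) (suc M)
    cPoly M K = cA M K + - (q * cB M K + pow R q (suc (suc M)) * cD M K)

    private
      triple : ∀ M → 3 *ℕ suc M ≡.≡ suc (2 +ℕ 3 *ℕ M)
      triple M = ℕₚ.*-distribˡ-+ 3 1 M

    -- The prefactor 1 + q^N + q^(2N) is [3N] / [N]; absorption then trades [3N] for [n+k] and
    -- raises both entries of the binomial by one.
    cA-mul : ∀ M K → qnum (suc M) * cA M K ≈ qnum (suc M +ℕ suc (suc K)) * cB M K
    cA-mul M K = begin
      n * ((1# + p + pow R q (suc M +ℕ suc M)) * (g * h))
        ≈⟨ solve 6 (λ n o p p2 g h → n :* ((o :+ p :+ p2) :* (g :* h)) := (n :* o :+ p :* n :+ p2 :* n) :* g :* h) refl n 1# p _ g h ⟩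
      (n * 1# + p * n + pow R q (suc M +ℕ suc M) * n) * g * h
        ≈⟨ *-congʳ (*-congʳ (+-congʳ (+-congʳ (*-identityʳ n)))) ⟩
      (n + p * n + pow R q (suc M +ℕ suc M) * n) * g * h
        ≈⟨ *-congʳ (*-congʳ (+-congʳ (qnum-+ (suc M) (suc M)))) ⟨
      (qnum (suc M +ℕ suc M) + pow R q (suc M +ℕ suc M) * n) * g * h
        ≈⟨ *-congʳ (*-congʳ (qnum-+ (suc M +ℕ suc M) (suc M))) ⟨
      qnum ((suc M +ℕ suc M) +ℕ suc M) * g * h
        ≡⟨ ≡.cong (λ z → qnum z * g * h) eq ⟩
      qnum (3 +ℕ 3 *ℕ M) * g * h
        ≈⟨ *-congʳ (gauss-absorb (2 +ℕ 3 *ℕ M) (suc M +ℕ suc K)) ⟨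
      qnum (suc (suc M +ℕ suc K)) * gauss (3 +ℕ 3 *ℕ M) (suc (suc M +ℕ suc K)) * h
        ≡⟨ ≡.cong₂ (λ z w → qnum z * gauss w z * h) (≡.sym (ℕₚ.+-suc (suc M) (suc K))) (≡.sym (triple M)) ⟩
      qnum (suc M +ℕ suc (suc K)) * gauss (3 *ℕ suc M) (suc M +ℕ suc (suc K)) * h
        ≈⟨ *-assoc _ _ _ ⟩
      qnum (suc M +ℕ suc (suc K)) * cB M K ∎
      where
      n = qnum (suc M)
      p = pow R q (suc M)
      g = gauss (2 +ℕ 3 *ℕ M) (suc M +ℕ suc K)
      h = gauss K M
      eq : (suc M +ℕ suc M) +ℕ suc M ≡.≡ 3 +ℕ 3 *ℕ M
      eq = ≡.trans (≡.trans (ℕₚ.+-assoc (suc M) (suc M) (suc M)) (≡.cong (λ z → suc M +ℕ (suc M +ℕ z)) (≡.sym (ℕₚ.+-identityʳ (suc M))))) (triple M)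

    cD-mul : ∀ M K → qnum (suc M) * cD M K ≈ qnum (suc K) * cB M K
    cD-mul M K = begin
      qnum (suc M) * (g * gauss (suc K) (suc M))  ≈⟨ solve 3 (λ n g h → n :* (g :* h) := g :* (n :* h)) refl _ _ _ ⟩
      g * (qnum (suc M) * gauss (suc K) (suc M))  ≈⟨ *-congˡ (gauss-absorb K M) ⟩
      g * (qnum (suc K) * gauss K M)              ≈⟨ solve 3 (λ n g h → g :* (n :* h) := n :* (g :* h)) refl _ _ _ ⟩
      qnum (suc K) * cB M K                       ∎
      where g = gauss (3 *ℕ suc M) (suc M +ℕ suc (suc K))

    -- After multiplication by [N] every summand of `cPoly` is a multiple of `cB`, with coefficients
    -- [n+k], q [N] and q^(N+1) [k]; the first exceeds the sum of the others by exactly 1.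
    cPoly-mul : ∀ M K → qnum (suc M) * cPoly M K ≈ cB M K
    cPoly-mul M K = begin
      n * (cA M K + - e)            ≈⟨ distribˡ n _ _ ⟩
      n * cA M K + n * - e          ≈⟨ +-cong (cA-mul M K) (sym (-‿distribʳ-* n e)) ⟩
      w * B + - (n * e)             ≈⟨ +-congʳ main ⟩
      (B + n * e) + - (n * e)       ≈⟨ +-assoc _ _ _ ⟩
      B + (n * e + - (n * e))       ≈⟨ +-congˡ (-‿inverseʳ _) ⟩
      B + 0#                        ≈⟨ +-identityʳ B ⟩
      B                             ∎
      where
      open RingProps ring using (-‿distribʳ-*)
      n = qnum (suc M)
      B = cB M K
      p = pow R q (suc M)
      e = q * B + pow R q (suc (suc M)) * cD M K
      w = qnum (suc M +ℕ suc (suc K))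
      main : w * B ≈ B + n * e
      main = begin
        w * B                                        ≡⟨ ≡.cong (λ z → qnum z * B) (ℕₚ.+-suc (suc M) (suc K)) ⟩
        (1# + q * qnum (suc M +ℕ suc K)) * B         ≈⟨ *-congʳ (+-congˡ (*-congˡ (qnum-+ (suc M) (suc K)))) ⟩
        (1# + q * (n + p * qnum (suc K))) * B
          ≈⟨ solve 6 (λ o q n p k B → (o :+ q :* (n :+ p :* k)) :* B := o :* B :+ (n :* (q :* B) :+ (q :* p) :* (k :* B))) refl 1# q n p _ B ⟩
        1# * B + (n * (q * B) + (q * p) * (qnum (suc K) * B))
          ≈⟨ +-cong (*-identityˡ B) (+-congˡ (*-congˡ (sym (cD-mul M K)))) ⟩
        B + (n * (q * B) + (q * p) * (n * cD M K))
          ≈⟨ +-congˡ (solve 5 (λ n q B p D → n :* (q :* B) :+ (q :* p) :* (n :* D) := n :* (q :* B :+ (q :* p) :* D)) refl n q B p _) ⟩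
        B + n * e ∎

    gauss-qfac-∸ : ∀ a b → b ≤ a → gauss a b * (qfac (a ∸ℕ b) * qfac b) ≈ qfac a
    gauss-qfac-∸ a b b≤a with ℕₚ.m∸n+n≡m b≤a | gauss-qfac (a ∸ℕ b) b
    ... | eq | p rewrite eq = p

    -- `a` and `b` stand for 3n - 3 and n + k and are tied to them only by equations, so that the
    -- truncated differences of `cDenom` can be matched as they are written.
    qfac-cPoly : ∀ M K a b → a ≡.≡ 3 *ℕ suc M → b ≡.≡ suc M +ℕ suc (suc K) → M ≤ K → b ≤ a →
      qnum (suc M) * qfac b * qfac (a ∸ℕ b) * qfac M * qfac (K ∸ℕ M) * cPoly M K ≈ qfac a * qfac K
    qfac-cPoly M K a b ≡.refl ≡.refl M≤K b≤a = begin
      qnum (suc M) * qfac b * qfac (a ∸ℕ b) * qfac M * qfac (K ∸ℕ M) * cPoly M K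
        ≈⟨ solve 6 (λ n x y z w c → n :* x :* y :* z :* w :* c := (n :* c) :* (x :* y :* z :* w)) refl _ _ _ _ _ _ ⟩
      (qnum (suc M) * cPoly M K) * (qfac b * qfac (a ∸ℕ b) * qfac M * qfac (K ∸ℕ M))
        ≈⟨ *-congʳ (cPoly-mul M K) ⟩
      (gauss a b * gauss K M) * (qfac b * qfac (a ∸ℕ b) * qfac M * qfac (K ∸ℕ M))
        ≈⟨ solve 6 (λ g h x y z w → (g :* h) :* (x :* y :* z :* w) := (g :* (y :* x)) :* (h :* (w :* z))) refl _ _ _ _ _ _ ⟩
      (gauss a b * (qfac (a ∸ℕ b) * qfac b)) * (gauss K M * (qfac (K ∸ℕ M) * qfac M))
        ≈⟨ *-cong (gauss-qfac-∸ a b b≤a) (gauss-qfac-∸ K M M≤K) ⟩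
      qfac a * qfac K ∎

-- The ring of integer polynomials, and evaluation as a ring homomorphism.

module PolyRing where
  open import Defs
  open Gauss
  open import Level using (Level; 0ℓ)
  open import Data.Nat using (ℕ; zero; suc; _≤_) renaming (_+_ to _+ℕ_; _*_ to _*ℕ_; _∸_ to _∸ℕ_)
  import Data.Nat.Properties as ℕₚ
  open import Data.Integer using (ℤ; +_; -[1+_]) renaming (_+_ to _+ℤ_; _*_ to _*ℤ_; -_ to -ℤ_)
  import Data.Integer.Properties as ℤₚ
  open import Data.List using ([]; _∷_; map)
  open import Data.Product using (_,_)
  open import Relation.Binary.PropositionalEquality using (_≡_; refl; sym; trans; cong; cong₂; module ≡-Reasoning)
  open import Algebra.Bundles using (CommutativeRing)
  import Algebra.Properties.Ring as RingProps
  import Relation.Binary.Reasoning.Setoid as SetoidReasoning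

  infix 4 _≋_
  -- Lists that differ by trailing zeros are the same polynomial, hence equality is coefficientwise.
  -- Being a record, it keeps `f` and `g` visible to unification.
  record _≋_ (f g : Poly) : Set where
    constructor pointwise
    field at : ∀ i → coeff f i ≡ coeff g i
  open _≋_

  0ₚ 1ₚ X : Poly
  0ₚ = []
  1ₚ = + 1 ∷ []
  X = + 0 ∷ + 1 ∷ []

  -ₚ_ : Poly → Poly
  -ₚ_ = map -ℤ_

  scale : ℤ → Poly → Poly
  scale a = map (a *ℤ_)

  shift : Poly → Poly
  shift f = + 0 ∷ f

  private
    ≋-trans : ∀ {f g h} → f ≋ g → g ≋ h → f ≋ h
    ≋-trans p r = pointwise λ i → trans (at p i) (at r i)

    ≋-sym : ∀ {f g} → f ≋ g → g ≋ f
    ≋-sym p = pointwise λ i → sym (at p i)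

    ≋-refl : ∀ {f} → f ≋ f
    ≋-refl = pointwise λ _ → refl

  coeff-+ : ∀ f g i → coeff (f +ₚ g) i ≡ coeff f i +ℤ coeff g i
  coeff-+ []      g       i       = sym (ℤₚ.+-identityˡ _)
  coeff-+ (a ∷ f) []      i       = sym (ℤₚ.+-identityʳ _)
  coeff-+ (a ∷ f) (b ∷ g) zero    = refl
  coeff-+ (a ∷ f) (b ∷ g) (suc i) = coeff-+ f g i

  coeff-scale : ∀ a f i → coeff (scale a f) i ≡ a *ℤ coeff f i
  coeff-scale a []      i       = sym (ℤₚ.*-zeroʳ a)
  coeff-scale a (b ∷ f) zero    = refl
  coeff-scale a (b ∷ f) (suc i) = coeff-scale a f i

  coeff-neg : ∀ f i → coeff (-ₚ f) i ≡ -ℤ coeff f i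
  coeff-neg []      i       = refl
  coeff-neg (b ∷ f) zero    = refl
  coeff-neg (b ∷ f) (suc i) = coeff-neg f i

  +ₚ-cong : ∀ {f f′ g g′} → f ≋ f′ → g ≋ g′ → f +ₚ g ≋ f′ +ₚ g′
  +ₚ-cong {f} {f′} {g} {g′} p r = pointwise λ i → trans (coeff-+ f g i) (trans (cong₂ _+ℤ_ (at p i) (at r i)) (sym (coeff-+ f′ g′ i)))

  +ₚ-comm : ∀ f g → f +ₚ g ≋ g +ₚ f
  +ₚ-comm f g = pointwise λ i → trans (coeff-+ f g i) (trans (ℤₚ.+-comm (coeff f i) _) (sym (coeff-+ g f i)))

  +ₚ-assoc : ∀ f g h → (f +ₚ g) +ₚ h ≋ f +ₚ (g +ₚ h)
  +ₚ-assoc f g h = pointwise λ i → begin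
    coeff ((f +ₚ g) +ₚ h) i                   ≡⟨ coeff-+ (f +ₚ g) h i ⟩
    coeff (f +ₚ g) i +ℤ coeff h i             ≡⟨ cong (_+ℤ coeff h i) (coeff-+ f g i) ⟩
    coeff f i +ℤ coeff g i +ℤ coeff h i       ≡⟨ ℤₚ.+-assoc (coeff f i) _ _ ⟩
    coeff f i +ℤ (coeff g i +ℤ coeff h i)     ≡⟨ cong (coeff f i +ℤ_) (coeff-+ g h i) ⟨
    coeff f i +ℤ coeff (g +ₚ h) i             ≡⟨ coeff-+ f (g +ₚ h) i ⟨
    coeff (f +ₚ (g +ₚ h)) i                   ∎
    where open ≡-Reasoning

  +ₚ-identityʳ : ∀ f → f +ₚ [] ≋ f
  +ₚ-identityʳ f = pointwise λ i → trans (coeff-+ f [] i) (ℤₚ.+-identityʳ _)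

  +ₚ-interchange : ∀ f g h k → (f +ₚ g) +ₚ (h +ₚ k) ≋ (f +ₚ h) +ₚ (g +ₚ k)
  +ₚ-interchange f g h k =
    ≋-trans (+ₚ-assoc f g (h +ₚ k)) (≋-trans (+ₚ-cong {f} ≋-refl
      (≋-trans (≋-sym (+ₚ-assoc g h k)) (≋-trans (+ₚ-cong {g +ₚ h} {h +ₚ g} {k} (+ₚ-comm g h) ≋-refl) (+ₚ-assoc h g k))))
      (≋-sym (+ₚ-assoc f h (g +ₚ k))))

  scale-cong : ∀ a {f g} → f ≋ g → scale a f ≋ scale a g
  scale-cong a {f} {g} p = pointwise λ i → trans (coeff-scale a f i) (trans (cong (a *ℤ_) (at p i)) (sym (coeff-scale a g i)))

  scale-+ₚ : ∀ a f g → scale a (f +ₚ g) ≋ scale a f +ₚ scale a g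
  scale-+ₚ a f g = pointwise λ i → begin
    coeff (scale a (f +ₚ g)) i                      ≡⟨ coeff-scale a (f +ₚ g) i ⟩
    a *ℤ coeff (f +ₚ g) i                           ≡⟨ cong (a *ℤ_) (coeff-+ f g i) ⟩
    a *ℤ (coeff f i +ℤ coeff g i)                   ≡⟨ ℤₚ.*-distribˡ-+ a (coeff f i) _ ⟩
    a *ℤ coeff f i +ℤ a *ℤ coeff g i                ≡⟨ cong₂ _+ℤ_ (coeff-scale a f i) (coeff-scale a g i) ⟨
    coeff (scale a f) i +ℤ coeff (scale a g) i      ≡⟨ coeff-+ (scale a f) _ i ⟨
    coeff (scale a f +ₚ scale a g) i                ∎
    where open ≡-Reasoning

  scale-scale : ∀ a b f → scale a (scale b f) ≋ scale (a *ℤ b) f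
  scale-scale a b f = pointwise λ i → trans (coeff-scale a (scale b f) i) (trans (cong (a *ℤ_) (coeff-scale b f i))
    (trans (sym (ℤₚ.*-assoc a b _)) (sym (coeff-scale (a *ℤ b) f i))))

  shift-cong : ∀ {f g} → f ≋ g → shift f ≋ shift g
  shift-cong p = pointwise λ { zero → refl ; (suc i) → at p i }

  shift-+ₚ : ∀ f g → shift (f +ₚ g) ≋ shift f +ₚ shift g
  shift-+ₚ f g = pointwise λ { zero → refl ; (suc i) → refl }

  scale-shift : ∀ a f → scale a (shift f) ≋ shift (scale a f)
  scale-shift a f = pointwise λ { zero → ℤₚ.*-zeroʳ a ; (suc i) → refl }

  *ₚ-congˡ : ∀ f {g h} → g ≋ h → f *ₚ g ≋ f *ₚ h
  *ₚ-congˡ []      p = ≋-refl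
  *ₚ-congˡ (a ∷ f) {g} {h} p = +ₚ-cong {scale a g} (scale-cong a p) (shift-cong (*ₚ-congˡ f p))

  *ₚ-zeroʳ : ∀ f → f *ₚ [] ≋ []
  *ₚ-zeroʳ []      = ≋-refl
  *ₚ-zeroʳ (a ∷ f) = pointwise λ { zero → refl ; (suc i) → at (*ₚ-zeroʳ f) i }

  -- The product recurs on its left factor; this mirror recursion on the right factor is what yields
  -- commutativity.
  *ₚ-∷ʳ : ∀ f b g → f *ₚ (b ∷ g) ≋ scale b f +ₚ shift (f *ₚ g)
  *ₚ-∷ʳ []      b g = pointwise λ { zero → refl ; (suc i) → refl }
  *ₚ-∷ʳ (a ∷ f) b g = pointwise λ
    { zero    → cong (_+ℤ + 0) (ℤₚ.*-comm a b)
    ; (suc i) → at (≋-trans (+ₚ-cong {scale a g} ≋-refl (*ₚ-∷ʳ f b g))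
                   (≋-trans (≋-sym (+ₚ-assoc (scale a g) (scale b f) (shift (f *ₚ g))))
                   (≋-trans (+ₚ-cong (+ₚ-comm (scale a g) (scale b f)) ≋-refl)
                            (+ₚ-assoc (scale b f) (scale a g) (shift (f *ₚ g)))))) i }

  *ₚ-comm : ∀ f g → f *ₚ g ≋ g *ₚ f
  *ₚ-comm []      g = ≋-sym (*ₚ-zeroʳ g)
  *ₚ-comm (a ∷ f) g = ≋-trans (+ₚ-cong {scale a g} ≋-refl (shift-cong (*ₚ-comm f g))) (≋-sym (*ₚ-∷ʳ g a f))

  *ₚ-distribˡ : ∀ f g h → f *ₚ (g +ₚ h) ≋ f *ₚ g +ₚ f *ₚ h
  *ₚ-distribˡ []      g h = ≋-refl
  *ₚ-distribˡ (a ∷ f) g h =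
    ≋-trans (+ₚ-cong {scale a (g +ₚ h)} (scale-+ₚ a g h) (≋-trans (shift-cong (*ₚ-distribˡ f g h)) (shift-+ₚ (f *ₚ g) (f *ₚ h))))
      (+ₚ-interchange (scale a g) (scale a h) (shift (f *ₚ g)) (shift (f *ₚ h)))

  -- Equal left factors may be lists of different lengths, which defeats induction on them;
  -- commutativity moves the change to the right factor.
  *ₚ-cong : ∀ {f f′ g g′} → f ≋ f′ → g ≋ g′ → f *ₚ g ≋ f′ *ₚ g′
  *ₚ-cong {f} {f′} {g} {g′} p r =
    ≋-trans (*ₚ-congˡ f r) (≋-trans (*ₚ-comm f g′) (≋-trans (*ₚ-congˡ g′ p) (*ₚ-comm g′ f′)))

  *ₚ-distribʳ : ∀ f g h → (g +ₚ h) *ₚ f ≋ g *ₚ f +ₚ h *ₚ f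
  *ₚ-distribʳ f g h = ≋-trans (*ₚ-comm (g +ₚ h) f) (≋-trans (*ₚ-distribˡ f g h) (+ₚ-cong {f *ₚ g} (*ₚ-comm f g) (*ₚ-comm f h)))

  scale-*ₚ : ∀ a f g → scale a f *ₚ g ≋ scale a (f *ₚ g)
  scale-*ₚ a []      g = ≋-refl
  scale-*ₚ a (b ∷ f) g =
    ≋-trans (+ₚ-cong {scale (a *ℤ b) g} (≋-sym (scale-scale a b g)) (≋-trans (shift-cong (scale-*ₚ a f g)) (≋-sym (scale-shift a (f *ₚ g)))))
      (≋-sym (scale-+ₚ a (scale b g) (shift (f *ₚ g))))

  shift-*ₚ : ∀ f g → shift f *ₚ g ≋ shift (f *ₚ g)
  shift-*ₚ f g = pointwise λ i → trans (coeff-+ (scale (+ 0) g) (shift (f *ₚ g)) i)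
    (trans (cong (_+ℤ coeff (shift (f *ₚ g)) i) (trans (coeff-scale (+ 0) g i) (ℤₚ.*-zeroˡ (coeff g i)))) (ℤₚ.+-identityˡ _))

  *ₚ-assoc : ∀ f g h → (f *ₚ g) *ₚ h ≋ f *ₚ (g *ₚ h)
  *ₚ-assoc []      g h = ≋-refl
  *ₚ-assoc (a ∷ f) g h =
    ≋-trans (*ₚ-distribʳ h (scale a g) (shift (f *ₚ g)))
      (+ₚ-cong {scale a g *ₚ h} (scale-*ₚ a g h) (≋-trans (shift-*ₚ (f *ₚ g) h) (shift-cong (*ₚ-assoc f g h))))

  *ₚ-identityˡ : ∀ f → 1ₚ *ₚ f ≋ f
  *ₚ-identityˡ f = pointwise λ i → begin
    coeff (scale (+ 1) f +ₚ shift []) i              ≡⟨ coeff-+ (scale (+ 1) f) (shift []) i ⟩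
    coeff (scale (+ 1) f) i +ℤ coeff (shift []) i    ≡⟨ cong₂ _+ℤ_ (trans (coeff-scale (+ 1) f i) (ℤₚ.*-identityˡ _)) (shift0 i) ⟩
    coeff f i +ℤ + 0                                 ≡⟨ ℤₚ.+-identityʳ _ ⟩
    coeff f i                                        ∎
    where
    open ≡-Reasoning
    shift0 : ∀ i → coeff (shift []) i ≡ + 0
    shift0 zero    = refl
    shift0 (suc i) = refl

  polyRing : CommutativeRing 0ℓ 0ℓ
  polyRing = record
    { Carrier = Poly ; _≈_ = _≋_ ; _+_ = _+ₚ_ ; _*_ = _*ₚ_ ; -_ = -ₚ_ ; 0# = 0ₚ ; 1# = 1ₚ
    ; isCommutativeRing = record
      { isRing = record
        { +-isAbelianGroup = record
          { isGroup = record
            { isMonoid = record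
              { isSemigroup = record
                { isMagma = record
                  { isEquivalence = record { refl = ≋-refl ; sym = ≋-sym ; trans = ≋-trans }
                  ; ∙-cong = +ₚ-cong }
                ; assoc = +ₚ-assoc }
              ; identity = (λ f → ≋-refl) , +ₚ-identityʳ }
            ; inverse = (λ f → pointwise λ i → trans (coeff-+ (-ₚ f) f i) (trans (cong (_+ℤ coeff f i) (coeff-neg f i)) (ℤₚ.+-inverseˡ (coeff f i))))
                      , (λ f → pointwise λ i → trans (coeff-+ f (-ₚ f) i) (trans (cong (coeff f i +ℤ_) (coeff-neg f i)) (ℤₚ.+-inverseʳ (coeff f i))))
            ; ⁻¹-cong = λ {f} {g} p → pointwise λ i → trans (coeff-neg f i) (trans (cong -ℤ_ (at p i)) (sym (coeff-neg g i))) }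
          ; comm = +ₚ-comm }
        ; *-cong = *ₚ-cong
        ; *-assoc = *ₚ-assoc
        ; *-identity = *ₚ-identityˡ , (λ f → ≋-trans (*ₚ-comm f 1ₚ) (*ₚ-identityˡ f))
        ; distrib = *ₚ-distribˡ , *ₚ-distribʳ }
      ; *-comm = *ₚ-comm } }

  -- The formulas at the indeterminate: `PG.cPoly` is the polynomial C of the theorem.
  module PG = GaussianBinomials polyRing X

  X-*ₚ : ∀ f → X *ₚ f ≋ shift f
  X-*ₚ f = ≋-trans (shift-*ₚ 1ₚ f) (shift-cong (*ₚ-identityˡ f))

  qint-qnum : ∀ m → qint m ≋ PG.qnum m
  qint-qnum zero    = ≋-refl
  qint-qnum (suc m) = pointwise λ i → trans (lemma i) (sym (coeff-+ 1ₚ (X *ₚ PG.qnum m) i))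
    where
    lemma : ∀ i → coeff (qint (suc m)) i ≡ coeff 1ₚ i +ℤ coeff (X *ₚ PG.qnum m) i
    lemma zero    = sym (cong (+ 1 +ℤ_) (at (X-*ₚ (PG.qnum m)) 0))
    lemma (suc i) = trans (at (qint-qnum m) i) (trans (sym (at (X-*ₚ (PG.qnum m)) (suc i))) (sym (ℤₚ.+-identityˡ _)))

  qfact-qfac : ∀ m → qfact m ≋ PG.qfac m
  qfact-qfac zero    = ≋-refl
  qfact-qfac (suc m) = *ₚ-cong {qint (suc m)} (qint-qnum (suc m)) (qfact-qfac m)

  module Evaluation {c ℓ : Level} (R : CommutativeRing c ℓ) (ω : CommutativeRing.Carrier R) where
    open CommutativeRing R using (Carrier; _≈_; 0#; 1#; _+_; _*_; -_; +-cong; +-congˡ; +-congʳ; *-cong; *-congˡ; *-congʳ;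
      +-assoc; +-comm; +-identityˡ; +-identityʳ; *-assoc; *-identityˡ; *-identityʳ; zeroˡ; zeroʳ; distribˡ; distribʳ; -‿inverseˡ; -‿inverseʳ; -‿cong; setoid; ring; commutativeSemiring)
      renaming (refl to ≈-refl; sym to ≈-sym; trans to ≈-trans)
    open RingProps ring using (-‿distribʳ-*; -‿distribˡ-*; -‿involutive; -0#≈0#; -‿+-comm)
    open SetoidReasoning setoid
    open GaussianBinomials R ω

    ev : Poly → Carrier
    ev f = evalP R f ω

    intR-neg : ∀ a → intR R (-ℤ a) ≈ - intR R a
    intR-neg (+ zero)  = ≈-sym -0#≈0#
    intR-neg (+ suc m) = ≈-refl
    intR-neg -[1+ m ]  = ≈-sym (-‿involutive _)

    private
      -- Addition of integers of mixed sign is a difference of naturals; additivity of `intR` there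
      -- comes down to cancelling a common successor.
      intR-⊖ : ∀ a b → intR R (a Data.Integer.⊖ b) ≈ natR R a + - natR R b
      intR-⊖ a zero = ≈-trans (≈-sym (+-identityʳ _)) (+-congˡ (≈-sym -0#≈0#))
      intR-⊖ zero (suc b) = ≈-sym (+-identityˡ _)
      intR-⊖ (suc a) (suc b) rewrite ℤₚ.[1+m]⊖[1+n]≡m⊖n a b = begin
        intR R (a Data.Integer.⊖ b)                       ≈⟨ intR-⊖ a b ⟩
        natR R a + - natR R b                             ≈⟨ +-congʳ (≈-trans (+-congʳ (-‿inverseˡ 1#)) (+-identityˡ _)) ⟨
        (- 1# + 1# + natR R a) + - natR R b               ≈⟨ +-congʳ (+-assoc _ _ _) ⟩
        (- 1# + (1# + natR R a)) + - natR R b             ≈⟨ +-congʳ (+-comm _ _) ⟩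
        ((1# + natR R a) + - 1#) + - natR R b             ≈⟨ +-assoc _ _ _ ⟩
        (1# + natR R a) + (- 1# + - natR R b)             ≈⟨ +-congˡ (-‿+-comm _ _) ⟩
        (1# + natR R a) + - (1# + natR R b)               ∎

    intR-+ : ∀ a b → intR R (a +ℤ b) ≈ intR R a + intR R b
    intR-+ (+ a)    (+ b)    = natR-+ a b
    intR-+ (+ a)    -[1+ b ] = intR-⊖ a (suc b)
    intR-+ -[1+ a ] (+ b)    = ≈-trans (intR-⊖ b (suc a)) (+-comm _ _)
    intR-+ -[1+ a ] -[1+ b ] =
      ≈-trans (-‿cong (≈-trans (CommutativeRing.reflexive R (cong (λ z → natR R (suc z)) (sym (ℕₚ.+-suc a b)))) (natR-+ (suc a) (suc b))))
        (≈-sym (-‿+-comm _ _))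

    intR-ℕ* : ∀ m b → intR R (+ m *ℤ b) ≈ natR R m * intR R b
    intR-ℕ* zero    b rewrite ℤₚ.*-zeroˡ b = ≈-sym (zeroˡ _)
    intR-ℕ* (suc m) b rewrite ℤₚ.suc-* (+ m) b = begin
      intR R (b +ℤ + m *ℤ b)               ≈⟨ intR-+ b (+ m *ℤ b) ⟩
      intR R b + intR R (+ m *ℤ b)         ≈⟨ +-cong (≈-sym (*-identityˡ _)) (intR-ℕ* m b) ⟩
      1# * intR R b + natR R m * intR R b  ≈⟨ distribʳ _ _ _ ⟨
      (1# + natR R m) * intR R b           ∎

    intR-* : ∀ a b → intR R (a *ℤ b) ≈ intR R a * intR R b
    intR-* (+ a)    b = intR-ℕ* a b
    intR-* -[1+ a ] b rewrite sym (ℤₚ.neg-distribˡ-* (+ suc a) b) =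
      ≈-trans (intR-neg (+ suc a *ℤ b)) (≈-trans (-‿cong (intR-ℕ* (suc a) b)) (-‿distribˡ-* _ _))

    ev-+ : ∀ f g → ev (f +ₚ g) ≈ ev f + ev g
    ev-+ []      g       = ≈-sym (+-identityˡ _)
    ev-+ (a ∷ f) []      = ≈-sym (+-identityʳ _)
    ev-+ (a ∷ f) (b ∷ g) = begin
      intR R (a +ℤ b) + ω * ev (f +ₚ g)                   ≈⟨ +-cong (intR-+ a b) (*-congˡ (ev-+ f g)) ⟩
      (intR R a + intR R b) + ω * (ev f + ev g)           ≈⟨ +-congˡ (distribˡ _ _ _) ⟩
      (intR R a + intR R b) + (ω * ev f + ω * ev g)       ≈⟨ +-assoc _ _ _ ⟩
      intR R a + (intR R b + (ω * ev f + ω * ev g))       ≈⟨ +-congˡ (+-comm _ _) ⟩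
      intR R a + ((ω * ev f + ω * ev g) + intR R b)       ≈⟨ +-congˡ (+-assoc _ _ _) ⟩
      intR R a + (ω * ev f + (ω * ev g + intR R b))       ≈⟨ +-congˡ (+-congˡ (+-comm _ _)) ⟩
      intR R a + (ω * ev f + (intR R b + ω * ev g))       ≈⟨ +-assoc _ _ _ ⟨
      (intR R a + ω * ev f) + (intR R b + ω * ev g)       ∎

    ev-scale : ∀ a f → ev (scale a f) ≈ intR R a * ev f
    ev-scale a []      = ≈-sym (zeroʳ _)
    ev-scale a (b ∷ f) = begin
      intR R (a *ℤ b) + ω * ev (scale a f)            ≈⟨ +-cong (intR-* a b) (*-congˡ (ev-scale a f)) ⟩
      intR R a * intR R b + ω * (intR R a * ev f)     ≈⟨ +-congˡ (≈-sym (*-assoc _ _ _)) ⟩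
      intR R a * intR R b + (ω * intR R a) * ev f     ≈⟨ +-congˡ (*-congʳ (CommutativeRing.*-comm R _ _)) ⟩
      intR R a * intR R b + (intR R a * ω) * ev f     ≈⟨ +-congˡ (*-assoc _ _ _) ⟩
      intR R a * intR R b + intR R a * (ω * ev f)     ≈⟨ distribˡ _ _ _ ⟨
      intR R a * (intR R b + ω * ev f)                ∎

    ev-* : ∀ f g → ev (f *ₚ g) ≈ ev f * ev g
    ev-* []      g = ≈-sym (zeroˡ _)
    ev-* (a ∷ f) g = begin
      ev (scale a g +ₚ shift (f *ₚ g))              ≈⟨ ev-+ (scale a g) (shift (f *ₚ g)) ⟩
      ev (scale a g) + (0# + ω * ev (f *ₚ g))       ≈⟨ +-cong (ev-scale a g) (≈-trans (+-identityˡ _) (*-congˡ (ev-* f g))) ⟩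
      intR R a * ev g + ω * (ev f * ev g)           ≈⟨ +-congˡ (*-assoc _ _ _) ⟨
      intR R a * ev g + ω * ev f * ev g             ≈⟨ distribʳ _ _ _ ⟨
      (intR R a + ω * ev f) * ev g                  ∎

    ev-neg : ∀ f → ev (-ₚ f) ≈ - ev f
    ev-neg []      = ≈-sym -0#≈0#
    ev-neg (a ∷ f) = begin
      intR R (-ℤ a) + ω * ev (-ₚ f)       ≈⟨ +-cong (intR-neg a) (*-congˡ (ev-neg f)) ⟩
      - intR R a + ω * - ev f             ≈⟨ +-congˡ (≈-sym (-‿distribʳ-* ω (ev f))) ⟩
      - intR R a + - (ω * ev f)           ≈⟨ -‿+-comm _ _ ⟩
      - (intR R a + ω * ev f)             ∎

    ev-1 : ev 1ₚ ≈ 1#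
    ev-1 = ≈-trans (+-cong (+-identityʳ 1#) (zeroʳ ω)) (+-identityʳ 1#)

    ev-X : ev X ≈ ω
    ev-X = ≈-trans (+-identityˡ _) (≈-trans (*-congˡ ev-1) (*-identityʳ ω))

    ev-pow : ∀ m → ev (pow polyRing X m) ≈ pow R ω m
    ev-pow zero    = ev-1
    ev-pow (suc m) = ≈-trans (ev-* X (pow polyRing X m)) (*-cong ev-X (ev-pow m))

    ev-gauss : ∀ a b → ev (PG.gauss a b) ≈ gauss a b
    ev-gauss a       zero    = ev-1
    ev-gauss zero    (suc b) = ≈-refl
    ev-gauss (suc a) (suc b) = begin
      ev (PG.gauss a b +ₚ pow polyRing X (suc b) *ₚ PG.gauss a (suc b))       ≈⟨ ev-+ (PG.gauss a b) _ ⟩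
      ev (PG.gauss a b) + ev (pow polyRing X (suc b) *ₚ PG.gauss a (suc b))   ≈⟨ +-cong (ev-gauss a b) (ev-* (pow polyRing X (suc b)) _) ⟩
      gauss a b + ev (pow polyRing X (suc b)) * ev (PG.gauss a (suc b))       ≈⟨ +-congˡ (*-cong (ev-pow (suc b)) (ev-gauss a (suc b))) ⟩
      gauss (suc a) (suc b)                                                   ∎

    -- `cPoly` is built by ring operations from q alone, and these commute with evaluation.
    ev-cPoly : ∀ M K → ev (PG.cPoly M K) ≈ cPoly M K
    ev-cPoly M K = begin
      ev (PG.cA M K +ₚ -ₚ t)            ≈⟨ ev-+ (PG.cA M K) (-ₚ t) ⟩
      ev (PG.cA M K) + ev (-ₚ t)        ≈⟨ +-cong evA (≈-trans (ev-neg t) (-‿cong evt)) ⟩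
      cPoly M K                         ∎
      where
      t = X *ₚ PG.cB M K +ₚ pow polyRing X (suc (suc M)) *ₚ PG.cD M K
      evgg : ∀ a b a′ b′ → ev (PG.gauss a b *ₚ PG.gauss a′ b′) ≈ gauss a b * gauss a′ b′
      evgg a b a′ b′ = ≈-trans (ev-* (PG.gauss a b) (PG.gauss a′ b′)) (*-cong (ev-gauss a b) (ev-gauss a′ b′))
      G : Poly
      G = 1ₚ +ₚ pow polyRing X (suc M) +ₚ pow polyRing X (suc M +ℕ suc M)
      evA : ev (PG.cA M K) ≈ cA M K
      evA = ≈-trans (ev-* G (PG.gauss (2 +ℕ 3 *ℕ M) (suc M +ℕ suc K) *ₚ PG.gauss K M))
        (*-cong (≈-trans (ev-+ (1ₚ +ₚ pow polyRing X (suc M)) _)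
                         (+-cong (≈-trans (ev-+ 1ₚ (pow polyRing X (suc M))) (+-cong ev-1 (ev-pow (suc M)))) (ev-pow (suc M +ℕ suc M))))
                (evgg (2 +ℕ 3 *ℕ M) (suc M +ℕ suc K) K M))
      evt : ev t ≈ ω * cB M K + pow R ω (suc (suc M)) * cD M K
      evt = ≈-trans (ev-+ (X *ₚ PG.cB M K) _)
        (+-cong (≈-trans (ev-* X (PG.cB M K)) (*-cong ev-X (evgg (3 *ℕ suc M) (suc M +ℕ suc (suc K)) K M)))
                (≈-trans (ev-* (pow polyRing X (suc (suc M))) (PG.cD M K))
                  (*-cong (ev-pow (suc (suc M))) (evgg (3 *ℕ suc M) (suc M +ℕ suc (suc K)) (suc K) (suc M)))))

  private
    quotient-mul : ∀ M K a b → a ≡ 3 *ℕ suc M → b ≡ suc M +ℕ suc (suc K) → M ≤ K → b ≤ a →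
      qint (suc M) *ₚ qfact b *ₚ qfact (a ∸ℕ b) *ₚ qfact M *ₚ qfact (K ∸ℕ M) *ₚ PG.cPoly M K ≋ qfact a *ₚ qfact K
    quotient-mul M K a b p r M≤K b≤a =
      ≋-trans (*-cong (*-cong (*-cong (*-cong (*-cong (qint-qnum (suc M)) (qfact-qfac b))
          (qfact-qfac (a ∸ℕ b))) (qfact-qfac M)) (qfact-qfac (K ∸ℕ M))) ≋-refl)
        (≋-trans (PG.qfac-cPoly M K a b p r M≤K b≤a)
          (≋-sym (*-cong (qfact-qfac a) (qfact-qfac K))))
      where open CommutativeRing polyRing using (*-cong)

  cDenom-cPoly : ∀ M K → M ≤ K → suc M +ℕ suc (suc K) ≤ 3 *ℕ suc M →
    cDenom (2 +ℕ M) (suc K) *ₚ PG.cPoly M K ≋ cNumer (2 +ℕ M) (suc K)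
  cDenom-cPoly M K M≤K b≤a = quotient-mul M K _ _ a-eq b-eq M≤K
    (ℕₚ.≤-trans (ℕₚ.≤-reflexive b-eq) (ℕₚ.≤-trans b≤a (ℕₚ.≤-reflexive (sym a-eq))))
    where
    a-eq : 3 *ℕ (2 +ℕ M) ∸ℕ 3 ≡ 3 *ℕ suc M
    a-eq = cong (_∸ℕ 3) (ℕₚ.*-suc 3 (suc M))
    b-eq : (2 +ℕ M) +ℕ suc K ≡ suc M +ℕ suc (suc K)
    b-eq = sym (ℕₚ.+-suc (suc M) (suc K))

-- Values at roots of unity by the q-Lucas theorem.

module Roots where
  open import Defs
  open Gauss
  open import Level using (Level)
  open import Data.Nat using (ℕ; zero; suc; _<_; z≤n; s≤s; _≤?_) renaming (_+_ to _+ℕ_; _*_ to _*ℕ_)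
  import Data.Nat.Properties as ℕₚ
  open import Data.Product using (proj₁; proj₂)
  open import Data.Sum using (inj₁; inj₂)
  open import Data.Empty using (⊥-elim)
  open import Relation.Nullary using (¬_; yes; no)
  open import Relation.Binary.PropositionalEquality as ≡ using (_≡_)
  open import Algebra.Bundles using (CommutativeRing)
  open import Data.Nat.Tactic.RingSolver using (solve-∀)
  import Algebra.Solver.Ring.NaturalCoefficients.Default as NatSolver
  import Algebra.Properties.Ring as RingProps
  import Relation.Binary.Reasoning.Setoid as SetoidReasoning

  module RootOfUnity {c ℓ : Level} (R : CommutativeRing c ℓ) (dom : IsDomainChar0 R)
                     (d-1 : ℕ) (ω : CommutativeRing.Carrier R) (prim : PrimitiveRoot R (suc d-1) ω) where
    open CommutativeRing R hiding (zero)
    open RingProps ring using (-‿distribʳ-*; x∙y⁻¹≈ε⇒x≈y; +-cancelˡ; +-cancelʳ)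
    open NatSolver commutativeSemiring using (solve; _:+_; _:*_; _:=_)
    open SetoidReasoning setoid
    open GaussianBinomials R ω

    private
      d : ℕ
      d = suc d-1

    *-cancelˡ-≉0 : ∀ x {y z} → ¬ (x ≈ 0#) → x * y ≈ x * z → y ≈ z
    *-cancelˡ-≉0 x {y} {z} x≉0 eq with proj₁ dom x (y + - z) (begin
      x * (y + - z)          ≈⟨ distribˡ _ _ _ ⟩
      x * y + x * - z        ≈⟨ +-cong eq (sym (-‿distribʳ-* x z)) ⟩
      x * z + - (x * z)      ≈⟨ -‿inverseʳ _ ⟩
      0#                     ∎)
    ... | inj₁ x≈0 = ⊥-elim (x≉0 x≈0)
    ... | inj₂ y-z≈0 = x∙y⁻¹≈ε⇒x≈y y z y-z≈0

    ω^d≈1 : pow R ω d ≈ 1#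
    ω^d≈1 = proj₁ prim

    -- The telescoping identity (ω - 1) [j] = ω^j - 1 without subtraction.
    qnum-telescope : ∀ j → 1# + ω * qnum j ≈ qnum j + pow R ω j
    qnum-telescope j = begin
      qnum (suc j)                    ≡⟨ ≡.cong qnum (ℕₚ.+-comm 1 j) ⟩
      qnum (j +ℕ 1)                   ≈⟨ qnum-+ j 1 ⟩
      qnum j + pow R ω j * qnum 1     ≈⟨ +-congˡ (trans (*-congˡ qnum-1) (*-identityʳ _)) ⟩
      qnum j + pow R ω j              ∎

    -- By the telescoping identity, [j] = 0 would give ω^j = 1.
    qnum≉0 : ∀ j → 0 < j → j < d → ¬ (qnum j ≈ 0#)
    qnum≉0 j 0<j j<d j≈0 = proj₂ prim j 0<j j<d (begin
      pow R ω j             ≈⟨ +-identityˡ _ ⟨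
      0# + pow R ω j        ≈⟨ +-congʳ j≈0 ⟨
      qnum j + pow R ω j    ≈⟨ qnum-telescope j ⟨
      1# + ω * qnum j       ≈⟨ +-congˡ (trans (*-congˡ j≈0) (zeroʳ ω)) ⟩
      1# + 0#               ≈⟨ +-identityʳ 1# ⟩
      1#                    ∎)

    -- (ω - 1) [d] = ω^d - 1 = 0, and ω is not 1 because d > 1. For d = 1 the value would be 1.
    qnum-d≈0 : 1 < d → qnum d ≈ 0#
    qnum-d≈0 1<d with proj₁ dom (ω + - 1#) (qnum d) (begin
      (ω + - 1#) * qnum d              ≈⟨ distribʳ _ _ _ ⟩
      ω * qnum d + - 1# * qnum d       ≈⟨ +-cong lemma (sym (RingProps.-‿distribˡ-* ring 1# (qnum d))) ⟩
      qnum d + - (1# * qnum d)         ≈⟨ +-congˡ (-‿cong (*-identityˡ _)) ⟩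
      qnum d + - qnum d                ≈⟨ -‿inverseʳ _ ⟩
      0#                               ∎)
      where
      lemma : ω * qnum d ≈ qnum d
      lemma = +-cancelˡ 1# _ _ (trans (qnum-telescope d) (trans (+-congˡ ω^d≈1) (+-comm _ _)))
    ... | inj₂ p = p
    ... | inj₁ p = ⊥-elim (proj₂ prim 1 (s≤s z≤n) 1<d (trans (*-identityʳ ω) (x∙y⁻¹≈ε⇒x≈y ω 1# p)))

    -- Absorption writes [j+1] times this binomial as a multiple of [d] = 0, while [j+1] is not 0.
    gauss-d≈0 : ∀ j → suc j < d → gauss d (suc j) ≈ 0#
    gauss-d≈0 j j<d = *-cancelˡ-≉0 (qnum (suc j)) (qnum≉0 (suc j) (s≤s z≤n) j<d) (begin
      qnum (suc j) * gauss d (suc j)   ≈⟨ gauss-absorb d-1 j ⟩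
      qnum d * gauss d-1 j             ≈⟨ *-congʳ (qnum-d≈0 (ℕₚ.≤-trans (s≤s (s≤s z≤n)) j<d)) ⟩
      0# * gauss d-1 j                 ≈⟨ zeroˡ _ ⟩
      0#                               ≈⟨ zeroʳ _ ⟨
      qnum (suc j) * 0#                ∎)

    -- In the q-Vandermonde expansion for the top entry d + x, only the terms taking none or all of
    -- the first d elements survive, each with coefficient 1. This lemma and its companion obtain
    -- that directly, by Pascal induction on `x`.
    gauss-d+-low : ∀ x y → y < d → gauss (d +ℕ x) y ≈ gauss x y
    gauss-d+-high : ∀ x y → gauss (d +ℕ x) (d +ℕ y) ≈ gauss x (d +ℕ y) + gauss x y

    gauss-d+-low x       zero    _   = refl
    gauss-d+-low zero    (suc y) y<d = trans (reflexive (≡.cong (λ z → gauss z (suc y)) (ℕₚ.+-identityʳ d))) (gauss-d≈0 y y<d)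
    gauss-d+-low (suc x) (suc y) y<d = trans (reflexive (≡.cong (λ z → gauss z (suc y)) (ℕₚ.+-suc d x)))
      (+-cong (gauss-d+-low x y (ℕₚ.<-trans (ℕₚ.n<1+n y) y<d)) (*-congˡ (gauss-d+-low x (suc y) y<d)))

    gauss-d+-high zero zero = begin
      gauss (d +ℕ 0) (d +ℕ 0)       ≈⟨ gauss-diag (d +ℕ 0) ⟩
      1#                            ≈⟨ +-identityˡ 1# ⟨
      0# + 1#                       ∎
    gauss-d+-high zero (suc y) = begin
      gauss (d +ℕ 0) (d +ℕ suc y)   ≈⟨ gauss-> (d +ℕ 0) (d +ℕ suc y) (ℕₚ.+-monoʳ-< d (s≤s z≤n)) ⟩
      0#                            ≈⟨ +-identityˡ 0# ⟨
      0# + 0#                       ∎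
    gauss-d+-high (suc x) zero = begin
      gauss (d +ℕ suc x) (d +ℕ 0)
        ≡⟨ ≡.cong₂ gauss (ℕₚ.+-suc d x) (ℕₚ.+-identityʳ d) ⟩
      gauss (d +ℕ x) d-1 + pow R ω d * gauss (d +ℕ x) d
        ≈⟨ +-cong (gauss-d+-low x d-1 ℕₚ.≤-refl) (*-congˡ (≡.subst (λ z → gauss (d +ℕ x) z ≈ gauss x z + 1#) (ℕₚ.+-identityʳ d) (gauss-d+-high x 0))) ⟩
      gauss x d-1 + pow R ω d * (gauss x d + 1#)
        ≈⟨ solve 4 (λ a b c e → a :+ b :* (c :+ e) := (a :+ b :* c) :+ b :* e) refl _ _ _ _ ⟩
      (gauss x d-1 + pow R ω d * gauss x d) + pow R ω d * 1#
        ≈⟨ +-congˡ (trans (*-identityʳ _) ω^d≈1) ⟩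
      gauss (suc x) d + 1#
        ≡⟨ ≡.cong (λ z → gauss (suc x) z + 1#) (≡.sym (ℕₚ.+-identityʳ d)) ⟩
      gauss (suc x) (d +ℕ 0) + 1# ∎
    gauss-d+-high (suc x) (suc y) = begin
      gauss (d +ℕ suc x) (d +ℕ suc y)
        ≡⟨ ≡.cong₂ gauss (ℕₚ.+-suc d x) (ℕₚ.+-suc d y) ⟩
      gauss (d +ℕ x) (d +ℕ y) + pow R ω (suc (d +ℕ y)) * gauss (d +ℕ x) (suc (d +ℕ y))
        ≈⟨ +-cong (gauss-d+-high x y) (*-congˡ (≡.subst (λ z → gauss (d +ℕ x) z ≈ gauss x z + gauss x (suc y)) (ℕₚ.+-suc d y) (gauss-d+-high x (suc y)))) ⟩
      (gauss x (d +ℕ y) + gauss x y) + pow R ω (suc (d +ℕ y)) * (gauss x (suc (d +ℕ y)) + gauss x (suc y))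
        ≈⟨ solve 5 (λ a b p e f → (a :+ b) :+ p :* (e :+ f) := (a :+ p :* e) :+ (b :+ p :* f)) refl _ _ _ _ _ ⟩
      gauss (suc x) (suc (d +ℕ y)) + (gauss x y + pow R ω (suc (d +ℕ y)) * gauss x (suc y))
        ≈⟨ +-congˡ (+-congˡ (*-congʳ powd)) ⟩
      gauss (suc x) (suc (d +ℕ y)) + gauss (suc x) (suc y)
        ≡⟨ ≡.cong (λ z → gauss (suc x) z + gauss (suc x) (suc y)) (≡.sym (ℕₚ.+-suc d y)) ⟩
      gauss (suc x) (d +ℕ suc y) + gauss (suc x) (suc y) ∎
      where
      powd : pow R ω (suc (d +ℕ y)) ≈ pow R ω (suc y)
      powd = trans (reflexive (≡.cong (pow R ω) (≡.sym (ℕₚ.+-suc d y)))) (trans (pow-+ d (suc y)) (trans (*-congʳ ω^d≈1) (*-identityˡ _)))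

    -- Each full d in the top entry is removed by `gauss-d+-low` or `gauss-d+-high`, and this
    -- reproduces Pascal's rule on the quotients `A` and `B`.
    lucas : ∀ A B a b → a < d → b < d → gauss (A *ℕ d +ℕ a) (B *ℕ d +ℕ b) ≈ natR R (binom A B) * gauss a b
    lucas zero zero a b _ _ = sym (trans (*-congʳ (+-identityʳ 1#)) (*-identityˡ _))
    lucas zero (suc B) a b a<d _ = trans (gauss-> a _ (ℕₚ.<-≤-trans a<d (ℕₚ.≤-trans (ℕₚ.m≤m+n d (B *ℕ d)) (ℕₚ.m≤m+n _ b)))) (sym (zeroˡ _))
    lucas (suc A) zero a b a<d b<d = trans (reflexive (≡.cong (λ z → gauss z b) (ℕₚ.+-assoc d (A *ℕ d) a)))
      (trans (gauss-d+-low (A *ℕ d +ℕ a) b b<d) (trans (lucas A zero a b a<d b<d) (reflexive (≡.cong (λ z → natR R z * gauss a b) (binom-0 A)))))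
      where
      binom-0 : ∀ A → binom A 0 ≡ 1
      binom-0 zero = ≡.refl
      binom-0 (suc A) = ≡.refl
    lucas (suc A) (suc B) a b a<d b<d = begin
      gauss (suc A *ℕ d +ℕ a) (suc B *ℕ d +ℕ b)
        ≡⟨ ≡.cong₂ gauss (ℕₚ.+-assoc d (A *ℕ d) a) (ℕₚ.+-assoc d (B *ℕ d) b) ⟩
      gauss (d +ℕ (A *ℕ d +ℕ a)) (d +ℕ (B *ℕ d +ℕ b))
        ≈⟨ gauss-d+-high (A *ℕ d +ℕ a) (B *ℕ d +ℕ b) ⟩
      gauss (A *ℕ d +ℕ a) (d +ℕ (B *ℕ d +ℕ b)) + gauss (A *ℕ d +ℕ a) (B *ℕ d +ℕ b)
        ≡⟨ ≡.cong (λ z → gauss (A *ℕ d +ℕ a) z + gauss (A *ℕ d +ℕ a) (B *ℕ d +ℕ b)) (≡.sym (ℕₚ.+-assoc d (B *ℕ d) b)) ⟩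
      gauss (A *ℕ d +ℕ a) (suc B *ℕ d +ℕ b) + gauss (A *ℕ d +ℕ a) (B *ℕ d +ℕ b)
        ≈⟨ +-cong (lucas A (suc B) a b a<d b<d) (lucas A B a b a<d b<d) ⟩
      natR R (binom A (suc B)) * gauss a b + natR R (binom A B) * gauss a b
        ≈⟨ trans (+-comm _ _) (sym (distribʳ _ _ _)) ⟩
      (natR R (binom A B) + natR R (binom A (suc B))) * gauss a b
        ≈⟨ *-congʳ (natR-+ (binom A B) (binom A (suc B))) ⟨
      natR R (binom (suc A) (suc B)) * gauss a b ∎

    qnum-mod : ∀ A x → 1 < d → qnum (A *ℕ d +ℕ x) ≈ qnum x
    qnum-mod zero    x _   = refl
    qnum-mod (suc A) x 1<d = begin
      qnum (suc A *ℕ d +ℕ x)                          ≡⟨ ≡.cong qnum (ℕₚ.+-assoc d (A *ℕ d) x) ⟩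
      qnum (d +ℕ (A *ℕ d +ℕ x))                       ≈⟨ qnum-+ d (A *ℕ d +ℕ x) ⟩
      qnum d + pow R ω d * qnum (A *ℕ d +ℕ x)         ≈⟨ +-cong (qnum-d≈0 1<d) (*-cong ω^d≈1 (qnum-mod A x 1<d)) ⟩
      0# + 1# * qnum x                                ≈⟨ trans (+-identityˡ _) (*-identityˡ _) ⟩
      qnum x                                          ∎

    gauss-subdiag : ∀ x → gauss (suc x) x ≈ qnum (suc x)
    gauss-subdiag zero    = sym qnum-1
    gauss-subdiag (suc x) = begin
      gauss (suc x) x + pow R ω (suc x) * gauss (suc x) (suc x)   ≈⟨ +-cong (gauss-subdiag x) (trans (*-congˡ (gauss-diag (suc x))) (*-identityʳ _)) ⟩
      qnum (suc x) + pow R ω (suc x)                              ≈⟨ qnum-telescope (suc x) ⟨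
      qnum (suc (suc x))                                          ∎

    -- [N] stays uncancelled here: its value, and the reason why it is not 0, depend on d.
    cPoly-lucas : ∀ M K A B A′ B′ {a b a′ b′} → a < d → b < d → a′ < d → b′ < d →
      3 *ℕ suc M ≡ A *ℕ d +ℕ a → suc M +ℕ suc (suc K) ≡ B *ℕ d +ℕ b → K ≡ A′ *ℕ d +ℕ a′ → M ≡ B′ *ℕ d +ℕ b′ →
      qnum (suc M) * cPoly M K ≈ natR R (binom A B *ℕ binom A′ B′) * (gauss a b * gauss a′ b′)
    cPoly-lucas M K A B A′ B′ {a} {b} {a′} {b′} a< b< a′< b′< p r s t = begin
      qnum (suc M) * cPoly M K                                                  ≈⟨ cPoly-mul M K ⟩
      gauss (3 *ℕ suc M) (suc M +ℕ suc (suc K)) * gauss K M                     ≡⟨ ≡.cong₂ _*_ (≡.cong₂ gauss p r) (≡.cong₂ gauss s t) ⟩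
      gauss (A *ℕ d +ℕ a) (B *ℕ d +ℕ b) * gauss (A′ *ℕ d +ℕ a′) (B′ *ℕ d +ℕ b′) ≈⟨ *-cong (lucas A B a b a< b<) (lucas A′ B′ a′ b′ a′< b′<) ⟩
      (natR R (binom A B) * gauss a b) * (natR R (binom A′ B′) * gauss a′ b′)
        ≈⟨ solve 4 (λ x g y h → (x :* g) :* (y :* h) := (x :* y) :* (g :* h)) refl _ _ _ _ ⟩
      (natR R (binom A B) * natR R (binom A′ B′)) * (gauss a b * gauss a′ b′)   ≈⟨ *-congʳ (natR-* (binom A B) (binom A′ B′)) ⟨
      natR R (binom A B *ℕ binom A′ B′) * (gauss a b * gauss a′ b′)             ∎

  module _ {c ℓ : Level} (R : CommutativeRing c ℓ) (dom : IsDomainChar0 R) (ω : CommutativeRing.Carrier R) where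
    open CommutativeRing R hiding (zero)
    open SetoidReasoning setoid
    open GaussianBinomials R ω

    -- At ω = 1 Gaussian binomials are ordinary ones. This is the q-Lucas theorem for d = 1 with all
    -- remainders 0, and [N] becomes N.
    cPoly-at-1 : PrimitiveRoot R 1 ω → ∀ M K x → suc M *ℕ x ≡ binom (3 *ℕ suc M) (suc M +ℕ suc (suc K)) *ℕ binom K M →
      cPoly M K ≈ natR R x
    cPoly-at-1 prim M K x eq = *-cancelˡ-≉0 (natR R (suc M)) (λ z → sucM≢0 (proj₂ dom (suc M) z)) (begin
      natR R (suc M) * cPoly M K                                        ≈⟨ *-congʳ (qnum≈natR (suc M)) ⟨
      qnum (suc M) * cPoly M K
        ≈⟨ cPoly-lucas M K (3 *ℕ suc M) (suc M +ℕ suc (suc K)) K M {0} {0} {0} {0} (s≤s z≤n) (s≤s z≤n) (s≤s z≤n) (s≤s z≤n) (one _) (one _) (one _) (one _) ⟩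
      natR R (binom (3 *ℕ suc M) (suc M +ℕ suc (suc K)) *ℕ binom K M) * (1# * 1#)   ≈⟨ trans (*-congˡ (*-identityˡ 1#)) (*-identityʳ _) ⟩
      natR R (binom (3 *ℕ suc M) (suc M +ℕ suc (suc K)) *ℕ binom K M)   ≡⟨ ≡.cong (natR R) eq ⟨
      natR R (suc M *ℕ x)                                               ≈⟨ natR-* (suc M) x ⟩
      natR R (suc M) * natR R x                                         ∎)
      where
      open RootOfUnity R dom 0 ω prim
      sucM≢0 : ¬ (suc M ≡ 0)
      sucM≢0 ()
      one : ∀ x → x ≡ x *ℕ 1 +ℕ 0
      one x = ≡.sym (≡.trans (ℕₚ.+-identityʳ _) (ℕₚ.*-identityʳ x))
      qnum≈natR : ∀ m → qnum m ≈ natR R m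
      qnum≈natR zero    = refl
      qnum≈natR (suc m) = +-congˡ (trans (*-cong (trans (sym (*-identityʳ ω)) ω^d≈1) (qnum≈natR m)) (*-identityˡ _))

    module _ (prim : PrimitiveRoot R 2 ω) where
      open RootOfUnity R dom 1 ω prim

      private
        1<2 : 1 < 2
        1<2 = s≤s (s≤s z≤n)
        0<2 : 0 < 2
        0<2 = s≤s z≤n
        -- For even n the number N = M + 1 is odd, so [N] = [1] = 1.
        reduce : ∀ M K x μ → M ≡ μ *ℕ 2 +ℕ 0 → qnum (suc M) * cPoly M K ≈ natR R x * (1# * 1#) → cPoly M K ≈ natR R x
        reduce M K x μ p q = begin
          cPoly M K                     ≈⟨ *-identityˡ _ ⟨
          1# * cPoly M K                ≈⟨ *-congʳ (trans (trans (reflexive (≡.cong qnum (≡.trans (≡.cong suc p) (≡.sym (ℕₚ.+-suc (μ *ℕ 2) 0))))) (qnum-mod μ 1 1<2)) qnum-1) ⟨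
          qnum (suc M) * cPoly M K      ≈⟨ q ⟩
          natR R x * (1# * 1#)          ≈⟨ trans (*-congˡ (*-identityˡ 1#)) (*-identityʳ _) ⟩
          natR R x                      ∎

      -- Modulo 2 the entries 3n - 3, n + k, k - 1, n - 2 leave 1, 0, 1, 0, and the Gaussian
      -- binomials of these remainders are 1.
      cPoly-at-2-even : ∀ {M K} μ ε → 2 +ℕ M ≡ suc μ *ℕ 2 → suc K ≡ suc ε *ℕ 2 →
        cPoly M K ≈ natR R (binom (3 *ℕ μ +ℕ 1) (suc μ +ℕ suc ε) *ℕ binom ε μ)
      cPoly-at-2-even {M} {K} μ ε ≡.refl ≡.refl = reduce M K (binom (3 *ℕ μ +ℕ 1) (suc μ +ℕ suc ε) *ℕ binom ε μ) μ (≡.sym (ℕₚ.+-identityʳ _))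
        (trans (cPoly-lucas M K (3 *ℕ μ +ℕ 1) (suc μ +ℕ suc ε) ε μ 1<2 0<2 1<2 0<2 (l1 μ) (l2 μ ε) (l3 ε) (≡.sym (ℕₚ.+-identityʳ _))) refl)
        where
        l1 : ∀ μ → 3 *ℕ suc (μ *ℕ 2) ≡ (3 *ℕ μ +ℕ 1) *ℕ 2 +ℕ 1
        l1 = solve-∀
        l2 : ∀ μ ε → suc (μ *ℕ 2) +ℕ suc (suc (suc (ε *ℕ 2))) ≡ (suc μ +ℕ suc ε) *ℕ 2 +ℕ 0
        l2 = solve-∀
        l3 : ∀ ε → suc (ε *ℕ 2) ≡ ε *ℕ 2 +ℕ 1
        l3 = solve-∀

      cPoly-at-2-odd : ∀ {M K} μ e → 2 +ℕ M ≡ suc μ *ℕ 2 → suc K ≡ e *ℕ 2 +ℕ 1 →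
        cPoly M K ≈ natR R (binom (3 *ℕ μ +ℕ 1) (suc μ +ℕ e) *ℕ binom e μ)
      cPoly-at-2-odd {M} {K} μ e ≡.refl q = reduce M K (binom (3 *ℕ μ +ℕ 1) (suc μ +ℕ e) *ℕ binom e μ) μ (≡.sym (ℕₚ.+-identityʳ _))
        (trans (cPoly-lucas M K (3 *ℕ μ +ℕ 1) (suc μ +ℕ e) e μ 1<2 1<2 0<2 0<2 (l1 μ) (≡.trans (≡.cong (λ z → suc (μ *ℕ 2) +ℕ suc z) q) (l2 μ e)) l3 (≡.sym (ℕₚ.+-identityʳ _)))
               (*-congˡ (*-congʳ (gauss-diag 1))))
        where
        l1 : ∀ μ → 3 *ℕ suc (μ *ℕ 2) ≡ (3 *ℕ μ +ℕ 1) *ℕ 2 +ℕ 1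
        l1 = solve-∀
        l2 : ∀ μ e → suc (μ *ℕ 2) +ℕ suc (e *ℕ 2 +ℕ 1) ≡ (suc μ +ℕ e) *ℕ 2 +ℕ 1
        l2 = solve-∀
        l3 : K ≡ e *ℕ 2 +ℕ 0
        l3 = ℕₚ.suc-injective (≡.trans q (ℕₚ.+-suc (e *ℕ 2) 0))

    module _ (δ : ℕ) (prim : PrimitiveRoot R (3 +ℕ δ) ω) where
      open RootOfUnity R dom (2 +ℕ δ) ω prim

      private
        δ<d : δ < 3 +ℕ δ
        δ<d = s≤s (ℕₚ.≤-trans (ℕₚ.n≤1+n δ) (ℕₚ.n≤1+n _))
        1+δ<d : 1 +ℕ δ < 3 +ℕ δ
        1+δ<d = s≤s (s≤s (ℕₚ.n≤1+n δ))
        1<d : 1 < 3 +ℕ δ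
        1<d = s≤s (s≤s z≤n)

        qnumM : ∀ M μ → M ≡ μ *ℕ (3 +ℕ δ) +ℕ (1 +ℕ δ) → qnum (suc M) ≈ qnum (2 +ℕ δ)
        qnumM M μ p = trans (reflexive (≡.cong qnum (≡.trans (≡.cong suc p) (≡.sym (ℕₚ.+-suc (μ *ℕ (3 +ℕ δ)) (1 +ℕ δ)))))) (qnum-mod μ (2 +ℕ δ) 1<d)

        -- With n = (μ + 1) d: 3 (n - 1) = (3 μ + 2) d + (d - 3), and below n - 2 = μ d + (d - 2).
        top : ∀ μ δ → 3 *ℕ suc (suc (δ +ℕ μ *ℕ suc (suc (suc δ)))) ≡ (3 *ℕ μ +ℕ 2) *ℕ suc (suc (suc δ)) +ℕ δ
        top = solve-∀
        low : ∀ μ δ → suc (δ +ℕ μ *ℕ suc (suc (suc δ))) ≡ μ *ℕ suc (suc (suc δ)) +ℕ suc δ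
        low = solve-∀

      -- The remainders of k - 1 and n - 2 are d - 1 and d - 2; their Gaussian binomial is [d-1],
      -- which is also the value of [N], so the two cancel.
      cPoly-at-≥3 : ∀ {M K} μ ε → 2 +ℕ M ≡ suc μ *ℕ (3 +ℕ δ) → suc K ≡ suc ε *ℕ (3 +ℕ δ) →
        cPoly M K ≈ natR R (binom (3 *ℕ μ +ℕ 2) (suc μ +ℕ suc ε) *ℕ binom ε μ)
      cPoly-at-≥3 {M} {K} μ ε ≡.refl ≡.refl = *-cancelˡ-≉0 (qnum (2 +ℕ δ)) (qnum≉0 (2 +ℕ δ) (s≤s z≤n) ℕₚ.≤-refl) (begin
        qnum (2 +ℕ δ) * cPoly M K
          ≈⟨ *-congʳ (qnumM M μ (low μ δ)) ⟨
        qnum (suc M) * cPoly M K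
          ≈⟨ cPoly-lucas M K (3 *ℕ μ +ℕ 2) (suc μ +ℕ suc ε) ε μ {δ} {0} {2 +ℕ δ} {1 +ℕ δ} δ<d (s≤s z≤n) ℕₚ.≤-refl 1+δ<d (top μ δ) (l2 μ ε δ) (l3 ε δ) (low μ δ) ⟩
        natR R x * (1# * gauss (2 +ℕ δ) (1 +ℕ δ))
          ≈⟨ *-congˡ (trans (*-identityˡ _) (gauss-subdiag (1 +ℕ δ))) ⟩
        natR R x * qnum (2 +ℕ δ)
          ≈⟨ *-comm _ _ ⟩
        qnum (2 +ℕ δ) * natR R x ∎)
        where
        x = binom (3 *ℕ μ +ℕ 2) (suc μ +ℕ suc ε) *ℕ binom ε μ
        l2 : ∀ μ ε δ → suc (suc (δ +ℕ μ *ℕ suc (suc (suc δ)))) +ℕ suc (suc (suc (suc (δ +ℕ ε *ℕ suc (suc (suc δ))))))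
             ≡ (suc μ +ℕ suc ε) *ℕ suc (suc (suc δ)) +ℕ 0
        l2 = solve-∀
        l3 : ∀ ε δ → suc (suc (δ +ℕ ε *ℕ suc (suc (suc δ)))) ≡ ε *ℕ suc (suc (suc δ)) +ℕ suc (suc δ)
        l3 = solve-∀

      -- Let r = ρ + 1 be the remainder of k. The Gaussian binomials of the remainders have tops d -
      -- 3 and r - 1 over r and d - 2. If neither vanished, both r ≤ d - 3 and r ≥ d - 1 would hold.
      cPoly-at-≥3-zero : ∀ {M K} μ e ρ → 2 +ℕ M ≡ suc μ *ℕ (3 +ℕ δ) → suc K ≡ e *ℕ (3 +ℕ δ) +ℕ suc ρ → suc ρ < 3 +ℕ δ →
        cPoly M K ≈ 0#
      cPoly-at-≥3-zero {M} {K} μ e ρ ≡.refl q ρ<d = *-cancelˡ-≉0 (qnum (2 +ℕ δ)) (qnum≉0 (2 +ℕ δ) (s≤s z≤n) ℕₚ.≤-refl) (begin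
        qnum (2 +ℕ δ) * cPoly M K
          ≈⟨ *-congʳ (qnumM M μ (low μ δ)) ⟨
        qnum (suc M) * cPoly M K
          ≈⟨ cPoly-lucas M K (3 *ℕ μ +ℕ 2) (suc μ +ℕ e) e μ {δ} {suc ρ} {ρ} {1 +ℕ δ} δ<d ρ<d (ℕₚ.<-trans (ℕₚ.n<1+n ρ) ρ<d) 1+δ<d (top μ δ)
               (≡.trans (≡.cong (λ z → suc M +ℕ suc z) q) (l2 μ e δ ρ)) l3 (low μ δ) ⟩
        natR R x * (gauss δ (suc ρ) * gauss ρ (1 +ℕ δ))
          ≈⟨ *-congˡ vanish ⟩
        natR R x * 0#
          ≈⟨ trans (zeroʳ _) (sym (zeroʳ _)) ⟩
        qnum (2 +ℕ δ) * 0# ∎)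
        where
        x = binom (3 *ℕ μ +ℕ 2) (suc μ +ℕ e) *ℕ binom e μ
        l2 : ∀ μ e δ ρ → suc (suc (δ +ℕ μ *ℕ suc (suc (suc δ)))) +ℕ suc (e *ℕ suc (suc (suc δ)) +ℕ suc ρ)
             ≡ (suc μ +ℕ e) *ℕ suc (suc (suc δ)) +ℕ suc ρ
        l2 = solve-∀
        l3 : K ≡ e *ℕ (3 +ℕ δ) +ℕ ρ
        l3 = ℕₚ.suc-injective (≡.trans q (ℕₚ.+-suc (e *ℕ (3 +ℕ δ)) ρ))
        vanish : gauss δ (suc ρ) * gauss ρ (1 +ℕ δ) ≈ 0#
        vanish with suc ρ ≤? δ
        ... | no ρ≰δ  = trans (*-congʳ (gauss-> δ (suc ρ) (ℕₚ.≰⇒> ρ≰δ))) (zeroˡ _)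
        ... | yes ρ<δ = trans (*-congˡ (gauss-> ρ (1 +ℕ δ) (s≤s (ℕₚ.≤-trans (ℕₚ.n≤1+n ρ) ρ<δ)))) (zeroʳ _)

-- Trees encoding graphs on an interval, and the enumeration of stacks of trees.

module Trees where
  open import Data.Bool using (Bool; true; false)
  open import Data.Nat using (ℕ; zero; suc; _+_)
  open import Data.Nat.Properties
  open import Data.Nat.Tactic.RingSolver using (solve-∀)
  open import Data.Fin using (zero; suc)
  open import Data.List using (List; []; _∷_; _++_; map)
  open import Data.List.Membership.Propositional using (_∈_)
  open import Data.List.Membership.Propositional.Properties using (∈-map⁺; ∈-map⁻; ∈-++⁺ˡ; ∈-++⁺ʳ; ∈-++⁻)
  open import Data.List.Relation.Unary.Any using (here)
  open import Data.List.Relation.Unary.All using ([])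
  open import Data.List.Relation.Unary.AllPairs using ([]; _∷_)
  open import Data.List.Relation.Unary.Unique.Propositional using (Unique)
  import Data.List.Relation.Unary.Unique.Propositional.Properties as Unique
  open import Data.Vec using (Vec; []; _∷_)
  open import Data.Product using (_×_; _,_; proj₁; proj₂)
  open import Data.Sum using (_⊎_; inj₁; inj₂)
  open import Data.Empty using (⊥)
  open import Relation.Binary.PropositionalEquality using (_≡_; refl; sym; trans; cong)

  -- `Con` is a sequence of arcs, as in C = 1 / (1 - F). The constructors of `Arc` are the terms y z
  -- C and (1 + y) F² of F, the Boolean choosing between 1 and y.
  mutual
    data Con : Set where
      nil  : Con
      snoc : Con → Arc → Con

    data Arc : Set where
      leaf : Con → Arc
      node : Bool → Arc → Arc → Arc

  bit : Bool → ℕ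
  bit true  = 1
  bit false = 0

  mutual
    span : Con → ℕ
    span nil        = 0
    span (snoc c f) = span c + suc (excess f)

    -- An arc f joins two vertices at distance suc (excess f).
    excess : Arc → ℕ
    excess (leaf c)     = span c
    excess (node _ f g) = suc (excess f + excess g)

  -- Marks are the edges in excess of a spanning tree.
  mutual
    marksC : Con → ℕ
    marksC nil        = 0
    marksC (snoc c f) = marksC c + marksA f

    marksA : Arc → ℕ
    marksA (leaf c)     = marksC c
    marksA (node b f g) = bit b + (marksA f + marksA g)

  Stack : ℕ → ℕ → Set
  Stack i j = Vec Con i × Vec Arc j

  -- The four operations undo the opening of a stack's head by one constructor, after which the
  -- parts stay on the stack; hence counting needs no convolution. Arcs are opened before pieces, so
  -- that every stack is reached in exactly one way.
  addNil : ∀ {i j} → Stack i j → Stack (suc i) j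
  addNil (cs , fs) = nil ∷ cs , fs

  addSnoc : ∀ {i j} → Stack (suc i) (suc j) → Stack (suc i) j
  addSnoc (c ∷ cs , f ∷ fs) = snoc c f ∷ cs , fs

  addLeaf : ∀ {i j} → Stack (suc i) j → Stack i (suc j)
  addLeaf (c ∷ cs , fs) = cs , leaf c ∷ fs

  addNode : ∀ {i j} → Bool → Stack i (suc (suc j)) → Stack i (suc j)
  addNode b (cs , f ∷ g ∷ fs) = cs , node b f g ∷ fs

  -- All stacks of i connected pieces and j arcs with total excess r and t marks.
  stacks : (i j r t : ℕ) → List (Stack i j)
  stacks i       (suc j) zero    t       = map addLeaf (stacks (suc i) j zero t)
  stacks i       (suc j) (suc r) zero    = map addLeaf (stacks (suc i) j (suc r) zero) ++ map (addNode false) (stacks i (suc (suc j)) r zero)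
  stacks i       (suc j) (suc r) (suc t) = map addLeaf (stacks (suc i) j (suc r) (suc t)) ++
    (map (addNode false) (stacks i (suc (suc j)) r (suc t)) ++ map (addNode true) (stacks i (suc (suc j)) r t))
  stacks zero    zero    zero    zero    = ([] , []) ∷ []
  stacks zero    zero    zero    (suc t) = []
  stacks zero    zero    (suc r) t       = []
  stacks (suc i) zero    zero    t       = map addNil (stacks i zero zero t)
  stacks (suc i) zero    (suc r) t       = map addNil (stacks i zero (suc r) t) ++ map addSnoc (stacks (suc i) 1 r t)

  sumV : ∀ {A : Set} {n} → (A → ℕ) → Vec A n → ℕ
  sumV f []       = 0
  sumV f (x ∷ xs) = f x + sumV f xs

  totalExcess totalMarks : ∀ {i j} → Stack i j → ℕ
  totalExcess (cs , fs) = sumV span cs + sumV excess fs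
  totalMarks  (cs , fs) = sumV marksC cs + sumV marksA fs

  Has : ∀ {i j} → Stack i j → ℕ → ℕ → Set
  Has s r t = (totalExcess s ≡ r) × (totalMarks s ≡ t)

  private
    snoc-total : ∀ a b c d → (a + b) + c + d ≡ (a + c) + (b + d)
    snoc-total = solve-∀

    leaf-total : ∀ a b c → b + (a + c) ≡ (a + b) + c
    leaf-total = solve-∀

    node-total : ∀ z a b c d → c + (z + (a + b) + d) ≡ z + (c + (a + (b + d)))
    node-total = solve-∀

    snoc-excess : ∀ a b c d → (a + suc b) + c + d ≡ suc ((a + c) + (b + d))
    snoc-excess = solve-∀

    node-excess : ∀ a b c d → c + suc ((a + b) + d) ≡ suc (c + (a + (b + d)))
    node-excess = solve-∀

  Has-addSnoc : ∀ {i j} (s : Stack (suc i) (suc j)) → totalExcess (addSnoc s) ≡ suc (totalExcess s) × totalMarks (addSnoc s) ≡ totalMarks s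
  Has-addSnoc (c ∷ cs , f ∷ fs) = snoc-excess (span c) (excess f) (sumV span cs) (sumV excess fs)
                                , snoc-total (marksC c) (marksA f) (sumV marksC cs) (sumV marksA fs)

  Has-addLeaf : ∀ {i j} (s : Stack (suc i) j) → totalExcess (addLeaf s) ≡ totalExcess s × totalMarks (addLeaf s) ≡ totalMarks s
  Has-addLeaf (c ∷ cs , fs) = leaf-total (span c) (sumV span cs) (sumV excess fs) , leaf-total (marksC c) (sumV marksC cs) (sumV marksA fs)

  Has-addNode : ∀ {i j} b (s : Stack i (suc (suc j))) →
    totalExcess (addNode b s) ≡ suc (totalExcess s) × totalMarks (addNode b s) ≡ bit b + totalMarks s
  Has-addNode b (cs , f ∷ g ∷ fs) = node-excess (excess f) (excess g) (sumV span cs) (sumV excess fs)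
                                  , node-total (bit b) (marksA f) (marksA g) (sumV marksC cs) (sumV marksA fs)

  ∈-map-elim : ∀ {A B : Set} (P : B → Set) (f : A → B) {xs y} → (∀ {x} → x ∈ xs → P (f x)) → y ∈ map f xs → P y
  ∈-map-elim P f h y∈ with ∈-map⁻ f y∈
  ... | x , x∈ , refl = h x∈

  ∈-++-elim : ∀ {A : Set} (P : A → Set) xs {ys y} → (y ∈ xs → P y) → (y ∈ ys → P y) → y ∈ xs ++ ys → P y
  ∈-++-elim P xs h k y∈ with ∈-++⁻ xs y∈
  ... | inj₁ p = h p
  ... | inj₂ p = k p

  private
    Has-leaf : ∀ {i j r t} (s : Stack (suc i) j) → Has s r t → Has (addLeaf s) r t
    Has-leaf s (e , m) = trans (proj₁ (Has-addLeaf s)) e , trans (proj₂ (Has-addLeaf s)) m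

    Has-snoc : ∀ {i j r t} (s : Stack (suc i) (suc j)) → Has s r t → Has (addSnoc s) (suc r) t
    Has-snoc s (e , m) = trans (proj₁ (Has-addSnoc s)) (cong suc e) , trans (proj₂ (Has-addSnoc s)) m

    Has-node : ∀ {i j r t} b (s : Stack i (suc (suc j))) → Has s r t → Has (addNode b s) (suc r) (bit b + t)
    Has-node b s (e , m) = trans (proj₁ (Has-addNode b s)) (cong suc e) , trans (proj₂ (Has-addNode b s)) (cong (bit b +_) m)

  stacks-sound : ∀ i j r t {s : Stack i j} → s ∈ stacks i j r t → Has s r t
  stacks-sound i (suc j) zero t = ∈-map-elim (λ s → Has s zero t) addLeaf (λ {s} s∈ → Has-leaf s (stacks-sound (suc i) j zero t s∈))
  stacks-sound i (suc j) (suc r) zero = ∈-++-elim (λ s → Has s (suc r) zero) (map addLeaf (stacks (suc i) j (suc r) zero))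
    (∈-map-elim (λ s → Has s (suc r) zero) addLeaf (λ {s} s∈ → Has-leaf s (stacks-sound (suc i) j (suc r) zero s∈)))
    (∈-map-elim (λ s → Has s (suc r) zero) (addNode false) (λ {s} s∈ → Has-node false s (stacks-sound i (suc (suc j)) r zero s∈)))
  stacks-sound i (suc j) (suc r) (suc t) = ∈-++-elim (λ s → Has s (suc r) (suc t)) (map addLeaf (stacks (suc i) j (suc r) (suc t)))
    (∈-map-elim (λ s → Has s (suc r) (suc t)) addLeaf (λ {s} s∈ → Has-leaf s (stacks-sound (suc i) j (suc r) (suc t) s∈)))
    (∈-++-elim (λ s → Has s (suc r) (suc t)) (map (addNode false) (stacks i (suc (suc j)) r (suc t)))
      (∈-map-elim (λ s → Has s (suc r) (suc t)) (addNode false) (λ {s} s∈ → Has-node false s (stacks-sound i (suc (suc j)) r (suc t) s∈)))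
      (∈-map-elim (λ s → Has s (suc r) (suc t)) (addNode true) (λ {s} s∈ → Has-node true s (stacks-sound i (suc (suc j)) r t s∈))))
  stacks-sound zero zero zero zero (here refl) = refl , refl
  stacks-sound (suc i) zero zero t = ∈-map-elim (λ s → Has s zero t) addNil (λ {s} s∈ → stacks-sound i zero zero t {s} s∈)
  stacks-sound (suc i) zero (suc r) t = ∈-++-elim (λ s → Has s (suc r) t) (map addNil (stacks i zero (suc r) t))
    (∈-map-elim (λ s → Has s (suc r) t) addNil (λ {s} s∈ → stacks-sound i zero (suc r) t {s} s∈))
    (∈-map-elim (λ s → Has s (suc r) t) addSnoc (λ {s} s∈ → Has-snoc s (stacks-sound (suc i) 1 r t s∈)))

  stacks-complete : ∀ i j r t (s : Stack i j) → Has s r t → s ∈ stacks i j r t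
  stacks-complete zero zero zero zero ([] , []) _ = here refl
  stacks-complete zero zero zero (suc t) ([] , []) (_ , ())
  stacks-complete zero zero (suc r) t ([] , []) (() , _)
  stacks-complete (suc i) zero zero t (nil ∷ cs , []) h = ∈-map⁺ addNil (stacks-complete i zero zero t (cs , []) h)
  stacks-complete (suc i) zero zero t (snoc c f ∷ cs , []) (e , _)
    with trans (sym e) (proj₁ (Has-addSnoc (c ∷ cs , f ∷ [])))
  ... | ()
  stacks-complete (suc i) zero (suc r) t (nil ∷ cs , []) h = ∈-++⁺ˡ (∈-map⁺ addNil (stacks-complete i zero (suc r) t (cs , []) h))
  stacks-complete (suc i) zero (suc r) t (snoc c f ∷ cs , []) (e , m) =
    ∈-++⁺ʳ (map addNil (stacks i zero (suc r) t)) (∈-map⁺ addSnoc (stacks-complete (suc i) 1 r t (c ∷ cs , f ∷ [])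
      (suc-injective (trans (sym (proj₁ (Has-addSnoc (c ∷ cs , f ∷ [])))) e) , trans (sym (proj₂ (Has-addSnoc (c ∷ cs , f ∷ [])))) m)))
  stacks-complete i (suc j) zero t (cs , leaf c ∷ fs) (e , m) =
    ∈-map⁺ addLeaf (stacks-complete (suc i) j zero t (c ∷ cs , fs)
      (trans (sym (proj₁ (Has-addLeaf (c ∷ cs , fs)))) e , trans (sym (proj₂ (Has-addLeaf (c ∷ cs , fs)))) m))
  stacks-complete i (suc j) zero t (cs , node b f g ∷ fs) (e , _)
    with trans (sym e) (proj₁ (Has-addNode b (cs , f ∷ g ∷ fs)))
  ... | ()
  stacks-complete i (suc j) (suc r) zero (cs , leaf c ∷ fs) (e , m) =
    ∈-++⁺ˡ (∈-map⁺ addLeaf (stacks-complete (suc i) j (suc r) zero (c ∷ cs , fs)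
      (trans (sym (proj₁ (Has-addLeaf (c ∷ cs , fs)))) e , trans (sym (proj₂ (Has-addLeaf (c ∷ cs , fs)))) m)))
  stacks-complete i (suc j) (suc r) zero (cs , node false f g ∷ fs) (e , m) =
    ∈-++⁺ʳ (map addLeaf (stacks (suc i) j (suc r) zero)) (∈-map⁺ (addNode false) (stacks-complete i (suc (suc j)) r zero (cs , f ∷ g ∷ fs)
      (suc-injective (trans (sym (proj₁ (Has-addNode false (cs , f ∷ g ∷ fs)))) e) , trans (sym (proj₂ (Has-addNode false (cs , f ∷ g ∷ fs)))) m)))
  stacks-complete i (suc j) (suc r) zero (cs , node true f g ∷ fs) (_ , m)
    with trans (sym m) (proj₂ (Has-addNode true (cs , f ∷ g ∷ fs)))
  ... | ()
  stacks-complete i (suc j) (suc r) (suc t) (cs , leaf c ∷ fs) (e , m) =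
    ∈-++⁺ˡ (∈-map⁺ addLeaf (stacks-complete (suc i) j (suc r) (suc t) (c ∷ cs , fs)
      (trans (sym (proj₁ (Has-addLeaf (c ∷ cs , fs)))) e , trans (sym (proj₂ (Has-addLeaf (c ∷ cs , fs)))) m)))
  stacks-complete i (suc j) (suc r) (suc t) (cs , node false f g ∷ fs) (e , m) =
    ∈-++⁺ʳ (map addLeaf (stacks (suc i) j (suc r) (suc t))) (∈-++⁺ˡ (∈-map⁺ (addNode false) (stacks-complete i (suc (suc j)) r (suc t) (cs , f ∷ g ∷ fs)
      (suc-injective (trans (sym (proj₁ (Has-addNode false (cs , f ∷ g ∷ fs)))) e) , trans (sym (proj₂ (Has-addNode false (cs , f ∷ g ∷ fs)))) m))))
  stacks-complete i (suc j) (suc r) (suc t) (cs , node true f g ∷ fs) (e , m) =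
    ∈-++⁺ʳ (map addLeaf (stacks (suc i) j (suc r) (suc t))) (∈-++⁺ʳ (map (addNode false) (stacks i (suc (suc j)) r (suc t)))
      (∈-map⁺ (addNode true) (stacks-complete i (suc (suc j)) r t (cs , f ∷ g ∷ fs)
        (suc-injective (trans (sym (proj₁ (Has-addNode true (cs , f ∷ g ∷ fs)))) e)
        , suc-injective (trans (sym (proj₂ (Has-addNode true (cs , f ∷ g ∷ fs)))) m)))))

  private
    addNil-inj : ∀ {i j} {s s′ : Stack i j} → addNil s ≡ addNil s′ → s ≡ s′
    addNil-inj refl = refl

    addSnoc-inj : ∀ {i j} {s s′ : Stack (suc i) (suc j)} → addSnoc s ≡ addSnoc s′ → s ≡ s′
    addSnoc-inj {s = c ∷ cs , f ∷ fs} {c′ ∷ cs′ , f′ ∷ fs′} refl = refl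

    addLeaf-inj : ∀ {i j} {s s′ : Stack (suc i) j} → addLeaf s ≡ addLeaf s′ → s ≡ s′
    addLeaf-inj {s = c ∷ cs , fs} {c′ ∷ cs′ , fs′} refl = refl

    addNode-inj : ∀ {i j} b {s s′ : Stack i (suc (suc j))} → addNode b s ≡ addNode b s′ → s ≡ s′
    addNode-inj b {cs , f ∷ g ∷ fs} {cs′ , f′ ∷ g′ ∷ fs′} refl = refl

    nil≢snoc : ∀ {i j} {s : Stack i j} {s′ : Stack (suc i) (suc j)} {A : Set} → addNil s ≡ addSnoc s′ → A
    nil≢snoc {s′ = c ∷ cs , f ∷ fs} ()

    leaf≢node : ∀ {i j} {b} {s : Stack (suc i) j} {s′ : Stack i (suc (suc j))} {A : Set} → addLeaf s ≡ addNode b s′ → A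
    leaf≢node {s = c ∷ cs , _} {_ , f ∷ g ∷ fs} ()

    false≢true : ∀ {i j} {s s′ : Stack i (suc (suc j))} {A : Set} → addNode false s ≡ addNode true s′ → A
    false≢true {s = _ , f ∷ g ∷ fs} {_ , f′ ∷ g′ ∷ fs′} ()

  stacks-unique : ∀ i j r t → Unique (stacks i j r t)
  stacks-unique zero zero zero zero = [] ∷ []
  stacks-unique zero zero zero (suc t) = []
  stacks-unique zero zero (suc r) t = []
  stacks-unique (suc i) zero zero t = Unique.map⁺ addNil-inj (stacks-unique i zero zero t)
  stacks-unique (suc i) zero (suc r) t = Unique.++⁺ (Unique.map⁺ addNil-inj (stacks-unique i zero (suc r) t))
    (Unique.map⁺ addSnoc-inj (stacks-unique (suc i) 1 r t))
    λ (p , q) → nil≢snoc (trans (sym (proj₂ (proj₂ (∈-map⁻ addNil p)))) (proj₂ (proj₂ (∈-map⁻ addSnoc q))))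
  stacks-unique i (suc j) zero t = Unique.map⁺ addLeaf-inj (stacks-unique (suc i) j zero t)
  stacks-unique i (suc j) (suc r) zero = Unique.++⁺ (Unique.map⁺ addLeaf-inj (stacks-unique (suc i) j (suc r) zero))
    (Unique.map⁺ (addNode-inj false) (stacks-unique i (suc (suc j)) r zero))
    λ (p , q) → leaf≢node (trans (sym (proj₂ (proj₂ (∈-map⁻ addLeaf p)))) (proj₂ (proj₂ (∈-map⁻ (addNode false) q))))
  stacks-unique i (suc j) (suc r) (suc t) = Unique.++⁺ (Unique.map⁺ addLeaf-inj (stacks-unique (suc i) j (suc r) (suc t)))
    (Unique.++⁺ (Unique.map⁺ (addNode-inj false) (stacks-unique i (suc (suc j)) r (suc t)))
      (Unique.map⁺ (addNode-inj true) (stacks-unique i (suc (suc j)) r t))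
      λ (p , q) → false≢true (trans (sym (proj₂ (proj₂ (∈-map⁻ (addNode false) p)))) (proj₂ (proj₂ (∈-map⁻ (addNode true) q)))))
    λ (p , q) → leaf-node p (∈-++⁻ (map (addNode false) (stacks i (suc (suc j)) r (suc t))) q)
    where
    leaf-node : ∀ {x} → x ∈ map addLeaf (stacks (suc i) j (suc r) (suc t)) →
      (x ∈ map (addNode false) (stacks i (suc (suc j)) r (suc t)) ⊎ x ∈ map (addNode true) (stacks i (suc (suc j)) r t)) → ⊥
    leaf-node p (inj₁ q) = leaf≢node (trans (sym (proj₂ (proj₂ (∈-map⁻ addLeaf p)))) (proj₂ (proj₂ (∈-map⁻ (addNode false) q))))
    leaf-node p (inj₂ q) = leaf≢node (trans (sym (proj₂ (proj₂ (∈-map⁻ addLeaf p)))) (proj₂ (proj₂ (∈-map⁻ (addNode true) q))))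

-- Closed forms for sums of spans over all stacks.

module Count where
  open Gauss using (binom)
  open Trees
  open import Data.Bool using (true; false)
  open import Data.Nat using (ℕ; zero; suc; _+_; _*_; _<_; s≤s)
  open import Data.Nat.Properties
  open import Data.Nat.Tactic.RingSolver using (solve-∀)
  import Data.Fin as Fin
  open import Data.Fin using (Fin)
  open import Data.List using (List; []; _∷_; _++_; map; length)
  open import Data.List.Properties using (length-map)
  open import Data.List.Membership.Propositional using (_∈_)
  open import Data.List.Relation.Unary.Any using (here; there)
  open import Data.Vec using (Vec; []; _∷_; lookup; tail)
  open import Data.Product using (_,_; proj₁; proj₂)
  open import Relation.Binary.PropositionalEquality using (_≡_; refl; sym; trans; cong; cong₂; subst; module ≡-Reasoning)

  ∑ : ∀ {A : Set} → (A → ℕ) → List A → ℕ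
  ∑ f []       = 0
  ∑ f (x ∷ xs) = f x + ∑ f xs

  ∑-++ : ∀ {A : Set} (f : A → ℕ) xs ys → ∑ f (xs ++ ys) ≡ ∑ f xs + ∑ f ys
  ∑-++ f []       ys = refl
  ∑-++ f (x ∷ xs) ys = trans (cong (f x +_) (∑-++ f xs ys)) (sym (+-assoc (f x) _ _))

  ∑-map : ∀ {A B : Set} (f : B → ℕ) (h : A → B) {g : A → ℕ} → (∀ x → f (h x) ≡ g x) → ∀ xs → ∑ f (map h xs) ≡ ∑ g xs
  ∑-map f h p []       = refl
  ∑-map f h p (x ∷ xs) = cong₂ _+_ (p x) (∑-map f h p xs)

  ∑-cong : ∀ {A : Set} {f g : A → ℕ} xs → (∀ {x} → x ∈ xs → f x ≡ g x) → ∑ f xs ≡ ∑ g xs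
  ∑-cong []       p = refl
  ∑-cong (x ∷ xs) p = cong₂ _+_ (p (here refl)) (∑-cong xs (λ x∈ → p (there x∈)))

  ∑-+ : ∀ {A : Set} (f g : A → ℕ) xs → ∑ (λ x → f x + g x) xs ≡ ∑ f xs + ∑ g xs
  ∑-+ f g []       = refl
  ∑-+ f g (x ∷ xs) = trans (cong (f x + g x +_) (∑-+ f g xs)) (interchange (f x) (g x) (∑ f xs) (∑ g xs))
    where
    interchange : ∀ a b c d → a + b + (c + d) ≡ (a + c) + (b + d)
    interchange = solve-∀

  ∑-const : ∀ {A : Set} c (xs : List A) → ∑ (λ _ → c) xs ≡ c * length xs
  ∑-const c []       = sym (*-zeroʳ c)
  ∑-const c (x ∷ xs) = trans (cong (c +_) (∑-const c xs)) (sym (*-suc c (length xs)))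

  -- Exchange of the two sums; since every position contributes the same `c`, the outer one is a
  -- multiple.
  ∑-sumV : ∀ {A B : Set} {p} (f : B → ℕ) (h : A → Vec B p) c xs →
    (∀ l → ∑ (λ x → f (lookup (h x) l)) xs ≡ c) → ∑ (λ x → sumV f (h x)) xs ≡ p * c
  ∑-sumV {p = zero}  f h c xs eq = trans (∑-cong xs (λ {x} _ → sumV-[] (h x))) (∑-const 0 xs)
    where
    sumV-[] : (v : Vec _ 0) → sumV f v ≡ 0
    sumV-[] [] = refl
  ∑-sumV {p = suc p} f h c xs eq = begin
    ∑ (λ x → sumV f (h x)) xs
      ≡⟨ ∑-cong xs (λ {x} _ → sumV-∷ (h x)) ⟩
    ∑ (λ x → f (lookup (h x) Fin.zero) + sumV f (tail (h x))) xs
      ≡⟨ ∑-+ _ _ xs ⟩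
    ∑ (λ x → f (lookup (h x) Fin.zero)) xs + ∑ (λ x → sumV f (tail (h x))) xs
      ≡⟨ cong₂ _+_ (eq Fin.zero) (∑-sumV f (λ x → tail (h x)) c xs (λ l → trans (∑-cong xs (λ {x} _ → cong f (lookup-tail (h x) l))) (eq (Fin.suc l)))) ⟩
    c + p * c ∎
    where
    open ≡-Reasoning
    sumV-∷ : (v : Vec _ (suc p)) → sumV f v ≡ f (lookup v Fin.zero) + sumV f (tail v)
    sumV-∷ (x ∷ v) = refl
    lookup-tail : (v : Vec _ (suc p)) (l : Fin p) → lookup (tail v) l ≡ lookup v (Fin.suc l)
    lookup-tail (x ∷ v) l = refl

  -- Multisets of size t from m elements: the coefficient of x^t in (1 - x)^(-m).
  multichoose : ℕ → ℕ → ℕ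
  multichoose _       zero    = 1
  multichoose zero    (suc t) = 0
  multichoose (suc m) (suc t) = multichoose m (suc t) + multichoose (suc m) t

  binom-> : ∀ a b → a < b → binom a b ≡ 0
  binom-> zero    (suc b) _         = refl
  binom-> (suc a) (suc b) (s≤s a<b) = cong₂ _+_ (binom-> a b a<b) (binom-> a (suc b) (m≤n⇒m≤1+n a<b))

  binom-diag : ∀ a → binom a a ≡ 1
  binom-diag zero    = refl
  binom-diag (suc a) = cong₂ _+_ (binom-diag a) (binom-> a (suc a) ≤-refl)

  -- The rule (l + 1) binom(q, l + 1) = (q - l) binom(q, l) with the difference moved across, hence
  -- meaningful for l > q as well.
  binom-absorb : ∀ q l → suc l * binom q (suc l) + l * binom q l ≡ q * binom q l
  binom-absorb zero    zero    = refl
  binom-absorb zero    (suc l) = cong₂ _+_ (*-zeroʳ (suc (suc l))) (*-zeroʳ (suc l))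
  binom-absorb (suc q) zero    with binom-absorb q zero
  ... | p = trans (cong suc (trans (lemma (binom q 1)) p)) refl
    where
    lemma : ∀ x → x + 0 + 0 ≡ 1 * x + 0 * binom q 0
    lemma = solve-∀
  binom-absorb (suc q) (suc l) = begin
    suc (suc l) * (b + c) + suc l * (a + b)
      ≡⟨ shape l a b c ⟩
    (suc (suc l) * c + suc l * b) + (suc l * b + l * a) + (a + b)
      ≡⟨ cong₂ (λ x y → x + y + (a + b)) (binom-absorb q (suc l)) (binom-absorb q l) ⟩
    q * b + q * a + (a + b)
      ≡⟨ shape′ q a b ⟩
    suc q * (a + b) ∎
    where
    open ≡-Reasoning
    a = binom q l
    b = binom q (suc l)
    c = binom q (suc (suc l))
    shape : ∀ l a b c → suc (suc l) * (b + c) + suc l * (a + b) ≡ (suc (suc l) * c + suc l * b) + (suc l * b + l * a) + (a + b)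
    shape = solve-∀
    shape′ : ∀ q a b → q * b + q * a + (a + b) ≡ suc q * (a + b)
    shape′ = solve-∀

  -- Coefficients of the derivative of (1 - x)^(-m).
  multichoose-absorb : ∀ m t → suc t * multichoose m (suc t) ≡ m * multichoose (suc m) t
  multichoose-absorb zero    t    = *-zeroʳ (suc t)
  multichoose-absorb (suc m) zero = trans (cong (λ x → x + 1 + 0) (trans (sym (+-identityʳ _)) (multichoose-absorb m zero))) (lemma m)
    where
    lemma : ∀ m → m * 1 + 1 + 0 ≡ suc m * 1
    lemma = solve-∀
  multichoose-absorb (suc m) (suc t) = begin
    suc (suc t) * (a + (b + c))                          ≡⟨ shape t a b c ⟩
    suc (suc t) * a + suc t * (b + c) + (b + c)          ≡⟨ cong₂ (λ x y → x + y + (b + c)) (multichoose-absorb m (suc t)) (multichoose-absorb (suc m) t) ⟩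
    m * (b + c) + suc m * e + (b + c)                    ≡⟨ shape′ m b c e ⟩
    suc m * ((b + c) + e)                                ∎
    where
    open ≡-Reasoning
    a = multichoose m (suc (suc t))
    b = multichoose m (suc t)
    c = multichoose (suc m) t
    e = multichoose (suc (suc m)) t
    shape : ∀ t a b c → suc (suc t) * (a + (b + c)) ≡ suc (suc t) * a + suc t * (b + c) + (b + c)
    shape = solve-∀
    shape′ : ∀ m b c e → m * (b + c) + suc m * e + (b + c) ≡ suc m * ((b + c) + e)
    shape′ = solve-∀

  multichoose-binom : ∀ m t → multichoose (suc m) t ≡ binom (m + t) m
  multichoose-binom zero    zero    = refl
  multichoose-binom zero    (suc t) = multichoose-binom zero t
  multichoose-binom (suc m) zero    = sym (trans (cong (λ z → binom z (suc m)) (+-identityʳ (suc m))) (binom-diag (suc m)))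
  multichoose-binom (suc m) (suc t) = cong₂ _+_ (multichoose-binom m (suc t))
    (trans (multichoose-binom (suc m) t) (cong (λ z → binom z (suc m)) (sym (+-suc m t))))

  mcBinom : ℕ → ℕ → ℕ → ℕ → ℕ
  mcBinom m t q l = multichoose m t * binom q l

  -- The coefficients that Lagrange inversion gives for the sum, over all stacks,
  -- of the span of one fixed arc, resp. of one fixed connected piece.
  arcSum conSum : (i j r t : ℕ) → ℕ
  arcSum i j r t = mcBinom (suc (j + r)) t (suc (i + 2 * j + 3 * r)) (suc (i + 2 * j + 2 * r + t))
  conSum i j r t = mcBinom (j + r) t (i + 2 * j + 3 * r) (suc (i + 2 * j + 2 * r + t))

  mcBinom-pascal₀ : ∀ m q l → mcBinom (suc m) 0 (suc q) (suc l) ≡ mcBinom m 0 q l + mcBinom (suc m) 0 q (suc l)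
  mcBinom-pascal₀ m q l = *-distribˡ-+ 1 (binom q l) (binom q (suc l))

  -- Pascal in both factors at once. The three terms answer to the three forms of a head arc: leaf,
  -- unmarked node, marked node.
  mcBinom-pascal : ∀ m t q l → mcBinom (suc m) (suc t) (suc q) (suc l) ≡ mcBinom m (suc t) q l + (mcBinom (suc m) (suc t) q (suc l) + mcBinom (suc m) t q l)
  mcBinom-pascal m t q l = shape (multichoose m (suc t)) (multichoose (suc m) t) (binom q l) (binom q (suc l))
    where
    shape : ∀ x y a b → (x + y) * (a + b) ≡ x * a + ((x + y) * b + y * a)
    shape = solve-∀

  private
    cong-mcBinom : ∀ {m m′ t q q′ l l′} → m ≡ m′ → q ≡ q′ → l ≡ l′ → mcBinom m t q l ≡ mcBinom m′ t q′ l′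
    cong-mcBinom refl refl refl = refl

  conSum-zero : ∀ i j t → conSum i j 0 t ≡ 0
  conSum-zero i j t = trans (cong (multichoose (j + 0) t *_) (binom-> _ _ (s≤s (m≤m+n (i + 2 * j + 2 * 0) t)))) (*-zeroʳ (multichoose (j + 0) t))

  -- At excess 0 every arc has span 1 and there is a single stack, which has no marks.
  arcSum-zero-0 : ∀ i j → arcSum i j 0 0 ≡ 1
  arcSum-zero-0 i j = trans (*-identityˡ _) (trans (cong (λ z → binom (suc (i + 2 * j + 0)) (suc z)) (+-identityʳ (i + 2 * j + 0))) (binom-diag (suc (i + 2 * j + 0))))

  arcSum-zero-suc : ∀ i j t → arcSum i j 0 (suc t) ≡ 0
  arcSum-zero-suc i j t = trans (cong (multichoose (suc (j + 0)) (suc t) *_)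
    (binom-> _ _ (s≤s (≤-trans (s≤s (m≤m+n (i + 2 * j + 0) t)) (≤-reflexive (sym (+-suc (i + 2 * j + 0) t)))))))
    (*-zeroʳ (multichoose (suc (j + 0)) (suc t)))

  arcSum-zero-shift : ∀ i j t → arcSum (suc i) j 0 t ≡ arcSum i (suc j) 0 t
  arcSum-zero-shift i j zero    = trans (arcSum-zero-0 (suc i) j) (sym (arcSum-zero-0 i (suc j)))
  arcSum-zero-shift i j (suc t) = trans (arcSum-zero-suc (suc i) j t) (sym (arcSum-zero-suc i (suc j) t))

  -- The recursion for a fixed arc behind the head, whose span is not affected when the head is
  -- opened.
  arcSum-node₀ : ∀ i j r → arcSum i (suc j) (suc r) 0 ≡ arcSum (suc i) j (suc r) 0 + arcSum i (suc (suc j)) r 0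
  arcSum-node₀ i j r = trans (cong-mcBinom {t = 0} (e1 i j r) (e2 i j r) (e3 i j r)) (trans (mcBinom-pascal₀ (2 + (j + r)) (i + 2 * j + 3 * r + 5) (i + 2 * j + 2 * r + 0 + 4))
    (cong₂ _+_ (cong-mcBinom {t = 0} (e4 i j r) (e5 i j r) (e6 i j r)) (cong-mcBinom {t = 0} (e7 i j r) (e8 i j r) (e9 i j r))))
    where
    e1 : ∀ i j r → suc (suc j + suc r) ≡ suc (2 + (j + r))
    e1 = solve-∀
    e2 : ∀ i j r → suc (i + 2 * suc j + 3 * suc r) ≡ suc (i + 2 * j + 3 * r + 5)
    e2 = solve-∀
    e3 : ∀ i j r → suc (i + 2 * suc j + 2 * suc r + 0) ≡ suc (i + 2 * j + 2 * r + 0 + 4)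
    e3 = solve-∀
    e4 : ∀ i j r → (2 + (j + r)) ≡ suc (j + suc r)
    e4 = solve-∀
    e5 : ∀ i j r → (i + 2 * j + 3 * r + 5) ≡ suc (suc i + 2 * j + 3 * suc r)
    e5 = solve-∀
    e6 : ∀ i j r → (i + 2 * j + 2 * r + 0 + 4) ≡ suc (suc i + 2 * j + 2 * suc r + 0)
    e6 = solve-∀
    e7 : ∀ i j r → suc (2 + (j + r)) ≡ suc (suc (suc j) + r)
    e7 = solve-∀
    e8 : ∀ i j r → (i + 2 * j + 3 * r + 5) ≡ suc (i + 2 * suc (suc j) + 3 * r)
    e8 = solve-∀
    e9 : ∀ i j r → suc (i + 2 * j + 2 * r + 0 + 4) ≡ suc (i + 2 * suc (suc j) + 2 * r + 0)
    e9 = solve-∀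

  arcSum-node : ∀ i j r t → arcSum i (suc j) (suc r) (suc t) ≡ arcSum (suc i) j (suc r) (suc t) + (arcSum i (suc (suc j)) r (suc t) + arcSum i (suc (suc j)) r t)
  arcSum-node i j r t = trans (cong-mcBinom {t = suc t} (e1 i j r t) (e2 i j r t) (e3 i j r t)) (trans (mcBinom-pascal (2 + (j + r)) t (i + 2 * j + 3 * r + 5) (i + 2 * j + 2 * r + (suc t) + 4))
    (cong₂ _+_ (cong-mcBinom {t = (suc t)} (e4 i j r t) (e5 i j r t) (e6 i j r t)) (cong₂ _+_ (cong-mcBinom {t = (suc t)} (e7 i j r t) (e8 i j r t) (e9 i j r t)) (cong-mcBinom {t = t} (e10 i j r t) (e11 i j r t) (e12 i j r t)))))
    where
    e1 : ∀ i j r t → suc (suc j + suc r) ≡ suc (2 + (j + r))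
    e1 = solve-∀
    e2 : ∀ i j r t → suc (i + 2 * suc j + 3 * suc r) ≡ suc (i + 2 * j + 3 * r + 5)
    e2 = solve-∀
    e3 : ∀ i j r t → suc (i + 2 * suc j + 2 * suc r + (suc t)) ≡ suc (i + 2 * j + 2 * r + (suc t) + 4)
    e3 = solve-∀
    e4 : ∀ i j r t → (2 + (j + r)) ≡ suc (j + suc r)
    e4 = solve-∀
    e5 : ∀ i j r t → (i + 2 * j + 3 * r + 5) ≡ suc (suc i + 2 * j + 3 * suc r)
    e5 = solve-∀
    e6 : ∀ i j r t → (i + 2 * j + 2 * r + (suc t) + 4) ≡ suc (suc i + 2 * j + 2 * suc r + (suc t))
    e6 = solve-∀
    e7 : ∀ i j r t → suc (2 + (j + r)) ≡ suc (suc (suc j) + r)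
    e7 = solve-∀
    e8 : ∀ i j r t → (i + 2 * j + 3 * r + 5) ≡ suc (i + 2 * suc (suc j) + 3 * r)
    e8 = solve-∀
    e9 : ∀ i j r t → suc (i + 2 * j + 2 * r + (suc t) + 4) ≡ suc (i + 2 * suc (suc j) + 2 * r + (suc t))
    e9 = solve-∀
    e10 : ∀ i j r t → suc (2 + (j + r)) ≡ suc (suc (suc j) + r)
    e10 = solve-∀
    e11 : ∀ i j r t → (i + 2 * j + 3 * r + 5) ≡ suc (i + 2 * suc (suc j) + 3 * r)
    e11 = solve-∀
    e12 : ∀ i j r t → (i + 2 * j + 2 * r + (suc t) + 4) ≡ suc (i + 2 * suc (suc j) + 2 * r + t)
    e12 = solve-∀

  conSum-node₀ : ∀ i j r → conSum i (suc j) (suc r) 0 ≡ conSum (suc i) j (suc r) 0 + conSum i (suc (suc j)) r 0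
  conSum-node₀ i j r = trans (cong-mcBinom {t = 0} (e1 i j r) (e2 i j r) (e3 i j r)) (trans (mcBinom-pascal₀ (1 + (j + r)) (i + 2 * j + 3 * r + 4) (i + 2 * j + 2 * r + 0 + 4))
    (cong₂ _+_ (cong-mcBinom {t = 0} (e4 i j r) (e5 i j r) (e6 i j r)) (cong-mcBinom {t = 0} (e7 i j r) (e8 i j r) (e9 i j r))))
    where
    e1 : ∀ i j r → suc j + suc r ≡ suc (1 + (j + r))
    e1 = solve-∀
    e2 : ∀ i j r → i + 2 * suc j + 3 * suc r ≡ suc (i + 2 * j + 3 * r + 4)
    e2 = solve-∀
    e3 : ∀ i j r → suc (i + 2 * suc j + 2 * suc r + 0) ≡ suc (i + 2 * j + 2 * r + 0 + 4)
    e3 = solve-∀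
    e4 : ∀ i j r → (1 + (j + r)) ≡ j + suc r
    e4 = solve-∀
    e5 : ∀ i j r → (i + 2 * j + 3 * r + 4) ≡ suc i + 2 * j + 3 * suc r
    e5 = solve-∀
    e6 : ∀ i j r → (i + 2 * j + 2 * r + 0 + 4) ≡ suc (suc i + 2 * j + 2 * suc r + 0)
    e6 = solve-∀
    e7 : ∀ i j r → suc (1 + (j + r)) ≡ suc (suc j) + r
    e7 = solve-∀
    e8 : ∀ i j r → (i + 2 * j + 3 * r + 4) ≡ i + 2 * suc (suc j) + 3 * r
    e8 = solve-∀
    e9 : ∀ i j r → suc (i + 2 * j + 2 * r + 0 + 4) ≡ suc (i + 2 * suc (suc j) + 2 * r + 0)
    e9 = solve-∀

  conSum-node : ∀ i j r t → conSum i (suc j) (suc r) (suc t) ≡ conSum (suc i) j (suc r) (suc t) + (conSum i (suc (suc j)) r (suc t) + conSum i (suc (suc j)) r t)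
  conSum-node i j r t = trans (cong-mcBinom {t = suc t} (e1 i j r t) (e2 i j r t) (e3 i j r t)) (trans (mcBinom-pascal (1 + (j + r)) t (i + 2 * j + 3 * r + 4) (i + 2 * j + 2 * r + (suc t) + 4))
    (cong₂ _+_ (cong-mcBinom {t = (suc t)} (e4 i j r t) (e5 i j r t) (e6 i j r t)) (cong₂ _+_ (cong-mcBinom {t = (suc t)} (e7 i j r t) (e8 i j r t) (e9 i j r t)) (cong-mcBinom {t = t} (e10 i j r t) (e11 i j r t) (e12 i j r t)))))
    where
    e1 : ∀ i j r t → suc j + suc r ≡ suc (1 + (j + r))
    e1 = solve-∀
    e2 : ∀ i j r t → i + 2 * suc j + 3 * suc r ≡ suc (i + 2 * j + 3 * r + 4)
    e2 = solve-∀
    e3 : ∀ i j r t → suc (i + 2 * suc j + 2 * suc r + (suc t)) ≡ suc (i + 2 * j + 2 * r + (suc t) + 4)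
    e3 = solve-∀
    e4 : ∀ i j r t → (1 + (j + r)) ≡ j + suc r
    e4 = solve-∀
    e5 : ∀ i j r t → (i + 2 * j + 3 * r + 4) ≡ suc i + 2 * j + 3 * suc r
    e5 = solve-∀
    e6 : ∀ i j r t → (i + 2 * j + 2 * r + (suc t) + 4) ≡ suc (suc i + 2 * j + 2 * suc r + (suc t))
    e6 = solve-∀
    e7 : ∀ i j r t → suc (1 + (j + r)) ≡ suc (suc j) + r
    e7 = solve-∀
    e8 : ∀ i j r t → (i + 2 * j + 3 * r + 4) ≡ i + 2 * suc (suc j) + 3 * r
    e8 = solve-∀
    e9 : ∀ i j r t → suc (i + 2 * j + 2 * r + (suc t) + 4) ≡ suc (i + 2 * suc (suc j) + 2 * r + (suc t))
    e9 = solve-∀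
    e10 : ∀ i j r t → suc (1 + (j + r)) ≡ suc (suc j) + r
    e10 = solve-∀
    e11 : ∀ i j r t → (i + 2 * j + 3 * r + 4) ≡ i + 2 * suc (suc j) + 3 * r
    e11 = solve-∀
    e12 : ∀ i j r t → (i + 2 * j + 2 * r + (suc t) + 4) ≡ suc (i + 2 * suc (suc j) + 2 * r + t)
    e12 = solve-∀

  mcBinom-pascal-binom : ∀ m t q l → mcBinom m t (suc q) (suc l) ≡ mcBinom m t q (suc l) + mcBinom m t q l
  mcBinom-pascal-binom m t q l = trans (*-distribˡ-+ (multichoose m t) (binom q l) _) (+-comm (mcBinom m t q l) _)

  -- Here the fixed piece is the head itself: when opened, its span splits into those of the shorter
  -- piece and of its last arc. Only the binomial factor is expanded.
  conSum-snoc : ∀ i r t → conSum i 0 (suc r) t ≡ conSum i 1 r t + arcSum (suc i) 0 r t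
  conSum-snoc i r t = trans (cong-mcBinom {t = t} (e1 i r t) (e2 i r t) (e3 i r t)) (trans (mcBinom-pascal-binom (suc r) t (i + 3 * r + 2) (i + 2 * r + t + 2))
    (cong₂ _+_ (cong-mcBinom {t = t} (e4 i r t) (e5 i r t) (e6 i r t)) (cong-mcBinom {t = t} (e7 i r t) (e8 i r t) (e9 i r t))))
    where
    e1 : ∀ i r t → 0 + suc r ≡ (suc r)
    e1 = solve-∀
    e2 : ∀ i r t → i + 2 * 0 + 3 * suc r ≡ suc (i + 3 * r + 2)
    e2 = solve-∀
    e3 : ∀ i r t → suc (i + 2 * 0 + 2 * suc r + t) ≡ suc (i + 2 * r + t + 2)
    e3 = solve-∀
    e4 : ∀ i r t → (suc r) ≡ 1 + r
    e4 = solve-∀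
    e5 : ∀ i r t → (i + 3 * r + 2) ≡ i + 2 * 1 + 3 * r
    e5 = solve-∀
    e6 : ∀ i r t → suc (i + 2 * r + t + 2) ≡ suc (i + 2 * 1 + 2 * r + t)
    e6 = solve-∀
    e7 : ∀ i r t → (suc r) ≡ suc (0 + r)
    e7 = solve-∀
    e8 : ∀ i r t → (i + 3 * r + 2) ≡ suc (suc i + 2 * 0 + 3 * r)
    e8 = solve-∀
    e9 : ∀ i r t → (i + 2 * r + t + 2) ≡ suc (suc i + 2 * 0 + 2 * r + t)
    e9 = solve-∀

  conSum-snoc-tail : ∀ i r t → conSum (suc i) 0 (suc r) t ≡ conSum (suc i) 1 r t + conSum i 0 (suc r) t
  conSum-snoc-tail i r t = trans (cong-mcBinom {t = t} (e1 i r t) (e2 i r t) (e3 i r t)) (trans (mcBinom-pascal-binom (suc r) t (i + 3 * r + 3) (i + 2 * r + t + 3))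
    (cong₂ _+_ (cong-mcBinom {t = t} (e4 i r t) (e5 i r t) (e6 i r t)) (cong-mcBinom {t = t} (e7 i r t) (e8 i r t) (e9 i r t))))
    where
    e1 : ∀ i r t → 0 + suc r ≡ (suc r)
    e1 = solve-∀
    e2 : ∀ i r t → (suc i) + 2 * 0 + 3 * suc r ≡ suc (i + 3 * r + 3)
    e2 = solve-∀
    e3 : ∀ i r t → suc ((suc i) + 2 * 0 + 2 * suc r + t) ≡ suc (i + 2 * r + t + 3)
    e3 = solve-∀
    e4 : ∀ i r t → (suc r) ≡ 1 + r
    e4 = solve-∀
    e5 : ∀ i r t → (i + 3 * r + 3) ≡ suc i + 2 * 1 + 3 * r
    e5 = solve-∀
    e6 : ∀ i r t → suc (i + 2 * r + t + 3) ≡ suc (suc i + 2 * 1 + 2 * r + t)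
    e6 = solve-∀
    e7 : ∀ i r t → (suc r) ≡ 0 + suc r
    e7 = solve-∀
    e8 : ∀ i r t → (i + 3 * r + 3) ≡ i + 2 * 0 + 3 * suc r
    e8 = solve-∀
    e9 : ∀ i r t → (i + 2 * r + t + 3) ≡ suc (i + 2 * 0 + 2 * suc r + t)
    e9 = solve-∀

  private
    -- For the head arc Pascal's rule is not enough: an arc over a leaf is one longer than its
    -- piece, so the number `W` of stacks enters, and `W` is known only through (j + r) `W`. Hence
    -- both sides are multiplied by j + r, which is positive.
    arcSum-head-identity : ∀ μ i j r t K′ K″ a b W → suc μ ≡ j + r → t * K′ ≡ (j + r) * K″ →
      r * a ≡ t * a + suc (i + 2 * j + 2 * r + t) * b →
      (j + r) * W ≡ j * (K′ * a) + suc i * (K′ * b) →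
      (K′ + K″) * (a + b) ≡ K′ * b + W + (2 * ((K′ + K″) * b) + 2 * (K″ * a))
    arcSum-head-identity μ i j r t K′ K″ a b W m≡ tK rab mW = *-cancelˡ-≡ _ _ (suc μ) (subst (λ m → m * X ≡ m * Y) (sym m≡) (begin
      (j + r) * X
        ≡⟨ shape₁ j r K′ K″ a b ⟩
      K′ * (j * a) + K′ * (r * a) + (j + r) * K′ * b + ((j + r) * K″) * (a + b)
        ≡⟨ cong₂ (λ x y → K′ * (j * a) + K′ * x + (j + r) * K′ * b + y * (a + b)) rab (sym tK) ⟩
      K′ * (j * a) + K′ * (t * a + suc (i + 2 * j + 2 * r + t) * b) + (j + r) * K′ * b + (t * K′) * (a + b)
        ≡⟨ shape₂ i j r t K′ a b ⟩
      (j + r) * K′ * b + (j * (K′ * a) + suc i * (K′ * b)) + 2 * (j + r) * K′ * b + 2 * (t * K′) * (a + b)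
        ≡⟨ cong₂ (λ x y → (j + r) * K′ * b + x + 2 * (j + r) * K′ * b + 2 * y * (a + b)) (sym mW) tK ⟩
      (j + r) * K′ * b + (j + r) * W + 2 * (j + r) * K′ * b + 2 * ((j + r) * K″) * (a + b)
        ≡⟨ shape₃ j r K′ K″ a b W ⟩
      (j + r) * Y ∎))
      where
      open ≡-Reasoning
      X = (K′ + K″) * (a + b)
      Y = K′ * b + W + (2 * ((K′ + K″) * b) + 2 * (K″ * a))
      shape₁ : ∀ j r K′ K″ a b → (j + r) * ((K′ + K″) * (a + b)) ≡ K′ * (j * a) + K′ * (r * a) + (j + r) * K′ * b + ((j + r) * K″) * (a + b)
      shape₁ = solve-∀
      shape₂ : ∀ i j r t K′ a b → K′ * (j * a) + K′ * (t * a + suc (i + 2 * j + 2 * r + t) * b) + (j + r) * K′ * b + (t * K′) * (a + b)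
        ≡ (j + r) * K′ * b + (j * (K′ * a) + suc i * (K′ * b)) + 2 * (j + r) * K′ * b + 2 * (t * K′) * (a + b)
      shape₂ = solve-∀
      shape₃ : ∀ j r K′ K″ a b W → (j + r) * K′ * b + (j + r) * W + 2 * (j + r) * K′ * b + 2 * ((j + r) * K″) * (a + b)
        ≡ (j + r) * (K′ * b + W + (2 * ((K′ + K″) * b) + 2 * (K″ * a)))
      shape₃ = solve-∀

    -- Absorption for q - l = r - t, with the difference moved across.
    binom-step : ∀ i j r t → let q = i + 2 * j + 3 * r ; l = i + 2 * j + 2 * r + t in
      r * binom q l ≡ t * binom q l + suc l * binom q (suc l)
    binom-step i j r t = +-cancelˡ-≡ ((i + 2 * j + 2 * r) * a) _ _ (begin
      (i + 2 * j + 2 * r) * a + r * a          ≡⟨ shape₁ i j r a ⟩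
      q * a                                    ≡⟨ binom-absorb q l ⟨
      suc l * b + l * a                        ≡⟨ shape₂ i j r t a b ⟩
      (i + 2 * j + 2 * r) * a + (t * a + suc l * b) ∎)
      where
      open ≡-Reasoning
      q = i + 2 * j + 3 * r
      l = i + 2 * j + 2 * r + t
      a = binom q l
      b = binom q (suc l)
      shape₁ : ∀ i j r a → (i + 2 * j + 2 * r) * a + r * a ≡ (i + 2 * j + 3 * r) * a
      shape₁ = solve-∀
      shape₂ : ∀ i j r t a b → suc (i + 2 * j + 2 * r + t) * b + (i + 2 * j + 2 * r + t) * a
        ≡ (i + 2 * j + 2 * r) * a + (t * a + suc (i + 2 * j + 2 * r + t) * b)
      shape₂ = solve-∀

  -- Meant for the number `W` of stacks of i + 1 pieces and j arcs: the left-hand side is the sum of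
  -- all their spans, the right-hand side that sum taken member by member.
  Total : (i j r t W : ℕ) → Set
  Total i j r t W = (j + r) * W ≡ j * mcBinom (j + r) t (i + 2 * j + 3 * r) (i + 2 * j + 2 * r + t) + suc i * conSum i j r t

  arcSum-head₀ : ∀ i j r W → Total i j (suc r) 0 W →
    arcSum i j (suc r) 0 ≡ conSum i j (suc r) 0 + W + (arcSum i (suc j) r 0 + arcSum i (suc j) r 0)
  arcSum-head₀ i j r W tot = trans (arcSum-head-identity (j + r) i j (suc r) 0 1 0 a b W (sym (+-suc j r)) (sym (*-zeroʳ (j + suc r))) (binom-step i j (suc r) 0) tot)
    (cong (conSum i j (suc r) 0 + W +_) (trans (shape (1 * b)) (cong₂ _+_ eq eq)))
    where
    q = i + 2 * j + 3 * suc r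
    l = i + 2 * j + 2 * suc r + 0
    a = binom q l
    b = binom q (suc l)
    shape : ∀ x → 2 * x + 0 ≡ x + x
    shape = solve-∀
    eq : 1 * b ≡ arcSum i (suc j) r 0
    eq = cong-mcBinom {m = 1} {t = 0} refl (e₁ i j r) (e₂ i j r)
      where
      e₁ : ∀ i j r → i + 2 * j + 3 * suc r ≡ suc (i + 2 * suc j + 3 * r)
      e₁ = solve-∀
      e₂ : ∀ i j r → suc (i + 2 * j + 2 * suc r + 0) ≡ suc (i + 2 * suc j + 2 * r + 0)
      e₂ = solve-∀

  arcSum-head : ∀ i j r t W → Total i j (suc r) (suc t) W →
    arcSum i j (suc r) (suc t) ≡ conSum i j (suc r) (suc t) + W +
      ((arcSum i (suc j) r (suc t) + arcSum i (suc j) r (suc t)) + (arcSum i (suc j) r t + arcSum i (suc j) r t))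
  arcSum-head i j r t W tot = trans (arcSum-head-identity (j + r) i j (suc r) (suc t) (multichoose (j + suc r) (suc t)) (multichoose (suc (j + suc r)) t) a b W
      (sym (+-suc j r)) (multichoose-absorb (j + suc r) t) (binom-step i j (suc r) (suc t)) tot)
    (cong (conSum i j (suc r) (suc t) + W +_) (cong₂ _+_ (trans (shape (mcBinom (suc (j + suc r)) (suc t) q (suc l))) (cong₂ _+_ eq₁ eq₁))
                                                       (trans (shape (mcBinom (suc (j + suc r)) t q l)) (cong₂ _+_ eq₂ eq₂))))
    where
    q = i + 2 * j + 3 * suc r
    l = i + 2 * j + 2 * suc r + suc t
    a = binom q l
    b = binom q (suc l)
    shape : ∀ x → 2 * x ≡ x + x
    shape = solve-∀
    e₀ : ∀ j r → suc (j + suc r) ≡ suc (suc j + r)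
    e₀ = solve-∀
    e₁ : ∀ i j r → i + 2 * j + 3 * suc r ≡ suc (i + 2 * suc j + 3 * r)
    e₁ = solve-∀
    e₂ : ∀ i j r t → suc (i + 2 * j + 2 * suc r + suc t) ≡ suc (i + 2 * suc j + 2 * r + suc t)
    e₂ = solve-∀
    e₃ : ∀ i j r t → i + 2 * j + 2 * suc r + suc t ≡ suc (i + 2 * suc j + 2 * r + t)
    e₃ = solve-∀
    eq₁ : mcBinom (suc (j + suc r)) (suc t) q (suc l) ≡ arcSum i (suc j) r (suc t)
    eq₁ = cong-mcBinom {t = suc t} (e₀ j r) (e₁ i j r) (e₂ i j r t)
    eq₂ : mcBinom (suc (j + suc r)) t q l ≡ arcSum i (suc j) r t
    eq₂ = cong-mcBinom {t = t} (e₀ j r) (e₁ i j r) (e₃ i j r t)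

  -- At excess 0 all trees are trivial: one stack without marks and none with marks.
  -- `arcSum 0 0 0 t` serves as a name for this 1 or 0.
  length-stacks-zero : ∀ i j t → length (stacks i j 0 t) ≡ arcSum 0 0 0 t
  length-stacks-zero i (suc j) t = trans (length-map addLeaf (stacks (suc i) j 0 t)) (length-stacks-zero (suc i) j t)
  length-stacks-zero (suc i) zero t = trans (length-map addNil (stacks i 0 0 t)) (length-stacks-zero i zero t)
  length-stacks-zero zero zero zero = refl
  length-stacks-zero zero zero (suc t) = sym (arcSum-zero-suc 0 0 t)

  arcSpan : ∀ {i j} → Fin j → Stack i j → ℕ
  arcSpan l s = suc (excess (lookup (proj₂ s) l))

  conSpan : ∀ {i j} → Fin i → Stack i j → ℕ
  conSpan l s = span (lookup (proj₁ s) l)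

  private
    arcSum-zero-const : ∀ i j t → arcSum i j 0 t ≡ arcSum 0 0 0 t
    arcSum-zero-const i j zero    = trans (arcSum-zero-0 i j) (sym (arcSum-zero-0 0 0))
    arcSum-zero-const i j (suc t) = trans (arcSum-zero-suc i j t) (sym (arcSum-zero-suc 0 0 t))

    ∑-map-+ : ∀ {A B : Set} (f : B → ℕ) (h : A → B) (g g′ : A → ℕ) → (∀ x → f (h x) ≡ g x + g′ x) → ∀ xs → ∑ f (map h xs) ≡ ∑ g xs + ∑ g′ xs
    ∑-map-+ f h g g′ p xs = trans (∑-map f h p xs) (∑-+ g g′ xs)

    leaf-head : ∀ i j r t → ∑ (arcSpan Fin.zero) (map addLeaf (stacks (suc i) j r t)) ≡
      ∑ (conSpan Fin.zero) (stacks (suc i) j r t) + length (stacks (suc i) j r t)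
    leaf-head i j r t = trans (∑-map-+ (arcSpan Fin.zero) addLeaf (conSpan Fin.zero) (λ _ → 1) (λ { (c ∷ cs , fs) → +-comm 1 (span c) }) (stacks (suc i) j r t))
      (cong (∑ (conSpan Fin.zero) (stacks (suc i) j r t) +_) (trans (∑-const 1 (stacks (suc i) j r t)) (*-identityˡ _)))

    node-head : ∀ b i j r t → ∑ (arcSpan Fin.zero) (map (addNode b) (stacks i (suc (suc j)) r t)) ≡
      ∑ (arcSpan Fin.zero) (stacks i (suc (suc j)) r t) + ∑ (arcSpan (Fin.suc Fin.zero)) (stacks i (suc (suc j)) r t)
    node-head b i j r t = ∑-map-+ (arcSpan Fin.zero) (addNode b) (arcSpan Fin.zero) (arcSpan (Fin.suc Fin.zero))
      (λ { (cs , f ∷ g ∷ fs) → cong suc (sym (+-suc (excess f) (excess g))) }) (stacks i (suc (suc j)) r t)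

    leaf-tail : ∀ i j r t (l : Fin j) → ∑ (arcSpan (Fin.suc l)) (map addLeaf (stacks (suc i) j r t)) ≡ ∑ (arcSpan l) (stacks (suc i) j r t)
    leaf-tail i j r t l = ∑-map (arcSpan (Fin.suc l)) addLeaf (λ { (c ∷ cs , fs) → refl }) (stacks (suc i) j r t)

    node-tail : ∀ b i j r t (l : Fin j) → ∑ (arcSpan (Fin.suc l)) (map (addNode b) (stacks i (suc (suc j)) r t)) ≡ ∑ (arcSpan (Fin.suc (Fin.suc l))) (stacks i (suc (suc j)) r t)
    node-tail b i j r t l = ∑-map (arcSpan (Fin.suc l)) (addNode b) (λ { (cs , f ∷ g ∷ fs) → refl }) (stacks i (suc (suc j)) r t)

    leaf-con : ∀ i j r t (l : Fin i) → ∑ (conSpan l) (map addLeaf (stacks (suc i) j r t)) ≡ ∑ (conSpan (Fin.suc l)) (stacks (suc i) j r t)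
    leaf-con i j r t l = ∑-map (conSpan l) addLeaf (λ { (c ∷ cs , fs) → refl }) (stacks (suc i) j r t)

    node-con : ∀ b i j r t (l : Fin i) → ∑ (conSpan l) (map (addNode b) (stacks i (suc (suc j)) r t)) ≡ ∑ (conSpan l) (stacks i (suc (suc j)) r t)
    node-con b i j r t l = ∑-map (conSpan l) (addNode b) (λ { (cs , f ∷ g ∷ fs) → refl }) (stacks i (suc (suc j)) r t)

    split₃ : ∀ {A : Set} (f : A → ℕ) xs ys zs → ∑ f (xs ++ (ys ++ zs)) ≡ ∑ f xs + (∑ f ys + ∑ f zs)
    split₃ f xs ys zs = trans (∑-++ f xs (ys ++ zs)) (cong (∑ f xs +_) (∑-++ f ys zs))

    total-span : ∀ {i j} (s : Stack i j) → sumV span (proj₁ s) + sumV (λ f → suc (excess f)) (proj₂ s) ≡ j + totalExcess s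
    total-span {i} {j} (cs , fs) = trans (cong (sumV span cs +_) (suc-out fs)) (swap (sumV span cs) j (sumV excess fs))
      where
      swap : ∀ a b c → a + (b + c) ≡ b + (a + c)
      swap = solve-∀
      shift : ∀ a b c → suc a + (b + c) ≡ suc (b + (a + c))
      shift = solve-∀
      suc-out : ∀ {j} (fs : Vec Arc j) → sumV (λ f → suc (excess f)) fs ≡ j + sumV excess fs
      suc-out []                 = refl
      suc-out {j = suc j} (f ∷ fs) = trans (cong (suc (excess f) +_) (suc-out fs)) (shift (excess f) j (sumV excess fs))

  mutual
    -- The induction follows the recursion of `stacks`. Behind the head it is Pascal's rule. At the
    -- head it calls `total` for the same excess but one arc fewer, which keeps the mutual induction
    -- well founded.
    ∑-arcSpan : ∀ i j r t (l : Fin (suc j)) → ∑ (arcSpan l) (stacks i (suc j) r t) ≡ arcSum i j r t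
    ∑-arcSpan i j zero t Fin.zero = trans (leaf-head i j zero t)
      (trans (cong₂ _+_ (trans (∑-conSpan i j zero t Fin.zero) (conSum-zero i j t)) (length-stacks-zero (suc i) j t))
             (sym (arcSum-zero-const i j t)))
    ∑-arcSpan i j (suc r) zero Fin.zero = trans (∑-++ _ (map addLeaf (stacks (suc i) j (suc r) zero)) _)
      (trans (cong₂ _+_ (trans (leaf-head i j (suc r) zero) (cong (_+ length (stacks (suc i) j (suc r) zero)) (∑-conSpan i j (suc r) zero Fin.zero)))
               (trans (node-head false i j r zero) (cong₂ _+_ (∑-arcSpan i (suc j) r zero Fin.zero) (∑-arcSpan i (suc j) r zero (Fin.suc Fin.zero)))))
             (sym (arcSum-head₀ i j r _ (total i j (suc r) zero))))
    ∑-arcSpan i j (suc r) (suc t) Fin.zero = trans (split₃ _ (map addLeaf (stacks (suc i) j (suc r) (suc t))) (map (addNode false) (stacks i (suc (suc j)) r (suc t))) _)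
      (trans (cong₂ _+_ (trans (leaf-head i j (suc r) (suc t)) (cong (_+ length (stacks (suc i) j (suc r) (suc t))) (∑-conSpan i j (suc r) (suc t) Fin.zero)))
               (cong₂ _+_ (trans (node-head false i j r (suc t)) (cong₂ _+_ (∑-arcSpan i (suc j) r (suc t) Fin.zero) (∑-arcSpan i (suc j) r (suc t) (Fin.suc Fin.zero))))
                          (trans (node-head true i j r t) (cong₂ _+_ (∑-arcSpan i (suc j) r t Fin.zero) (∑-arcSpan i (suc j) r t (Fin.suc Fin.zero))))))
             (sym (arcSum-head i j r t _ (total i j (suc r) (suc t)))))
    ∑-arcSpan i (suc j) zero t (Fin.suc l) = trans (leaf-tail i (suc j) zero t l) (trans (∑-arcSpan (suc i) j zero t l) (arcSum-zero-shift i j t))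
    ∑-arcSpan i (suc j) (suc r) zero (Fin.suc l) = trans (∑-++ _ (map addLeaf (stacks (suc i) (suc j) (suc r) zero)) _)
      (trans (cong₂ _+_ (trans (leaf-tail i (suc j) (suc r) zero l) (∑-arcSpan (suc i) j (suc r) zero l))
                        (trans (node-tail false i (suc j) r zero l) (∑-arcSpan i (suc (suc j)) r zero (Fin.suc (Fin.suc l)))))
             (sym (arcSum-node₀ i j r)))
    ∑-arcSpan i (suc j) (suc r) (suc t) (Fin.suc l) = trans (split₃ _ (map addLeaf (stacks (suc i) (suc j) (suc r) (suc t))) (map (addNode false) (stacks i (suc (suc (suc j))) r (suc t))) _)
      (trans (cong₂ _+_ (trans (leaf-tail i (suc j) (suc r) (suc t) l) (∑-arcSpan (suc i) j (suc r) (suc t) l))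
               (cong₂ _+_ (trans (node-tail false i (suc j) r (suc t) l) (∑-arcSpan i (suc (suc j)) r (suc t) (Fin.suc (Fin.suc l))))
                          (trans (node-tail true i (suc j) r t l) (∑-arcSpan i (suc (suc j)) r t (Fin.suc (Fin.suc l))))))
             (sym (arcSum-node i j r t)))

    ∑-conSpan : ∀ i j r t (l : Fin (suc i)) → ∑ (conSpan l) (stacks (suc i) j r t) ≡ conSum i j r t
    ∑-conSpan i (suc j) zero t l = trans (leaf-con (suc i) j zero t l)
      (trans (∑-conSpan (suc i) j zero t (Fin.suc l)) (trans (conSum-zero (suc i) j t) (sym (conSum-zero i (suc j) t))))
    ∑-conSpan i (suc j) (suc r) zero l = trans (∑-++ _ (map addLeaf (stacks (suc (suc i)) j (suc r) zero)) _)
      (trans (cong₂ _+_ (trans (leaf-con (suc i) j (suc r) zero l) (∑-conSpan (suc i) j (suc r) zero (Fin.suc l)))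
                        (trans (node-con false (suc i) j r zero l) (∑-conSpan i (suc (suc j)) r zero l)))
             (sym (conSum-node₀ i j r)))
    ∑-conSpan i (suc j) (suc r) (suc t) l = trans (split₃ _ (map addLeaf (stacks (suc (suc i)) j (suc r) (suc t))) (map (addNode false) (stacks (suc i) (suc (suc j)) r (suc t))) _)
      (trans (cong₂ _+_ (trans (leaf-con (suc i) j (suc r) (suc t) l) (∑-conSpan (suc i) j (suc r) (suc t) (Fin.suc l)))
               (cong₂ _+_ (trans (node-con false (suc i) j r (suc t) l) (∑-conSpan i (suc (suc j)) r (suc t) l))
                          (trans (node-con true (suc i) j r t l) (∑-conSpan i (suc (suc j)) r t l))))
             (sym (conSum-node i j r t)))
    ∑-conSpan i zero zero t Fin.zero = trans (trans (∑-map (conSpan Fin.zero) addNil (λ _ → refl) (stacks i zero zero t)) (∑-const 0 (stacks i zero zero t))) (sym (conSum-zero i zero t))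
    ∑-conSpan (suc i) zero zero t (Fin.suc l) = trans (∑-map (conSpan (Fin.suc l)) addNil (λ _ → refl) (stacks (suc i) zero zero t))
      (trans (∑-conSpan i zero zero t l) (trans (conSum-zero i zero t) (sym (conSum-zero (suc i) zero t))))
    ∑-conSpan i zero (suc r) t Fin.zero = trans (∑-++ _ (map addNil (stacks i zero (suc r) t)) _)
      (trans (cong₂ _+_ (trans (∑-map (conSpan Fin.zero) addNil (λ _ → refl) (stacks i zero (suc r) t)) (∑-const 0 (stacks i zero (suc r) t)))
                        (trans (∑-map-+ (conSpan Fin.zero) addSnoc (conSpan Fin.zero) (arcSpan Fin.zero) (λ { (c ∷ cs , f ∷ fs) → refl }) (stacks (suc i) 1 r t))
                               (cong₂ _+_ (∑-conSpan i 1 r t Fin.zero) (∑-arcSpan (suc i) zero r t Fin.zero))))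
             (sym (conSum-snoc i r t)))
    ∑-conSpan (suc i) zero (suc r) t (Fin.suc l) = trans (∑-++ _ (map addNil (stacks (suc i) zero (suc r) t)) _)
      (trans (cong₂ _+_ (trans (∑-map (conSpan (Fin.suc l)) addNil (λ _ → refl) (stacks (suc i) zero (suc r) t)) (∑-conSpan i zero (suc r) t l))
                        (trans (∑-map (conSpan (Fin.suc l)) addSnoc (λ { (c ∷ cs , f ∷ fs) → refl }) (stacks (suc (suc i)) 1 r t)) (∑-conSpan (suc i) 1 r t (Fin.suc l))))
      (trans (+-comm (conSum i zero (suc r) t) (conSum (suc i) 1 r t)) (sym (conSum-snoc-tail i r t))))

    -- Every stack has total span j + r; summing over stacks and exchanging the
    -- order of summation counts the stacks.
    total : ∀ i j r t → Total i j r t (length (stacks (suc i) j r t))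
    total i j r t = begin
      (j + r) * length S
        ≡⟨ ∑-const (j + r) S ⟨
      ∑ (λ _ → j + r) S
        ≡⟨ ∑-cong S (λ {s} s∈ → trans (cong (j +_) (sym (proj₁ (stacks-sound (suc i) j r t s∈)))) (sym (total-span s))) ⟩
      ∑ (λ s → sumV span (proj₁ s) + sumV (λ f → suc (excess f)) (proj₂ s)) S
        ≡⟨ ∑-+ (λ s → sumV span (proj₁ s)) _ S ⟩
      ∑ (λ s → sumV span (proj₁ s)) S + ∑ (λ s → sumV (λ f → suc (excess f)) (proj₂ s)) S
        ≡⟨ cong₂ _+_ (∑-sumV span proj₁ (conSum i j r t) S (∑-conSpan i j r t)) (arcs j) ⟩
      suc i * conSum i j r t + j * mcBinom (j + r) t (i + 2 * j + 3 * r) (i + 2 * j + 2 * r + t)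
        ≡⟨ +-comm (suc i * conSum i j r t) _ ⟩
      j * mcBinom (j + r) t (i + 2 * j + 3 * r) (i + 2 * j + 2 * r + t) + suc i * conSum i j r t ∎
      where
      open ≡-Reasoning
      S = stacks (suc i) j r t
      e₁ : ∀ i j r → suc (suc i + 2 * j + 3 * r) ≡ i + 2 * suc j + 3 * r
      e₁ = solve-∀
      e₂ : ∀ i j r t → suc (suc i + 2 * j + 2 * r + t) ≡ i + 2 * suc j + 2 * r + t
      e₂ = solve-∀
      arcs : ∀ j → ∑ (λ s → sumV (λ f → suc (excess f)) (proj₂ s)) (stacks (suc i) j r t) ≡ j * mcBinom (j + r) t (i + 2 * j + 3 * r) (i + 2 * j + 2 * r + t)
      arcs zero    = ∑-sumV (λ f → suc (excess f)) proj₂ 0 (stacks (suc i) zero r t) (λ ())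
      arcs (suc j) = ∑-sumV (λ f → suc (excess f)) proj₂ _ (stacks (suc i) (suc j) r t)
        (λ l → trans (∑-arcSpan (suc i) j r t l) (cong-mcBinom {m = suc (j + r)} {t = t} refl (e₁ i j r) (e₂ i j r t)))

-- Connected non-crossing graphs on an interval correspond to trees.

module Interval where
  open Trees
  open import Data.Bool using (Bool; true; false; _∧_; _∨_; T)
  open import Data.Nat using (ℕ; zero; suc; _+_; _≤_; _<_; z≤n; s≤s; _≤?_; _≟_; _≡ᵇ_; _⊓_; _⊔_)
  open import Data.Nat.Properties
  open import Data.Nat.Tactic.RingSolver using (solve-∀)
  open import Data.Product using (∃; _×_; _,_; proj₁; proj₂)
  open import Data.Sum using (_⊎_; inj₁; inj₂)
  open import Data.Empty using (⊥; ⊥-elim)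
  open import Relation.Nullary using (yes; no)
  open import Relation.Binary.Definitions using (tri<; tri≈; tri>)
  open import Relation.Binary.PropositionalEquality using (_≡_; _≢_; refl; sym; trans; cong; cong₂; subst; module ≡-Reasoning)

  -- Statements about an interval read only the entries `g x y` with x < y.
  Graph : Set
  Graph = ℕ → ℕ → Bool

  true≢false : ∀ {b} {A : Set} → b ≡ true → b ≡ false → A
  true≢false p q with trans (sym p) q
  ... | ()

  ¬true⇒false : ∀ {b} → (b ≡ true → ⊥) → b ≡ false
  ¬true⇒false {true}  p = ⊥-elim (p refl)
  ¬true⇒false {false} _ = refl

  bool-ext : ∀ {b c} → (b ≡ true → c ≡ true) → (c ≡ true → b ≡ true) → b ≡ c
  bool-ext {true}  p q = sym (p refl)
  bool-ext {false} p q = sym (¬true⇒false (λ e → true≢false (q e) refl))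

  ∨-true : ∀ b {c} → b ∨ c ≡ true → b ≡ true ⊎ c ≡ true
  ∨-true true  _ = inj₁ refl
  ∨-true false p = inj₂ p

  ∨-introˡ : ∀ {b} c → b ≡ true → b ∨ c ≡ true
  ∨-introˡ c refl = refl

  ∨-introʳ : ∀ b {c} → c ≡ true → b ∨ c ≡ true
  ∨-introʳ true  _ = refl
  ∨-introʳ false p = p

  ∨-false : ∀ b {c} → b ≡ false → c ≡ false → b ∨ c ≡ false
  ∨-false _ refl p = p

  -- A tree describes a graph on the interval [lo, hi].  In a connected piece
  -- snoc c f the cut vertex v is the least neighbour of hi and f describes the
  -- graph on [v, hi].  An arc describes the graph on [lo, hi] under the edge
  -- {lo, hi}, which itself is ignored; in node b f f′ the cut vertex v is the
  -- least neighbour of hi other than lo, and b tells whether {lo, v} is an edge.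
  mutual
    data RepC (g : Graph) : Con → ℕ → ℕ → Set where
      nil  : ∀ {lo} → RepC g nil lo lo
      snoc : ∀ {c f lo v hi} → RepC g c lo v → RepA g f v hi → g v hi ≡ true →
             (∀ {x y} → lo ≤ x → x < v → v < y → y ≤ hi → g x y ≡ false) → RepC g (snoc c f) lo hi

    data RepA (g : Graph) : Arc → ℕ → ℕ → Set where
      leaf : ∀ {c lo hi} → RepC g c lo hi → (∀ {x} → lo < x → x ≤ hi → g x (suc hi) ≡ false) → RepA g (leaf c) lo (suc hi)
      node : ∀ {b f f′ lo v hi} → RepA g f lo v → g lo v ≡ b → RepA g f′ v hi → g v hi ≡ true →
             (∀ {x y} → lo ≤ x → x < v → v < y → y ≤ hi → lo < x ⊎ y < hi → g x y ≡ false) → RepA g (node b f f′) lo hi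

  mutual
    repC-span : ∀ {g c lo hi} → RepC g c lo hi → hi ≡ lo + span c
    repC-span nil = sym (+-identityʳ _)
    repC-span {lo = lo} (snoc {c} {f} p q _ _) = trans (repA-span q) (trans (cong (_+ suc (excess f)) (repC-span p)) (+-assoc lo (span c) _))

    repA-span : ∀ {g f lo hi} → RepA g f lo hi → hi ≡ lo + suc (excess f)
    repA-span {lo = lo} (leaf {c} p _) = trans (cong suc (repC-span p)) (sym (+-suc lo (span c)))
    repA-span {lo = lo} (node {f = f} {f′} p _ q _ _) = trans (repA-span q) (trans (cong (_+ suc (excess f′)) (repA-span p))
      (trans (+-assoc lo (suc (excess f)) _) (cong (λ z → lo + suc z) (+-suc (excess f) (excess f′)))))

  repC-≤ : ∀ {g c lo hi} → RepC g c lo hi → lo ≤ hi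
  repC-≤ {lo = lo} p = subst (lo ≤_) (sym (repC-span p)) (m≤m+n lo _)

  repA-< : ∀ {g f lo hi} → RepA g f lo hi → lo < hi
  repA-< {lo = lo} p = subst (lo <_) (sym (repA-span p)) (m<m+n lo (s≤s z≤n))

  NC : Graph → ℕ → ℕ → Set
  NC g lo hi = ∀ a c b d → lo ≤ a → a < c → c < b → b < d → d ≤ hi → g a b ≡ true → g c d ≡ true → ⊥

  mutual
    repC-NC : ∀ {g c lo hi} → RepC g c lo hi → NC g lo hi
    repC-NC nil a c b d lo≤a a<c c<b b<d d≤hi _ _ = <⇒≱ (<-trans a<c (<-trans c<b b<d)) (≤-trans d≤hi lo≤a)
    repC-NC (snoc {v = v} p q _ cut) a c b d lo≤a a<c c<b b<d d≤hi ab cd with v ≤? a | d ≤? v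
    ... | yes v≤a | _       = repA-NC q a c b d v≤a a<c c<b b<d d≤hi ab cd
    ... | no  _   | yes d≤v = repC-NC p a c b d lo≤a a<c c<b b<d d≤v ab cd
    ... | no  v≰a | no  d≰v with b ≤? v
    ...   | no  b≰v = true≢false ab (cut lo≤a (≰⇒> v≰a) (≰⇒> b≰v) (≤-trans (<⇒≤ b<d) d≤hi))
    ...   | yes b≤v = true≢false cd (cut (≤-trans lo≤a (<⇒≤ a<c)) (<-≤-trans c<b b≤v) (≰⇒> d≰v) d≤hi)

    repA-NC : ∀ {g f lo hi} → RepA g f lo hi → NC g lo hi
    repA-NC (leaf {hi = hi} p none) a c b d lo≤a a<c c<b b<d d≤hi ab cd with d ≤? hi
    ... | yes d≤hi′ = repC-NC p a c b d lo≤a a<c c<b b<d d≤hi′ ab cd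
    ... | no  d≰hi with ≤-antisym d≤hi (≰⇒> d≰hi)
    ...   | refl = true≢false cd (none (≤-<-trans lo≤a a<c) (≤-pred (<-trans c<b b<d)))
    repA-NC (node {v = v} p _ q _ cut) a c b d lo≤a a<c c<b b<d d≤hi ab cd with v ≤? a | d ≤? v
    ... | yes v≤a | _       = repA-NC q a c b d v≤a a<c c<b b<d d≤hi ab cd
    ... | no  _   | yes d≤v = repA-NC p a c b d lo≤a a<c c<b b<d d≤v ab cd
    ... | no  v≰a | no  d≰v with b ≤? v
    ...   | no  b≰v = true≢false ab (cut lo≤a (≰⇒> v≰a) (≰⇒> b≰v) (≤-trans (<⇒≤ b<d) d≤hi) (inj₂ (<-≤-trans b<d d≤hi)))
    ...   | yes b≤v = true≢false cd (cut (≤-trans lo≤a (<⇒≤ a<c)) (<-≤-trans c<b b≤v) (≰⇒> d≰v) d≤hi (inj₁ (≤-<-trans lo≤a a<c)))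

  module _ (g : Graph) where
    mutual
      -- The graph fixes the cut vertex: of two candidates, the smaller one is joined to `hi` by an
      -- edge passing over the larger one, which the larger one's cut condition forbids.
      repC-unique : ∀ {c c′ lo hi} → RepC g c lo hi → RepC g c′ lo hi → c ≡ c′
      repC-unique nil nil = refl
      repC-unique nil (snoc p q _ _) = ⊥-elim (<⇒≱ (repA-< q) (repC-≤ p))
      repC-unique (snoc p q _ _) nil = ⊥-elim (<⇒≱ (repA-< q) (repC-≤ p))
      repC-unique (snoc {v = v} p q e cut) (snoc {v = v′} p′ q′ e′ cut′) with <-cmp v v′
      ... | tri< v<v′ _ _ = true≢false e (cut′ (repC-≤ p) v<v′ (repA-< q′) ≤-refl)
      ... | tri> _ _ v′<v = true≢false e′ (cut (repC-≤ p′) v′<v (repA-< q) ≤-refl)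
      ... | tri≈ _ refl _ = cong₂ snoc (repC-unique p p′) (repA-unique q q′)

      repA-unique : ∀ {f f′ lo hi} → RepA g f lo hi → RepA g f′ lo hi → f ≡ f′
      repA-unique (leaf p _) (leaf p′ _) = cong leaf (repC-unique p p′)
      repA-unique (leaf p none) (node p′ _ q′ e′ _) = true≢false e′ (none (repA-< p′) (≤-pred (repA-< q′)))
      repA-unique (node p _ q e _) (leaf p′ none) = true≢false e (none (repA-< p) (≤-pred (repA-< q)))
      repA-unique (node {v = v} p refl q e cut) (node {v = v′} p′ refl q′ e′ cut′) with <-cmp v v′
      ... | tri< v<v′ _ _ = true≢false e (cut′ (<⇒≤ (repA-< p)) v<v′ (repA-< q′) ≤-refl (inj₁ (repA-< p)))
      ... | tri> _ _ v′<v = true≢false e′ (cut (<⇒≤ (repA-< p′)) v′<v (repA-< q) ≤-refl (inj₁ (repA-< p′)))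
      ... | tri≈ _ refl _ = cong₂ (node _) (repA-unique p p′) (repA-unique q q′)

  -- Connectedness is proved for any equivalence relation that contains the edges, so that it
  -- applies to paths on the circle and to their translates.
  module _ {g : Graph} (_~_ : ℕ → ℕ → Set) (~-refl : ∀ {x} → x ~ x) (~-sym : ∀ {x y} → x ~ y → y ~ x)
           (~-trans : ∀ {x y z} → x ~ y → y ~ z → x ~ z) where

    Contains : ℕ → ℕ → Set
    Contains lo hi = ∀ x y → lo ≤ x → x < y → y ≤ hi → g x y ≡ true → x ~ y

    private
      restrict : ∀ {lo hi lo′ hi′} → lo ≤ lo′ → hi′ ≤ hi → Contains lo hi → Contains lo′ hi′
      restrict p q E x y lo≤x x<y y≤hi = E x y (≤-trans p lo≤x) x<y (≤-trans y≤hi q)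

    mutual
      repC-connected : ∀ {c lo hi} → RepC g c lo hi → Contains lo hi → ∀ x → lo ≤ x → x ≤ hi → lo ~ x
      repC-connected nil E x lo≤x x≤lo with ≤-antisym lo≤x x≤lo
      ... | refl = ~-refl
      repC-connected {lo = lo} {hi} (snoc {v = v} p q e _) E x lo≤x x≤hi with x ≤? v
      ... | yes x≤v = repC-connected p (restrict ≤-refl (<⇒≤ (repA-< q)) E) x lo≤x x≤v
      ... | no  x≰v = ~-trans (repC-connected p (restrict ≤-refl (<⇒≤ (repA-< q)) E) v (repC-≤ p) ≤-refl)
        (repA-connected q (restrict (repC-≤ p) ≤-refl E) (E v hi (repC-≤ p) (repA-< q) ≤-refl e) x (<⇒≤ (≰⇒> x≰v)) x≤hi)

      -- An arc does not include the edge {lo, hi}, so `lo ~ hi` has to be supplied.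
      repA-connected : ∀ {f lo hi} → RepA g f lo hi → Contains lo hi → lo ~ hi → ∀ x → lo ≤ x → x ≤ hi → lo ~ x
      repA-connected (leaf {hi = hi} p _) E lo~hi x lo≤x x≤hi with x ≤? hi
      ... | yes x≤hi′ = repC-connected p (restrict ≤-refl (n≤1+n hi) E) x lo≤x x≤hi′
      ... | no  x≰hi with ≤-antisym x≤hi (≰⇒> x≰hi)
      ...   | refl = lo~hi
      repA-connected {lo = lo} {hi} (node {v = v} p _ q e _) E lo~hi x lo≤x x≤hi = go
        where
        v~hi : v ~ hi
        v~hi = E v hi (<⇒≤ (repA-< p)) (repA-< q) ≤-refl e
        -- The way round through `hi`. It exists whether or not {lo, v} is an edge, which leaves the
        -- mark `b` free.
        lo~v : lo ~ v
        lo~v = ~-trans lo~hi (~-sym v~hi)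
        go : lo ~ x
        go with x ≤? v
        ... | yes x≤v = repA-connected p (restrict ≤-refl (<⇒≤ (repA-< q)) E) lo~v x lo≤x x≤v
        ... | no  x≰v = ~-trans lo~v (repA-connected q (restrict (<⇒≤ (repA-< p)) ≤-refl E) v~hi x (<⇒≤ (≰⇒> x≰v)) x≤hi)

  Agree : Graph → Graph → ℕ → ℕ → Set
  Agree g h lo hi = ∀ x y → lo ≤ x → x < y → y ≤ hi → g x y ≡ h x y

  -- Exempts the pair (lo, hi), about which an arc says nothing.
  AgreeBelow : Graph → Graph → ℕ → ℕ → Set
  AgreeBelow g h lo hi = ∀ x y → lo ≤ x → x < y → y ≤ hi → lo < x ⊎ y < hi → g x y ≡ h x y

  module _ {g h : Graph} where
    mutual
      repC-transport : ∀ {c lo hi} → Agree g h lo hi → RepC g c lo hi → RepC h c lo hi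
      repC-transport ag nil = nil
      repC-transport {hi = hi} ag (snoc {v = v} p q e cut) = snoc
        (repC-transport (λ x y a b c → ag x y a b (≤-trans c (<⇒≤ (repA-< q)))) p)
        (repA-transport (λ x y a b c _ → ag x y (≤-trans (repC-≤ p) a) b c) q)
        (trans (sym (ag v hi (repC-≤ p) (repA-< q) ≤-refl)) e)
        (λ {x} {y} a b c d → trans (sym (ag x y a (<-trans b c) d)) (cut a b c d))

      repA-transport : ∀ {f lo hi} → AgreeBelow g h lo hi → RepA g f lo hi → RepA h f lo hi
      repA-transport ag (leaf {hi = hi} p none) = leaf
        (repC-transport (λ x y a b c → ag x y a b (m≤n⇒m≤1+n c) (inj₂ (s≤s c))) p)
        (λ {x} a b → trans (sym (ag x (suc hi) (<⇒≤ a) (s≤s b) ≤-refl (inj₁ a))) (none a b))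
      repA-transport {lo = lo} {hi} ag (node {v = v} p eb q e cut) = node
        (repA-transport (λ x y a b c _ → ag x y a b (≤-trans c (<⇒≤ (repA-< q))) (inj₂ (≤-<-trans c (repA-< q)))) p)
        (trans (sym (ag lo v ≤-refl (repA-< p) (<⇒≤ (repA-< q)) (inj₂ (repA-< q)))) eb)
        (repA-transport (λ x y a b c _ → ag x y (≤-trans (<⇒≤ (repA-< p)) a) b c (inj₁ (<-≤-trans (repA-< p) a))) q)
        (trans (sym (ag v hi (<⇒≤ (repA-< p)) (repA-< q) ≤-refl (inj₁ (repA-< p)))) e)
        (λ {x} {y} a b c d o → trans (sym (ag x y a (<-trans b c) d o)) (cut a b c d o))

    private
      same-cut : ∀ {a b c : ℕ} → b ≡ a → c ≡ a → b ≡ c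
      same-cut refl refl = refl

    mutual
      -- A tree determines its graph: spans fix the cut vertices, and a pair across a cut is a
      -- non-edge in both graphs.
      repC-agree : ∀ {c lo hi} → RepC g c lo hi → RepC h c lo hi → Agree g h lo hi
      repC-agree nil nil x y a b c = ⊥-elim (<⇒≱ b (≤-trans c a))
      repC-agree (snoc p q e cut) (snoc p′ q′ e′ cut′) x y a b c with same-cut (repC-span p) (repC-span p′)
      repC-agree (snoc {v = v} p q e cut) (snoc p′ q′ e′ cut′) x y a b c | refl with y ≤? v | v ≤? x
      ... | yes y≤v | _       = repC-agree p p′ x y a b y≤v
      ... | no  y≰v | no  v≰x = trans (cut a (≰⇒> v≰x) (≰⇒> y≰v) c) (sym (cut′ a (≰⇒> v≰x) (≰⇒> y≰v) c))
      ... | no  _   | yes v≤x with m≤n⇒m<n∨m≡n v≤x | m≤n⇒m<n∨m≡n c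
      ...   | inj₁ v<x | _         = repA-agree q q′ x y v≤x b c (inj₁ v<x)
      ...   | inj₂ _   | inj₁ y<hi = repA-agree q q′ x y v≤x b c (inj₂ y<hi)
      ...   | inj₂ refl | inj₂ refl = trans e (sym e′)

      repA-agree : ∀ {f lo hi} → RepA g f lo hi → RepA h f lo hi → AgreeBelow g h lo hi
      repA-agree (leaf {hi = hi} p none) (leaf p′ none′) x y a b c o with y ≤? hi
      ... | yes y≤hi = repC-agree p p′ x y a b y≤hi
      ... | no  y≰hi with ≤-antisym c (≰⇒> y≰hi) | o
      ...   | refl | inj₁ lo<x = trans (none lo<x (≤-pred b)) (sym (none′ lo<x (≤-pred b)))
      ...   | refl | inj₂ y<hi = ⊥-elim (n≮n _ y<hi)
      repA-agree (node p eb q e cut) (node p′ eb′ q′ e′ cut′) x y a b c o with same-cut (repA-span p) (repA-span p′)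
      repA-agree (node {v = v} p eb q e cut) (node p′ eb′ q′ e′ cut′) x y a b c o | refl with y ≤? v | v ≤? x
      ... | no  y≰v | no  v≰x = trans (cut a (≰⇒> v≰x) (≰⇒> y≰v) c o) (sym (cut′ a (≰⇒> v≰x) (≰⇒> y≰v) c o))
      ... | yes y≤v | _       with m≤n⇒m<n∨m≡n a | m≤n⇒m<n∨m≡n y≤v
      ...   | inj₁ lo<x | _         = repA-agree p p′ x y a b y≤v (inj₁ lo<x)
      ...   | inj₂ _    | inj₁ y<v  = repA-agree p p′ x y a b y≤v (inj₂ y<v)
      ...   | inj₂ refl | inj₂ refl = trans eb (sym eb′)
      repA-agree (node {v = v} p eb q e cut) (node p′ eb′ q′ e′ cut′) x y a b c o | refl | no  _   | yes v≤x with m≤n⇒m<n∨m≡n v≤x | m≤n⇒m<n∨m≡n c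
      ...   | inj₁ v<x | _         = repA-agree q q′ x y v≤x b c (inj₁ v<x)
      ...   | inj₂ _   | inj₁ y<hi = repA-agree q q′ x y v≤x b c (inj₂ y<hi)
      ...   | inj₂ refl | inj₂ refl = trans e (sym e′)

  edge : ℕ → ℕ → Graph
  edge a b x y = (x ≡ᵇ a) ∧ (y ≡ᵇ b)

  mutual
    decC : Con → ℕ → Graph
    decC nil        lo x y = false
    decC (snoc c f) lo x y = decC c lo x y ∨ (edge v (v + suc (excess f)) x y ∨ decA f v x y)
      where v = lo + span c

    decA : Arc → ℕ → Graph
    decA (leaf c)      lo x y = decC c lo x y
    decA (node b f f′) lo x y = decA f lo x y ∨ ((b ∧ edge lo v x y) ∨ (edge v (v + suc (excess f′)) x y ∨ decA f′ v x y))
      where v = lo + suc (excess f)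

  ≡ᵇ-true : ∀ x y → (x ≡ᵇ y) ≡ true → x ≡ y
  ≡ᵇ-true x y p = ≡ᵇ⇒≡ x y (subst T (sym p) _)

  ≡ᵇ-refl : ∀ x → (x ≡ᵇ x) ≡ true
  ≡ᵇ-refl zero    = refl
  ≡ᵇ-refl (suc x) = ≡ᵇ-refl x

  ∧-true : ∀ b {c} → b ∧ c ≡ true → b ≡ true × c ≡ true
  ∧-true true p = refl , p

  edge-true : ∀ a b x y → edge a b x y ≡ true → x ≡ a × y ≡ b
  edge-true a b x y p with ∧-true (x ≡ᵇ a) p
  ... | q , r = ≡ᵇ-true x a q , ≡ᵇ-true y b r

  edge-self : ∀ a b → edge a b a b ≡ true
  edge-self a b = cong₂ _∧_ (≡ᵇ-refl a) (≡ᵇ-refl b)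

  private
    spanSnoc : ∀ lo c f → lo + span c + suc (excess f) ≡ lo + (span c + suc (excess f))
    spanSnoc lo c f = +-assoc lo (span c) _

    spanNode : ∀ lo f f′ → lo + suc (excess f) + suc (excess f′) ≡ lo + suc (suc (excess f + excess f′))
    spanNode lo f f′ = trans (+-assoc lo (suc (excess f)) _) (cong (λ z → lo + suc z) (+-suc (excess f) (excess f′)))

  mutual
    decC-support : ∀ c lo x y → decC c lo x y ≡ true → lo ≤ x × x < y × y ≤ lo + span c
    decC-support (snoc c f) lo x y p with ∨-true (decC c lo x y) p
    ... | inj₁ q with decC-support c lo x y q
    ...   | a , b , e = a , b , ≤-trans e (+-monoʳ-≤ lo (m≤m+n (span c) _))
    decC-support (snoc c f) lo x y p | inj₂ q with ∨-true (edge (lo + span c) (lo + span c + suc (excess f)) x y) q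
    ...   | inj₁ r with edge-true (lo + span c) (lo + span c + suc (excess f)) x y r
    ...     | refl , refl = m≤m+n lo _ , m<m+n _ (s≤s z≤n) , ≤-reflexive (spanSnoc lo c f)
    decC-support (snoc c f) lo x y p | inj₂ q | inj₂ r with decA-support f (lo + span c) x y r
    ...     | a , b , e , _ = ≤-trans (m≤m+n lo _) a , b , ≤-trans e (≤-reflexive (spanSnoc lo c f))

    -- By the last component the edge {lo, hi} itself is never drawn; this makes the unions in
    -- `decC` and `decA` disjoint.
    decA-support : ∀ f lo x y → decA f lo x y ≡ true → lo ≤ x × x < y × y ≤ lo + suc (excess f) × (lo < x ⊎ y < lo + suc (excess f))
    decA-support (leaf c) lo x y p with decC-support c lo x y p
    ... | a , b , e = a , b , ≤-trans e (+-monoʳ-≤ lo (n≤1+n _)) , inj₂ (≤-<-trans e (+-monoʳ-< lo ≤-refl))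
    decA-support (node b f f′) lo x y p with ∨-true (decA f lo x y) p
    ... | inj₁ q with decA-support f lo x y q
    ...   | a , c , e , _ = a , c , ≤-trans e (<⇒≤ v<hi) , inj₂ (≤-<-trans e v<hi)
      where
      v<hi : lo + suc (excess f) < lo + suc (suc (excess f + excess f′))
      v<hi = +-monoʳ-< lo (s≤s (s≤s (m≤m+n _ _)))
    decA-support (node b f f′) lo x y p | inj₂ q with ∨-true (b ∧ edge lo (lo + suc (excess f)) x y) q
    ...   | inj₁ r with edge-true lo (lo + suc (excess f)) x y (proj₂ (∧-true b r))
    ...     | refl , refl = ≤-refl , m<m+n _ (s≤s z≤n) , <⇒≤ v<hi , inj₂ v<hi
      where
      v<hi : lo + suc (excess f) < lo + suc (suc (excess f + excess f′))
      v<hi = +-monoʳ-< lo (s≤s (s≤s (m≤m+n _ _)))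
    decA-support (node b f f′) lo x y p | inj₂ q | inj₂ r with ∨-true (edge (lo + suc (excess f)) (lo + suc (excess f) + suc (excess f′)) x y) r
    ...     | inj₁ u with edge-true (lo + suc (excess f)) (lo + suc (excess f) + suc (excess f′)) x y u
    ...       | refl , refl = m≤m+n lo _ , m<m+n _ (s≤s z≤n) , ≤-reflexive (spanNode lo f f′) , inj₁ (m<m+n lo (s≤s z≤n))
    decA-support (node b f f′) lo x y p | inj₂ q | inj₂ r | inj₂ u with decA-support f′ (lo + suc (excess f)) x y u
    ...       | a , c , e , _ = ≤-trans (m≤m+n lo _) a , c , ≤-trans e (≤-reflexive (spanNode lo f f′)) , inj₁ (<-≤-trans (m<m+n lo (s≤s z≤n)) a)

  private
    edge-falseˡ : ∀ {a b} x y → x ≢ a → edge a b x y ≡ false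
    edge-falseˡ x y x≢a = ¬true⇒false (λ p → x≢a (proj₁ (edge-true _ _ x y p)))

    edge-falseʳ : ∀ {a b} x y → y ≢ b → edge a b x y ≡ false
    edge-falseʳ x y y≢b = ¬true⇒false (λ p → y≢b (proj₂ (edge-true _ _ x y p)))

    ∨-dropˡ : ∀ {b c} → b ≡ false → b ∨ c ≡ c
    ∨-dropˡ refl = refl

    ∨-dropʳ : ∀ b {c} → c ≡ false → b ≡ b ∨ c
    ∨-dropʳ true  _ = refl
    ∨-dropʳ false p = sym p

    ∧-false : ∀ b {c} → c ≡ false → b ∧ c ≡ false
    ∧-false true  p = p
    ∧-false false _ = refl

    ∧-trueʳ : ∀ b {c} → c ≡ true → b ∧ c ≡ b
    ∧-trueʳ true  p = p
    ∧-trueʳ false _ = refl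

  mutual
    -- The parts of the union are supported on different sides of the cut vertex, so on either side
    -- the whole graph agrees with a single part.
    repC-dec : ∀ c lo → RepC (decC c lo) c lo (lo + span c)
    repC-dec nil lo = subst (RepC (decC nil lo) nil lo) (sym (+-identityʳ lo)) nil
    repC-dec (snoc c f) lo = subst (RepC (decC (snoc c f) lo) (snoc c f) lo) (spanSnoc lo c f)
      (snoc (repC-transport left (repC-dec c lo)) (repA-transport right (repA-dec f v))
        (∨-introʳ (decC c lo v hi) (∨-introˡ (decA f v v hi) (edge-self v hi)))
        λ {x} {y} a b e _ → ∨-false (decC c lo x y) (¬true⇒false (λ p → <⇒≱ e (proj₂ (proj₂ (decC-support c lo x y p)))))
          (∨-false (edge v hi x y) (edge-falseˡ x y (<⇒≢ b)) (¬true⇒false (λ p → <⇒≱ b (proj₁ (decA-support f v x y p))))))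
      where
      v = lo + span c
      hi = v + suc (excess f)
      left : Agree (decC c lo) (decC (snoc c f) lo) lo v
      left x y a b e = ∨-dropʳ (decC c lo x y) (∨-false (edge v hi x y) (edge-falseˡ x y (<⇒≢ (<-≤-trans b e)))
        (¬true⇒false (λ p → <⇒≱ (<-≤-trans b e) (proj₁ (decA-support f v x y p)))))
      right : AgreeBelow (decA f v) (decC (snoc c f) lo) v hi
      right x y a b e o = sym (trans (∨-dropˡ (¬true⇒false {decC c lo x y} (λ p → <⇒≱ (<-≤-trans b (proj₂ (proj₂ (decC-support c lo x y p)))) a)))
        (cong (_∨ decA f v x y) (not-edge o)))
        where
        not-edge : v < x ⊎ y < hi → edge v hi x y ≡ false
        not-edge (inj₁ v<x)  = edge-falseˡ x y (λ z → <⇒≢ v<x (sym z))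
        not-edge (inj₂ y<hi) = edge-falseʳ x y (<⇒≢ y<hi)

    repA-dec : ∀ f lo → RepA (decA f lo) f lo (lo + suc (excess f))
    repA-dec (leaf c) lo = subst (RepA (decC c lo) (leaf c) lo) (sym (+-suc lo (span c)))
      (leaf (repC-dec c lo) λ {x} a b → ¬true⇒false (λ p → <⇒≱ (n<1+n (lo + span c)) (proj₂ (proj₂ (decC-support c lo x _ p)))))
    repA-dec (node b f f′) lo = subst (RepA (decA (node b f f′) lo) (node b f f′) lo) (spanNode lo f f′)
      (node (repA-transport left (repA-dec f lo)) top (repA-transport right (repA-dec f′ v))
        (∨-introʳ (decA f lo v hi) (∨-introʳ (b ∧ edge lo v v hi) (∨-introˡ (decA f′ v v hi) (edge-self v hi))))
        λ {x} {y} p q r _ _ → ∨-false (decA f lo x y) (¬true⇒false (λ z → <⇒≱ r (proj₁ (proj₂ (proj₂ (decA-support f lo x y z))))))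
          (∨-false (b ∧ edge lo v x y) (∧-false b (edge-falseʳ x y (λ z → <⇒≢ r (sym z))))
            (∨-false (edge v hi x y) (edge-falseˡ x y (<⇒≢ q)) (¬true⇒false (λ z → <⇒≱ q (proj₁ (decA-support f′ v x y z)))))))
      where
      v = lo + suc (excess f)
      hi = v + suc (excess f′)
      lo<v : lo < v
      lo<v = m<m+n lo (s≤s z≤n)
      right-false : ∀ x y → x < v → (edge v hi x y ∨ decA f′ v x y) ≡ false
      right-false x y x<v = ∨-false (edge v hi x y) (edge-falseˡ x y (<⇒≢ x<v)) (¬true⇒false (λ z → <⇒≱ x<v (proj₁ (decA-support f′ v x y z))))
      top : decA (node b f f′) lo lo v ≡ b
      top = trans (∨-dropˡ (¬true⇒false {decA f lo lo v} notop))
        (trans (sym (∨-dropʳ (b ∧ edge lo v lo v) (right-false lo v lo<v))) (∧-trueʳ b (edge-self lo v)))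
        where
        notop : decA f lo lo v ≡ true → ⊥
        notop z with proj₂ (proj₂ (proj₂ (decA-support f lo lo v z)))
        ... | inj₁ q = n≮n lo q
        ... | inj₂ q = n≮n v q
      left : AgreeBelow (decA f lo) (decA (node b f f′) lo) lo v
      left x y p q r o = ∨-dropʳ (decA f lo x y) (∨-false (b ∧ edge lo v x y) (∧-false b (not-edge o)) (right-false x y (<-≤-trans q r)))
        where
        not-edge : lo < x ⊎ y < v → edge lo v x y ≡ false
        not-edge (inj₁ lo<x) = edge-falseˡ x y (λ z → <⇒≢ lo<x (sym z))
        not-edge (inj₂ y<v)  = edge-falseʳ x y (<⇒≢ y<v)
      right : AgreeBelow (decA f′ v) (decA (node b f f′) lo) v hi
      right x y p q r o = sym (trans (∨-dropˡ (¬true⇒false {decA f lo x y} (λ z → <⇒≱ (<-≤-trans q (proj₁ (proj₂ (proj₂ (decA-support f lo x y z))))) p)))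
        (trans (∨-dropˡ (∧-false b (edge-falseˡ x y (λ z → <⇒≢ (<-≤-trans lo<v p) (sym z))))) (cong (_∨ decA f′ v x y) (not-edge o))))
        where
        not-edge : v < x ⊎ y < hi → edge v hi x y ≡ false
        not-edge (inj₁ v<x)  = edge-falseˡ x y (λ z → <⇒≢ v<x (sym z))
        not-edge (inj₂ y<hi) = edge-falseʳ x y (<⇒≢ y<hi)

  -- `I` is any functional that is additive on disjoint unions and 1 on single edges. Kept abstract,
  -- one computation serves both for all pairs of vertices and for one period of a symmetric graph.
  module _ (I : Graph → ℕ) (I-∅ : I (λ _ _ → false) ≡ 0)
           (I-∨ : ∀ g h → (∀ x y → g x y ≡ true → h x y ≡ true → ⊥) → I (λ x y → g x y ∨ h x y) ≡ I g + I h)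
           {LO HI : ℕ} (I-edge : ∀ a b → LO ≤ a → a < b → b ≤ HI → I (edge a b) ≡ 1) where
    mutual
      -- The edge {v, hi} drawn by `snoc` or `node` accounts for the extra unit in the recursions of
      -- `span` and `excess`; each mark is one further edge.
      countC : ∀ c lo → LO ≤ lo → lo + span c ≤ HI → I (decC c lo) ≡ span c + marksC c
      countC nil lo _ _ = I-∅
      countC (snoc c f) lo LO≤ ≤HI = begin
        I (decC (snoc c f) lo)
          ≡⟨ I-∨ (decC c lo) _ (λ x y p q → <⇒≱ (<-≤-trans (proj₁ (proj₂ (decC-support c lo x y p))) (proj₂ (proj₂ (decC-support c lo x y p)))) (right x y q)) ⟩
        I (decC c lo) + I (λ x y → edge v hi x y ∨ decA f v x y)
          ≡⟨ cong (I (decC c lo) +_) (I-∨ (edge v hi) (decA f v) disjoint) ⟩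
        I (decC c lo) + (I (edge v hi) + I (decA f v))
          ≡⟨ cong₂ _+_ (countC c lo LO≤ (≤-trans (<⇒≤ v<hi) hi≤HI)) (cong₂ _+_ (I-edge v hi (≤-trans LO≤ (m≤m+n lo _)) v<hi hi≤HI) (countA f v (≤-trans LO≤ (m≤m+n lo _)) hi≤HI)) ⟩
        span c + marksC c + (1 + (excess f + marksA f))
          ≡⟨ shape (span c) (marksC c) (excess f) (marksA f) ⟩
        span c + suc (excess f) + (marksC c + marksA f) ∎
        where
        open ≡-Reasoning
        v = lo + span c
        hi = v + suc (excess f)
        v<hi : v < hi
        v<hi = m<m+n v (s≤s z≤n)
        hi≤HI : hi ≤ HI
        hi≤HI = ≤-trans (≤-reflexive (spanSnoc lo c f)) ≤HI
        shape : ∀ a b c d → a + b + (1 + (c + d)) ≡ a + suc c + (b + d)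
        shape = solve-∀
        right : ∀ x y → edge v hi x y ∨ decA f v x y ≡ true → v ≤ x
        right x y q with ∨-true (edge v hi x y) q
        ... | inj₁ e = ≤-reflexive (sym (proj₁ (edge-true v hi x y e)))
        ... | inj₂ e = proj₁ (decA-support f v x y e)
        disjoint : ∀ x y → edge v hi x y ≡ true → decA f v x y ≡ true → ⊥
        disjoint x y e p with edge-true v hi x y e
        ... | refl , refl with proj₂ (proj₂ (proj₂ (decA-support f v x y p)))
        ...   | inj₁ q = n≮n _ q
        ...   | inj₂ q = n≮n _ q

      countA : ∀ f lo → LO ≤ lo → lo + suc (excess f) ≤ HI → I (decA f lo) ≡ excess f + marksA f
      countA (leaf c) lo LO≤ ≤HI = countC c lo LO≤ (≤-trans (+-monoʳ-≤ lo (n≤1+n _)) ≤HI)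
      countA (node b f f′) lo LO≤ ≤HI = begin
        I (decA (node b f f′) lo)
          ≡⟨ I-∨ (decA f lo) _ disjoint₁ ⟩
        I (decA f lo) + I (λ x y → (b ∧ edge lo v x y) ∨ (edge v hi x y ∨ decA f′ v x y))
          ≡⟨ cong (I (decA f lo) +_) (I-∨ (λ x y → b ∧ edge lo v x y) _ (λ x y p q → <⇒≱ (subst (_< v) (sym (proj₁ (edge-true lo v x y (proj₂ (∧-true b p))))) lo<v) (right x y q))) ⟩
        I (decA f lo) + (I (λ x y → b ∧ edge lo v x y) + I (λ x y → edge v hi x y ∨ decA f′ v x y))
          ≡⟨ cong (λ z → I (decA f lo) + (I (λ x y → b ∧ edge lo v x y) + z)) (I-∨ (edge v hi) (decA f′ v) disjoint₂) ⟩
        I (decA f lo) + (I (λ x y → b ∧ edge lo v x y) + (I (edge v hi) + I (decA f′ v)))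
          ≡⟨ cong₂ _+_ (countA f lo LO≤ (≤-trans (<⇒≤ v<hi) hi≤HI)) (cong₂ _+_ (mark b) (cong₂ _+_ (I-edge v hi (≤-trans LO≤ (<⇒≤ lo<v)) v<hi hi≤HI) (countA f′ v (≤-trans LO≤ (<⇒≤ lo<v)) hi≤HI))) ⟩
        excess f + marksA f + (bit b + (1 + (excess f′ + marksA f′)))
          ≡⟨ shape (excess f) (marksA f) (bit b) (excess f′) (marksA f′) ⟩
        suc (excess f + excess f′) + (bit b + (marksA f + marksA f′)) ∎
        where
        open ≡-Reasoning
        v = lo + suc (excess f)
        hi = v + suc (excess f′)
        lo<v : lo < v
        lo<v = m<m+n lo (s≤s z≤n)
        v<hi : v < hi
        v<hi = m<m+n v (s≤s z≤n)
        hi≤HI : hi ≤ HI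
        hi≤HI = ≤-trans (≤-reflexive (spanNode lo f f′)) ≤HI
        shape : ∀ a b c d e → a + b + (c + (1 + (d + e))) ≡ suc (a + d) + (c + (b + e))
        shape = solve-∀
        mark : ∀ b → I (λ x y → b ∧ edge lo v x y) ≡ bit b
        mark true  = I-edge lo v LO≤ lo<v (≤-trans (<⇒≤ v<hi) hi≤HI)
        mark false = I-∅
        right : ∀ x y → edge v hi x y ∨ decA f′ v x y ≡ true → v ≤ x
        right x y q with ∨-true (edge v hi x y) q
        ... | inj₁ e = ≤-reflexive (sym (proj₁ (edge-true v hi x y e)))
        ... | inj₂ e = proj₁ (decA-support f′ v x y e)
        disjoint₂ : ∀ x y → edge v hi x y ≡ true → decA f′ v x y ≡ true → ⊥
        disjoint₂ x y e p with edge-true v hi x y e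
        ... | refl , refl with proj₂ (proj₂ (proj₂ (decA-support f′ v x y p)))
        ...   | inj₁ q = n≮n _ q
        ...   | inj₂ q = n≮n _ q
        disjoint₁ : ∀ x y → decA f lo x y ≡ true → (b ∧ edge lo v x y) ∨ (edge v hi x y ∨ decA f′ v x y) ≡ true → ⊥
        disjoint₁ x y p q with decA-support f lo x y p | ∨-true (b ∧ edge lo v x y) q
        ... | _ , x<y , y≤v , _ | inj₂ r = <⇒≱ (<-≤-trans x<y y≤v) (right x y r)
        ... | _ , x<y , y≤v , o | inj₁ r with edge-true lo v x y (proj₂ (∧-true b r)) | o
        ...   | refl , refl | inj₁ z = n≮n _ z
        ...   | refl , refl | inj₂ z = n≮n _ z

  Closed : Graph → ℕ → ℕ → (ℕ → ℕ) → Set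
  Closed g lo hi χ = ∀ x y → lo ≤ x → x < y → y ≤ hi → g x y ≡ true → χ x ≡ χ y

  Constant : ℕ → ℕ → (ℕ → ℕ) → Set
  Constant lo hi χ = ∀ x → lo ≤ x → x ≤ hi → χ x ≡ χ lo

  -- Connectedness stated through colourings: a colouring that is constant along
  -- edges is constant.  For arcs the edge {lo, hi} is taken for granted.
  Conn ArcConn : Graph → ℕ → ℕ → Set
  Conn    g lo hi = ∀ χ → Closed g lo hi χ → Constant lo hi χ
  ArcConn g lo hi = ∀ χ → Closed g lo hi χ → χ lo ≡ χ hi → Constant lo hi χ

  leastTrue : ∀ (p : ℕ → Bool) lo n →
    (∀ x → lo ≤ x → x < lo + n → p x ≡ false) ⊎
    (∃ λ v → lo ≤ v × v < lo + n × p v ≡ true × (∀ x → lo ≤ x → x < v → p x ≡ false))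
  leastTrue p lo zero = inj₁ (λ x a b → ⊥-elim (<⇒≱ b (≤-trans (≤-reflexive (+-identityʳ lo)) a)))
  leastTrue p lo (suc n) with p lo in eq
  ... | true  = inj₂ (lo , ≤-refl , m<m+n lo (s≤s z≤n) , eq , λ x a b → ⊥-elim (<⇒≱ b a))
  ... | false with leastTrue p (suc lo) n
  ...   | inj₁ none = inj₁ (λ x a b → head-or x (m≤n⇒m<n∨m≡n a) (subst (x <_) (+-suc lo n) b))
    where
    head-or : ∀ x → lo < x ⊎ lo ≡ x → x < suc (lo + n) → p x ≡ false
    head-or x (inj₁ a) b = none x a b
    head-or x (inj₂ refl) b = eq
  ...   | inj₂ (v , a , b , e , below) = inj₂ (v , <⇒≤ a , subst (v <_) (sym (+-suc lo n)) b , e , λ x c d → head-or x (m≤n⇒m<n∨m≡n c) d)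
    where
    head-or : ∀ x → lo < x ⊎ lo ≡ x → x < v → p x ≡ false
    head-or x (inj₁ a) b = below x a b
    head-or x (inj₂ refl) b = eq

  NC-restrict : ∀ {g lo hi lo′ hi′} → lo ≤ lo′ → hi′ ≤ hi → NC g lo hi → NC g lo′ hi′
  NC-restrict p q nc a c b d e₁ e₂ e₃ e₄ e₅ = nc a c b d (≤-trans p e₁) e₂ e₃ e₄ (≤-trans e₅ q)

  module _ (g : Graph) where
    private
      -- The edge {v, hi} shields v from all edges except those ending in hi.
      cut-at : ∀ {lo v hi x y} → NC g lo hi → g v hi ≡ true → lo ≤ x → x < v → v < y → y < hi → g x y ≡ false
      cut-at {v = v} {hi} {x} {y} nc e a b c d = ¬true⇒false (λ p → nc x v y hi a b c d ≤-refl p e)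

      -- A colouring of [lo, v] is extended by clamping: everything beyond v gets the colour of v.
      -- Clamping from below with `⊔` does the same for [v, hi].
      ⊓-cong-left : ∀ {lo v} (χ : ℕ → ℕ) → Closed g lo v χ → ∀ x y → lo ≤ x → x < y → y ≤ v → g x y ≡ true → χ (x ⊓ v) ≡ χ (y ⊓ v)
      ⊓-cong-left χ cl x y a b c e = trans (cong χ (m≤n⇒m⊓n≡m (≤-trans (<⇒≤ b) c))) (trans (cl x y a b c e) (cong χ (sym (m≤n⇒m⊓n≡m c))))

      ⊓-cong-right : ∀ {v} (χ : ℕ → ℕ) x y → v ≤ x → x < y → χ (x ⊓ v) ≡ χ (y ⊓ v)
      ⊓-cong-right χ x y a b = cong χ (trans (m≥n⇒m⊓n≡n a) (sym (m≥n⇒m⊓n≡n (≤-trans a (<⇒≤ b)))))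

      ⊔-cong-right : ∀ {v hi} (χ : ℕ → ℕ) → Closed g v hi χ → ∀ x y → v ≤ x → x < y → y ≤ hi → g x y ≡ true → χ (x ⊔ v) ≡ χ (y ⊔ v)
      ⊔-cong-right χ cl x y a b c e = trans (cong χ (m≥n⇒m⊔n≡m a)) (trans (cl x y a b c e) (cong χ (sym (m≥n⇒m⊔n≡m (≤-trans a (<⇒≤ b))))))

      ⊔-cong-left : ∀ {v} (χ : ℕ → ℕ) x y → x < y → y ≤ v → χ (x ⊔ v) ≡ χ (y ⊔ v)
      ⊔-cong-left χ x y a b = cong χ (trans (m≤n⇒m⊔n≡n (≤-trans (<⇒≤ a) b)) (sym (m≤n⇒m⊔n≡n b)))

      shrink : ∀ {lo hi n} → lo < hi → hi ≤ lo + suc n → ∃ λ k → hi ≡ lo + suc k × k ≤ n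
      shrink {lo} {hi} {n} lo<hi hi≤ with m≤n⇒∃[o]m+o≡n lo<hi
      ... | k , eq = k , trans (sym eq) (sym (+-suc lo k)) , ≤-pred (+-cancelˡ-≤ lo _ _ (≤-trans (≤-reflexive (trans (+-suc lo k) eq)) hi≤))

    mutual
      -- The fuel `n` bounds the length. An arc with fuel `n` may have length n + 1, since the last
      -- arc of a piece can span all of it.
      existsC : ∀ n lo hi → lo ≤ hi → hi ≤ lo + n → NC g lo hi → Conn g lo hi → ∃ λ c → RepC g c lo hi
      existsC n lo hi lo≤hi hi≤ nc conn with m≤n⇒m<n∨m≡n lo≤hi
      ... | inj₂ refl = nil , nil
      existsC zero lo hi lo≤hi hi≤ nc conn | inj₁ lo<hi = ⊥-elim (<⇒≱ lo<hi (≤-trans hi≤ (≤-reflexive (+-identityʳ lo))))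
      existsC (suc n) lo hi lo≤hi hi≤ nc conn | inj₁ lo<hi with shrink lo<hi hi≤
      ... | k , refl , k≤n with leastTrue (λ x → g x hi) lo (suc k)
      -- Without neighbours `hi` would be a colour class of its own.
      ...   | inj₁ none = ⊥-elim (1≢0 (trans (sym χhi) (trans (conn χ closed hi (<⇒≤ lo<hi) ≤-refl) (χlow lo lo<hi))))
        where
        χ : ℕ → ℕ
        χ x = bit (x ≡ᵇ hi)
        χhi : χ hi ≡ 1
        χhi = cong bit (≡ᵇ-refl hi)
        χlow : ∀ x → x < hi → χ x ≡ 0
        χlow x x<hi = cong bit (¬true⇒false (λ p → <⇒≢ x<hi (≡ᵇ-true x hi p)))
        1≢0 : 1 ≡ 0 → ⊥
        1≢0 ()
        closed : Closed g lo hi χ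
        closed x y a b c e with m≤n⇒m<n∨m≡n c
        ... | inj₁ y<hi = trans (χlow x (<-trans b y<hi)) (sym (χlow y y<hi))
        ... | inj₂ refl = true≢false e (none x a b)
      ...   | inj₂ (v , lo≤v , v<hi , e , below) = combine
              (existsC n lo v lo≤v (≤-trans (≤-pred (≤-trans v<hi (≤-reflexive (+-suc lo k)))) (+-monoʳ-≤ lo k≤n)) (NC-restrict ≤-refl (<⇒≤ v<hi) nc) connˡ)
              (existsA n v hi v<hi (≤-trans hi≤ (+-monoˡ-≤ (suc n) lo≤v)) (NC-restrict lo≤v ≤-refl nc) connʳ)
        where
        cut : ∀ {x y} → lo ≤ x → x < v → v < y → y ≤ hi → g x y ≡ false
        cut {x} a b c d with m≤n⇒m<n∨m≡n d
        ... | inj₁ y<hi = cut-at nc e a b c y<hi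
        ... | inj₂ refl = below x a b
        combine : (∃ λ c → RepC g c lo v) → (∃ λ f → RepA g f v hi) → ∃ λ c → RepC g c lo hi
        combine (c , p) (f , q) = snoc c f , snoc p q e cut
        connˡ : Conn g lo v
        connˡ χ cl x a b = trans (cong χ (sym (m≤n⇒m⊓n≡m b))) (trans (conn (λ z → χ (z ⊓ v)) closed x a (≤-trans b (<⇒≤ v<hi))) (cong χ (m≤n⇒m⊓n≡m lo≤v)))
          where
          closed : Closed g lo hi (λ z → χ (z ⊓ v))
          closed x y a b c e with y ≤? v | v ≤? x
          ... | yes y≤v | _       = ⊓-cong-left χ cl x y a b y≤v e
          ... | no  _   | yes v≤x = ⊓-cong-right χ x y v≤x b
          ... | no  y≰v | no  v≰x = true≢false e (cut a (≰⇒> v≰x) (≰⇒> y≰v) c)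
        connʳ : ArcConn g v hi
        connʳ χ cl _ x a b = trans (cong χ (sym (m≥n⇒m⊔n≡m a))) (trans (conn (λ z → χ (z ⊔ v)) closed x (≤-trans lo≤v a) b) (cong χ (m≤n⇒m⊔n≡n lo≤v)))
          where
          closed : Closed g lo hi (λ z → χ (z ⊔ v))
          closed x y a b c e with y ≤? v | v ≤? x
          ... | yes y≤v | _       = ⊔-cong-left χ x y b y≤v
          ... | no  _   | yes v≤x = ⊔-cong-right χ cl x y v≤x b c e
          ... | no  y≰v | no  v≰x = true≢false e (cut a (≰⇒> v≰x) (≰⇒> y≰v) c)

      -- An arc of length at most n needs only fuel n - 1, and n > 0 because arcs have positive
      -- length.
      existsA< : ∀ n lo hi → lo < hi → hi ≤ lo + n → NC g lo hi → ArcConn g lo hi → ∃ λ f → RepA g f lo hi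
      existsA< zero    lo hi lo<hi hi≤ nc conn = ⊥-elim (<⇒≱ lo<hi (≤-trans hi≤ (≤-reflexive (+-identityʳ lo))))
      existsA< (suc n) = existsA n

      existsA : ∀ n lo hi → lo < hi → hi ≤ lo + suc n → NC g lo hi → ArcConn g lo hi → ∃ λ f → RepA g f lo hi
      existsA n lo hi lo<hi hi≤ nc conn with shrink lo<hi hi≤
      ... | k , eq , k≤n with trans eq (+-suc lo k)
      ...   | refl with leastTrue (λ x → g x hi) (suc lo) k
      ...     | inj₁ none = let (c , p) = existsC n lo (lo + k) (m≤m+n lo k) (+-monoʳ-≤ lo k≤n) (NC-restrict ≤-refl (n≤1+n _) nc) connC
                            in leaf c , leaf p (λ {x} a b → none x a (s≤s b))
        where
        -- `hi` now hangs on the edge {lo, hi} alone, so a colouring of the rest extends by giving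
        -- `hi` the colour of `lo`.
        connC : Conn g lo (lo + k)
        connC χ cl x a b = trans (sym (χ′-low x (s≤s b))) (trans (conn χ′ closed χ′-ends x a (m≤n⇒m≤1+n b)) (χ′-low lo lo<hi))
          where
          χ′ : ℕ → ℕ
          χ′ x with x ≟ hi
          ... | yes _ = χ lo
          ... | no  _ = χ x
          χ′-low : ∀ x → x < hi → χ′ x ≡ χ x
          χ′-low x x<hi with x ≟ hi
          ... | yes refl = ⊥-elim (n≮n _ x<hi)
          ... | no  _    = refl
          χ′-hi : χ′ hi ≡ χ lo
          χ′-hi with hi ≟ hi
          ... | yes _   = refl
          ... | no hi≢ = ⊥-elim (hi≢ refl)
          χ′-ends : χ′ lo ≡ χ′ hi
          χ′-ends = trans (χ′-low lo lo<hi) (sym χ′-hi)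
          closed : Closed g lo hi χ′
          closed x y a b c e with m≤n⇒m<n∨m≡n c
          ... | inj₁ y<hi = trans (χ′-low x (<-trans b y<hi)) (trans (cl x y a b (≤-pred y<hi) e) (sym (χ′-low y y<hi)))
          ... | inj₂ refl with m≤n⇒m<n∨m≡n a
          ...   | inj₁ lo<x = true≢false e (none x lo<x b)
          ...   | inj₂ refl = χ′-ends
      ...     | inj₂ (v , lo<v , v<hi , e , below) = combine
                (existsA< n lo v lo<v (≤-trans (≤-pred v<hi) (+-monoʳ-≤ lo k≤n)) (NC-restrict ≤-refl (<⇒≤ v<hi) nc) connˡ)
                (existsA< n v hi v<hi (≤-trans (s≤s (+-monoʳ-≤ lo k≤n)) (+-monoˡ-≤ n lo<v)) (NC-restrict (<⇒≤ lo<v) ≤-refl nc) connʳ)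
        where
        cut : ∀ {x y} → lo ≤ x → x < v → v < y → y ≤ hi → lo < x ⊎ y < hi → g x y ≡ false
        cut {x} a b c d o with m≤n⇒m<n∨m≡n d | o
        ... | inj₁ y<hi | _ = cut-at nc e a b c y<hi
        ... | inj₂ refl | inj₁ lo<x = below x lo<x b
        ... | inj₂ refl | inj₂ y<hi = ⊥-elim (n≮n _ y<hi)
        combine : (∃ λ f → RepA g f lo v) → (∃ λ f → RepA g f v hi) → ∃ λ f → RepA g f lo hi
        combine (f , p) (f′ , q) = node (g lo v) f f′ , node p refl q e cut
        -- The pair (lo, hi) alone escapes the cut condition; for it the clamped colours agree by
        -- the assumption on the ends of the shorter arc.
        ends : ∀ {x y} → lo ≤ x → y ≤ hi → (lo < x ⊎ y < hi) ⊎ (lo ≡ x × y ≡ hi)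
        ends a b with m≤n⇒m<n∨m≡n a | m≤n⇒m<n∨m≡n b
        ... | inj₁ p | _ = inj₁ (inj₁ p)
        ... | _ | inj₁ p = inj₁ (inj₂ p)
        ... | inj₂ p | inj₂ q = inj₂ (p , q)
        connˡ : ArcConn g lo v
        connˡ χ cl lo~v x a b = trans (cong χ (sym (m≤n⇒m⊓n≡m b))) (trans (conn (λ z → χ (z ⊓ v)) closed ends-eq x a (≤-trans b (<⇒≤ v<hi))) (cong χ (m≤n⇒m⊓n≡m (<⇒≤ lo<v))))
          where
          ends-eq : χ (lo ⊓ v) ≡ χ (hi ⊓ v)
          ends-eq = trans (cong χ (m≤n⇒m⊓n≡m (<⇒≤ lo<v))) (trans lo~v (cong χ (sym (m≥n⇒m⊓n≡n (<⇒≤ v<hi)))))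
          closed : Closed g lo hi (λ z → χ (z ⊓ v))
          closed x y a b c e with y ≤? v | v ≤? x
          ... | yes y≤v | _       = ⊓-cong-left χ cl x y a b y≤v e
          ... | no  _   | yes v≤x = ⊓-cong-right χ x y v≤x b
          ... | no  y≰v | no  v≰x with ends a c
          ...   | inj₁ o = true≢false e (cut a (≰⇒> v≰x) (≰⇒> y≰v) c o)
          ...   | inj₂ (refl , refl) = ends-eq
        connʳ : ArcConn g v hi
        connʳ χ cl v~hi x a b = trans (cong χ (sym (m≥n⇒m⊔n≡m a))) (trans (conn (λ z → χ (z ⊔ v)) closed ends-eq x (≤-trans (<⇒≤ lo<v) a) b) (cong χ (m≤n⇒m⊔n≡n (<⇒≤ lo<v))))
          where
          ends-eq : χ (lo ⊔ v) ≡ χ (hi ⊔ v)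
          ends-eq = trans (cong χ (m≤n⇒m⊔n≡n (<⇒≤ lo<v))) (trans v~hi (cong χ (sym (m≥n⇒m⊔n≡m (<⇒≤ v<hi)))))
          closed : Closed g lo hi (λ z → χ (z ⊔ v))
          closed x y a b c e with y ≤? v | v ≤? x
          ... | yes y≤v | _       = ⊔-cong-left χ x y b y≤v
          ... | no  _   | yes v≤x = ⊔-cong-right χ cl x y v≤x b c e
          ... | no  y≰v | no  v≰x with ends a c
          ...   | inj₁ o = true≢false e (cut a (≰⇒> v≰x) (≰⇒> y≰v) c o)
          ...   | inj₂ (refl , refl) = ends-eq

-- Adjacency matrices, periodic extension and double sums.

module Matrix where
  open import Defs
  open Trees using (bit)
  open Interval
  open import Data.Bool using (true; false; _∧_; _∨_; T; if_then_else_)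
  open import Data.Bool.Properties using (∨-comm)
  open import Data.Nat using (ℕ; zero; suc; _+_; _*_; _≤_; _<_; z≤n; s≤s; _<ᵇ_)
  open import Data.Nat.Properties
  open import Data.Nat.DivMod using (_%_; _mod_; m%n<n; m<n⇒m%n≡m)
  open import Data.Nat.Tactic.RingSolver using (solve-∀)
  open import Data.Nat.ListAction using (sum)
  open import Data.Fin using (Fin; toℕ)
  import Data.Fin as Fin
  open import Data.Fin.Properties using (toℕ-fromℕ<; toℕ<n; toℕ-injective)
  open import Data.List using (map; allFin; tabulate)
  open import Data.List.Properties using (map-tabulate)
  open import Data.Vec using (Vec; lookup)
  import Data.Vec as Vec
  open import Data.Vec.Properties using (lookup∘tabulate; tabulate∘lookup; tabulate-cong)
  open import Data.Product using (_×_; _,_; proj₁; proj₂)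
  open import Data.Empty using (⊥; ⊥-elim)
  open import Function using (_∘_)
  open import Relation.Binary.Definitions using (tri<; tri≈; tri>)
  open import Relation.Binary.PropositionalEquality using (_≡_; _≢_; refl; sym; trans; cong; cong₂; subst; module ≡-Reasoning)

  Σ< : ℕ → (ℕ → ℕ) → ℕ
  Σ< zero    f = 0
  Σ< (suc n) f = f 0 + Σ< n (f ∘ suc)

  Σ<-cong : ∀ n {f g : ℕ → ℕ} → (∀ x → x < n → f x ≡ g x) → Σ< n f ≡ Σ< n g
  Σ<-cong zero    p = refl
  Σ<-cong (suc n) p = cong₂ _+_ (p 0 (s≤s z≤n)) (Σ<-cong n (λ x x<n → p (suc x) (s≤s x<n)))

  Σ<-0 : ∀ n → Σ< n (λ _ → 0) ≡ 0
  Σ<-0 zero    = refl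
  Σ<-0 (suc n) = Σ<-0 n

  Σ<-zero : ∀ n {f : ℕ → ℕ} → (∀ x → x < n → f x ≡ 0) → Σ< n f ≡ 0
  Σ<-zero n p = trans (Σ<-cong n p) (Σ<-0 n)

  Σ<-+ : ∀ n (f g : ℕ → ℕ) → Σ< n (λ x → f x + g x) ≡ Σ< n f + Σ< n g
  Σ<-+ zero    f g = refl
  Σ<-+ (suc n) f g = trans (cong (f 0 + g 0 +_) (Σ<-+ n (f ∘ suc) (g ∘ suc))) (interchange (f 0) (g 0) _ _)
    where
    interchange : ∀ a b c d → a + b + (c + d) ≡ (a + c) + (b + d)
    interchange = solve-∀

  Σ<-split : ∀ a b (f : ℕ → ℕ) → Σ< (a + b) f ≡ Σ< a f + Σ< b (λ x → f (a + x))
  Σ<-split zero    b f = refl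
  Σ<-split (suc a) b f = trans (cong (f 0 +_) (Σ<-split a b (f ∘ suc))) (sym (+-assoc (f 0) _ _))

  Σ<-swap : ∀ a b (f : ℕ → ℕ → ℕ) → Σ< a (λ x → Σ< b (f x)) ≡ Σ< b (λ y → Σ< a (λ x → f x y))
  Σ<-swap zero    b f = sym (Σ<-0 b)
  Σ<-swap (suc a) b f = trans (cong (Σ< b (f 0) +_) (Σ<-swap a b (f ∘ suc))) (sym (Σ<-+ b (f 0) _))

  -- `Q` is transposed so that, together with `P`, it makes up one row. On the circle, `P` will
  -- count forward edges, `Q` wrapped ones, `B` those found twice, and a row the edges starting at
  -- one vertex.
  Σ<-pair-up : ∀ n (U B P Q : ℕ → ℕ → ℕ) (w : ℕ → ℕ) → (∀ x y → U x y + B x y ≡ P x y + Q x y) →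
    (∀ x → x < n → Σ< n (λ y → P x y + Q y x) ≡ w x) → Σ< n (λ x → Σ< n (U x)) + Σ< n (λ x → Σ< n (B x)) ≡ Σ< n w
  Σ<-pair-up n U B P Q w eq row = begin
    ΣΣ U + ΣΣ B                                        ≡⟨ Σ<-+ n (λ x → Σ< n (U x)) (λ x → Σ< n (B x)) ⟨
    Σ< n (λ x → Σ< n (U x) + Σ< n (B x))               ≡⟨ Σ<-cong n (λ x _ → trans (sym (Σ<-+ n (U x) (B x))) (trans (Σ<-cong n (λ y _ → eq x y)) (Σ<-+ n (P x) (Q x)))) ⟩
    Σ< n (λ x → Σ< n (P x) + Σ< n (Q x))               ≡⟨ Σ<-+ n (λ x → Σ< n (P x)) (λ x → Σ< n (Q x)) ⟩
    ΣΣ P + ΣΣ Q                                        ≡⟨ cong (ΣΣ P +_) (Σ<-swap n n Q) ⟩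
    ΣΣ P + Σ< n (λ x → Σ< n (λ y → Q y x))             ≡⟨ Σ<-+ n (λ x → Σ< n (P x)) (λ x → Σ< n (λ y → Q y x)) ⟨
    Σ< n (λ x → Σ< n (P x) + Σ< n (λ y → Q y x))       ≡⟨ Σ<-cong n (λ x x<n → trans (sym (Σ<-+ n (P x) (λ y → Q y x))) (row x x<n)) ⟩
    Σ< n w                                             ∎
    where
    open ≡-Reasoning
    ΣΣ : (ℕ → ℕ → ℕ) → ℕ
    ΣΣ F = Σ< n (λ x → Σ< n (F x))

  Σ<-single : ∀ n {f : ℕ → ℕ} a → a < n → (∀ x → x < n → x ≢ a → f x ≡ 0) → Σ< n f ≡ f a
  Σ<-single (suc n) {f} zero    _         p = trans (cong (f 0 +_) (Σ<-zero n (λ x x<n → p (suc x) (s≤s x<n) (λ ())))) (+-identityʳ _)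
  Σ<-single (suc n) {f} (suc a) (s≤s a<n) p = cong₂ _+_ (p 0 (s≤s z≤n) (λ ()))
    (Σ<-single n a a<n (λ x x<n x≢a → p (suc x) (s≤s x<n) (λ e → x≢a (suc-injective e))))

  Σ<-repeat : ∀ d m (f : ℕ → ℕ) → (∀ x → f (m + x) ≡ f x) → Σ< (d * m) f ≡ d * Σ< m f
  Σ<-repeat zero    m f p = refl
  Σ<-repeat (suc d) m f p = trans (Σ<-split m (d * m) f)
    (cong (Σ< m f +_) (trans (Σ<-cong (d * m) (λ x _ → p x)) (Σ<-repeat d m f p)))

  sum-allFin : ∀ n (f : Fin n → ℕ) (g : ℕ → ℕ) → (∀ i → f i ≡ g (toℕ i)) → sum (map f (allFin n)) ≡ Σ< n g
  sum-allFin n f g p = trans (cong sum (map-tabulate (λ i → i) f)) (go n f g p)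
    where
    go : ∀ n (f : Fin n → ℕ) (g : ℕ → ℕ) → (∀ i → f i ≡ g (toℕ i)) → sum (tabulate f) ≡ Σ< n g
    go zero    f g p = refl
    go (suc n) f g p = cong₂ _+_ (p Fin.zero) (go n (f ∘ Fin.suc) (g ∘ suc) (p ∘ Fin.suc))

  private
    bit-∨ : ∀ b c → (b ≡ true → c ≡ true → ⊥) → bit (b ∨ c) ≡ bit b + bit c
    bit-∨ true  true  p = ⊥-elim (p refl refl)
    bit-∨ true  false p = refl
    bit-∨ false c     p = refl

  -- Counting the edges of a graph by a double sum in which the pair (o , δ)
  -- stands for the pair of vertices (X o δ , Y o δ).
  module DoubleSum (p r : ℕ) (X Y : ℕ → ℕ → ℕ) where
    edges : Graph → ℕ
    edges g = Σ< p (λ o → Σ< r (λ δ → bit (g (X o δ) (Y o δ))))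

    edges-∅ : edges (λ _ _ → false) ≡ 0
    edges-∅ = Σ<-zero p (λ _ _ → Σ<-0 r)

    edges-∨ : ∀ g h → (∀ x y → g x y ≡ true → h x y ≡ true → ⊥) → edges (λ x y → g x y ∨ h x y) ≡ edges g + edges h
    edges-∨ g h disj = trans
      (Σ<-cong p (λ o _ → trans (Σ<-cong r (λ δ _ → bit-∨ (g (X o δ) (Y o δ)) _ (disj (X o δ) (Y o δ)))) (Σ<-+ r _ _)))
      (Σ<-+ p _ _)

    edges-edge : ∀ a b o δ → o < p → δ < r → X o δ ≡ a → Y o δ ≡ b →
      (∀ o′ δ′ → o′ < p → δ′ < r → X o′ δ′ ≡ a → Y o′ δ′ ≡ b → o′ ≡ o × δ′ ≡ δ) → edges (edge a b) ≡ 1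
    edges-edge a b o δ o<p δ<r refl refl uniq = trans (Σ<-single p o o<p (λ o′ o′<p o′≢o → Σ<-zero r (λ δ′ δ′<r → miss o′ δ′ (λ x y → o′≢o (proj₁ (uniq o′ δ′ o′<p δ′<r x y))))))
      (trans (Σ<-single r δ δ<r (λ δ′ δ′<r δ′≢δ → miss o δ′ (λ x y → δ′≢δ (proj₂ (uniq o δ′ o<p δ′<r x y)))))
        (cong bit (edge-self a b)))
      where
      miss : ∀ o′ δ′ → (X o′ δ′ ≡ a → Y o′ δ′ ≡ b → ⊥) → bit (edge a b (X o′ δ′) (Y o′ δ′)) ≡ 0
      miss o′ δ′ no-hit = cong bit (¬true⇒false (λ e → no-hit (proj₁ (edge-true a b (X o′ δ′) (Y o′ δ′) e)) (proj₂ (edge-true a b (X o′ δ′) (Y o′ δ′) e))))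

  <ᵇ-true : ∀ {x y} → (x <ᵇ y) ≡ true → x < y
  <ᵇ-true {x} {y} p = <ᵇ⇒< x y (subst T (sym p) _)

  <ᵇ-yes : ∀ {x y} → x < y → (x <ᵇ y) ≡ true
  <ᵇ-yes {x} {y} x<y with x <ᵇ y | <⇒<ᵇ x<y
  ... | true | _ = refl

  <ᵇ-no : ∀ {x y} → y ≤ x → (x <ᵇ y) ≡ false
  <ᵇ-no y≤x = ¬true⇒false (λ p → <⇒≱ (<ᵇ-true p) y≤x)

  -- Tree graphs are drawn for x < y only; this is the loopless symmetric relation they stand for.
  symm : Graph → Graph
  symm h x y = ((x <ᵇ y) ∧ h x y) ∨ ((y <ᵇ x) ∧ h y x)

  symm-< : ∀ h {x y} → x < y → symm h x y ≡ h x y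
  symm-< h {x} {y} x<y rewrite <ᵇ-yes x<y | <ᵇ-no (<⇒≤ x<y) with h x y
  ... | true  = refl
  ... | false = refl

  symm-comm : ∀ h x y → symm h x y ≡ symm h y x
  symm-comm h x y = ∨-comm ((x <ᵇ y) ∧ h x y) _

  symm-diag : ∀ h x → symm h x x ≡ false
  symm-diag h x rewrite <ᵇ-no (≤-refl {x}) = refl

  -- Opaque, so that tables of entries never unfold in comparisons; they are accessed through
  -- `entry-mat`.
  opaque
    mat : ∀ n → Graph → Adj n
    mat n h = Vec.tabulate (λ i → Vec.tabulate (λ j → symm h (toℕ i) (toℕ j)))

    entry-mat : ∀ {n} h (i j : Fin n) → entry (mat n h) i j ≡ symm h (toℕ i) (toℕ j)
    entry-mat h i j = trans (cong (λ r → lookup r j) (lookup∘tabulate (λ i → Vec.tabulate (λ j → symm h (toℕ i) (toℕ j))) i)) (lookup∘tabulate _ j)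

  mat-simple : ∀ n h → Simple (mat n h)
  mat-simple n h = (λ i j → trans (entry-mat h i j) (trans (symm-comm h (toℕ i) (toℕ j)) (sym (entry-mat h j i))))
                 , (λ i → trans (entry-mat h i i) (symm-diag h (toℕ i)))

  adj-ext : ∀ {n} {A B : Adj n} → (∀ i j → entry A i j ≡ entry B i j) → A ≡ B
  adj-ext {A = A} {B} p = vec-ext (λ i → vec-ext (p i))
    where
    vec-ext : ∀ {X : Set} {m} {u w : Vec X m} → (∀ i → lookup u i ≡ lookup w i) → u ≡ w
    vec-ext {u = u} {w} q = trans (sym (tabulate∘lookup u)) (trans (tabulate-cong q) (tabulate∘lookup w))

  module _ (n-1 : ℕ) where
    private
      n : ℕ
      n = suc n-1

    toℕ-mod : ∀ x → toℕ (x mod n) ≡ x % n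
    toℕ-mod x = toℕ-fromℕ< (m%n<n x n)

    mod-cong : ∀ {x y} → x % n ≡ y % n → x mod n ≡ y mod n
    mod-cong {x} {y} p = toℕ-injective (trans (toℕ-mod x) (trans p (sym (toℕ-mod y))))

    mod-toℕ : ∀ (i : Fin n) → toℕ i mod n ≡ i
    mod-toℕ i = toℕ-injective (trans (toℕ-mod (toℕ i)) (m<n⇒m%n≡m (toℕ<n i)))

    -- The n-periodic extension to ℕ, as on the universal cover of the circle: wrapping around
    -- becomes a matter of inequalities.
    lift : Adj n → Graph
    lift A x y = entry A (x mod n) (y mod n)

    lift-toℕ : ∀ A (i j : Fin n) → lift A (toℕ i) (toℕ j) ≡ entry A i j
    lift-toℕ A i j = cong₂ (entry A) (mod-toℕ i) (mod-toℕ j)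

    lift-mat : ∀ h {x y} → x < n → y < n → lift (mat n h) x y ≡ symm h x y
    lift-mat h {x} {y} x<n y<n = trans (entry-mat h (x mod n) (y mod n))
      (cong₂ (symm h) (trans (toℕ-mod x) (m<n⇒m%n≡m x<n)) (trans (toℕ-mod y) (m<n⇒m%n≡m y<n)))

    module _ {A : Adj n} (simple : Simple A) where
      lift-comm : ∀ x y → lift A x y ≡ lift A y x
      lift-comm x y = proj₁ simple (x mod n) (y mod n)

      lift-diag : ∀ {x y} → x % n ≡ y % n → lift A x y ≡ false
      lift-diag {x} {y} p = trans (cong (entry A (x mod n)) (sym (mod-cong {x} {y} p))) (proj₂ simple (x mod n))

      mat-lift : ∀ h → (∀ x y → x < y → y < n → lift A x y ≡ h x y) → A ≡ mat n h
      mat-lift h p = adj-ext (λ i j → trans (main i j) (sym (entry-mat h i j)))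
        where
        main : ∀ i j → entry A i j ≡ symm h (toℕ i) (toℕ j)
        main i j with <-cmp (toℕ i) (toℕ j)
        ... | tri< i<j _ _ = trans (sym (lift-toℕ A i j)) (trans (p _ _ i<j (toℕ<n j)) (sym (symm-< h i<j)))
        ... | tri≈ _ i≡j _ = trans (cong (entry A i) (sym (toℕ-injective i≡j))) (trans (proj₂ simple i) (sym (trans (cong (symm h (toℕ i)) (sym i≡j)) (symm-diag h (toℕ i)))))
        ... | tri> _ _ j<i = trans (proj₁ simple i j) (trans (sym (lift-toℕ A j i)) (trans (p _ _ j<i (toℕ<n i))
                               (trans (sym (symm-< h j<i)) (symm-comm h (toℕ j) (toℕ i)))))

    noncrossing-lift : ∀ {A} → NonCrossing A → NC (lift A) 0 n-1
    noncrossing-lift {A} nc a c b d _ a<c c<b b<d d≤ ab cd =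
      nc (a mod n) (b mod n) (c mod n) (d mod n) ab cd (lt a<c c<n) (lt c<b b<n) (lt b<d (s≤s d≤))
      where
      b<n : b < n
      b<n = <-trans b<d (s≤s d≤)
      c<n : c < n
      c<n = <-trans c<b b<n
      lt : ∀ {x y} → x < y → y < n → toℕ (x mod n) < toℕ (y mod n)
      lt {x} {y} x<y y<n = subst₂′ (trans (toℕ-mod x) (m<n⇒m%n≡m (<-trans x<y y<n))) (trans (toℕ-mod y) (m<n⇒m%n≡m y<n)) x<y
        where
        subst₂′ : ∀ {a b c d : ℕ} → a ≡ c → b ≡ d → c < d → a < b
        subst₂′ refl refl p = p

    lift-noncrossing : ∀ {A} → NC (lift A) 0 n-1 → NonCrossing A
    lift-noncrossing {A} nc a b c d ab cd a<c c<b b<d =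
      nc (toℕ a) (toℕ c) (toℕ b) (toℕ d) z≤n a<c c<b b<d (≤-pred (toℕ<n d)) (trans (lift-toℕ A a b) ab) (trans (lift-toℕ A c d) cd)

    connected-colouring : ∀ {A} → Connected A → (χ : Fin n → ℕ) → (∀ i j → Edge A i j → χ i ≡ χ j) → ∀ i j → χ i ≡ χ j
    connected-colouring {A} con χ cl i j = go (con i j)
      where
      go : ∀ {i j} → Path A i j → χ i ≡ χ j
      go here       = refl
      go (step e p) = trans (cl _ _ e) (go p)

    module _ {A : Adj n} (simple : Simple A) where
      path-trans : ∀ {i j k} → Path A i j → Path A j k → Path A i k
      path-trans here       q = q
      path-trans (step e p) q = step e (path-trans p q)

      path-sym : ∀ {i j} → Path A i j → Path A j i
      path-sym here               = here
      path-sym (step {i} {j} e p) = path-trans (path-sym p) (step (trans (proj₁ simple j i) e) here)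

    edgeCount-lift : ∀ A → edgeCount A ≡ Σ< n (λ x → Σ< n (λ y → bit ((x <ᵇ y) ∧ lift A x y)))
    edgeCount-lift A = sum-allFin n _ (λ x → Σ< n (λ y → bit ((x <ᵇ y) ∧ lift A x y))) (λ i → sum-allFin n _ (λ y → bit ((toℕ i <ᵇ y) ∧ lift A (toℕ i) y)) (λ j →
      trans (if-bit ((toℕ i <ᵇ toℕ j) ∧ entry A i j)) (cong (λ z → bit ((toℕ i <ᵇ toℕ j) ∧ z)) (sym (lift-toℕ A i j)))))
      where
      if-bit : ∀ b → (if b then 1 else 0) ≡ bit b
      if-bit true  = refl
      if-bit false = refl

    edgeCount-mat : ∀ h → edgeCount (mat n h) ≡ Σ< n (λ x → Σ< n (λ y → bit ((x <ᵇ y) ∧ h x y)))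
    edgeCount-mat h = trans (edgeCount-lift (mat n h)) (Σ<-cong n (λ x x<n → Σ<-cong n (λ y y<n → cong bit (main x y x<n y<n))))
      where
      main : ∀ x y → x < n → y < n → (x <ᵇ y) ∧ lift (mat n h) x y ≡ (x <ᵇ y) ∧ h x y
      main x y x<n y<n with x <ᵇ y in eq
      ... | false = refl
      ... | true  = trans (lift-mat h x<n y<n) (symm-< h (<ᵇ-true eq))

-- All connected non-crossing graphs, without symmetry.

module Linear where
  open import Defs
  open Trees
  open Interval
  open Matrix
  open import Data.Bool using (true; false; _∧_)
  open import Data.Nat using (ℕ; suc; _+_; _<_; z≤n; s≤s; _<ᵇ_)
  open import Data.Nat.Properties
  open import Data.Nat.DivMod using (_mod_)
  open import Data.Fin using (Fin; toℕ)
  open import Data.Fin.Properties using (toℕ<n; toℕ-fromℕ<)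
  open import Data.List using (List; []; _∷_; map; length)
  open import Data.List.Properties using (length-map)
  open import Data.List.Membership.Propositional using (_∈_)
  open import Data.List.Membership.Propositional.Properties using (∈-map⁺; ∈-map⁻)
  open import Data.List.Relation.Unary.Any using (here; there)
  open import Data.List.Relation.Unary.All using (All; []; _∷_)
  import Data.List.Relation.Unary.All as All
  open import Data.List.Relation.Unary.AllPairs using ([]; _∷_)
  open import Data.List.Relation.Unary.Unique.Propositional using (Unique)
  open import Data.Vec using ([]; _∷_)
  open import Data.Product using (∃; _×_; _,_; proj₁; proj₂)
  open import Data.Empty using (⊥)
  open import Function.Bundles using (_⇔_; mk⇔)
  open import Relation.Binary.Definitions using (tri<; tri≈; tri>)
  open import Relation.Binary.PropositionalEquality using (_≡_; refl; sym; trans; cong; subst)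

  -- The length is a separate index, so that it can be rewritten to a formula while the list stays
  -- as it is.
  record Listing {n : ℕ} (Good : Adj n → Set) (len : ℕ) : Set where
    constructor mkListing
    field
      list     : List (Adj n)
      unique   : Unique list
      complete : ∀ A → (A ∈ list) ⇔ Good A
      size     : length list ≡ len

  -- Injectivity is asked on members only: trees of the wrong length may decode to the same matrix.
  unique-map : ∀ {A B : Set} (f : A → B) xs → (∀ {x y} → x ∈ xs → y ∈ xs → f x ≡ f y → x ≡ y) → Unique xs → Unique (map f xs)
  unique-map f []       inj []         = []
  unique-map f (x ∷ xs) inj (x∉ ∷ uxs) =
    All.tabulate (λ y∈ eq → separate y∈ eq) ∷ unique-map f xs (λ p q → inj (there p) (there q)) uxs
    where
    separate : ∀ {y} → y ∈ map f xs → f x ≡ y → ⊥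
    separate y∈ eq with ∈-map⁻ f y∈
    ... | x′ , x′∈ , refl = All.lookup x∉ x′∈ (inj (here refl) (there x′∈) eq)

  listing : ∀ {n} {Good : Adj n → Set} {T : Set} (ts : List T) → Unique ts → (dec : T → Adj n) →
    (∀ {s t} → s ∈ ts → t ∈ ts → dec s ≡ dec t → s ≡ t) → (∀ {t} → t ∈ ts → Good (dec t)) →
    (∀ A → Good A → ∃ λ t → t ∈ ts × A ≡ dec t) → Listing Good (length ts)
  listing {Good = Good} ts uniq dec inj good cover = mkListing (map dec ts) (unique-map dec ts inj uniq)
    (λ A → mk⇔ (to A) (from A)) (length-map dec ts)
    where
    to : ∀ A → A ∈ map dec ts → Good A
    to A A∈ with ∈-map⁻ dec A∈
    ... | t , t∈ , refl = good t∈
    from : ∀ A → Good A → A ∈ map dec ts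
    from A g with cover A g
    ... | t , t∈ , refl = ∈-map⁺ dec t∈

  module _ (N : ℕ) where
    private
      n : ℕ
      n = suc N

    colouring-lift : ∀ {A : Adj n} → Simple A → Connected A → (χ : ℕ → ℕ) →
      (∀ x y → x < y → y < n → lift N A x y ≡ true → χ x ≡ χ y) → ∀ x y → x < n → y < n → χ x ≡ χ y
    colouring-lift {A} simple con χ cl x y x<n y<n = trans (cong χ (sym (toℕ-fromℕ< x<n)))
      (trans (connected-colouring N con (λ i → χ (toℕ i)) closed (Data.Fin.fromℕ< x<n) (Data.Fin.fromℕ< y<n)) (cong χ (toℕ-fromℕ< y<n)))
      where
      closed : ∀ i j → Edge A i j → χ (toℕ i) ≡ χ (toℕ j)
      closed i j e with <-cmp (toℕ i) (toℕ j)
      ... | tri< i<j _ _ = cl (toℕ i) (toℕ j) i<j (toℕ<n j) (trans (lift-toℕ N A i j) e)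
      ... | tri≈ _ i≡j _ = cong χ i≡j
      ... | tri> _ _ j<i = sym (cl (toℕ j) (toℕ i) j<i (toℕ<n i) (trans (lift-toℕ N A j i) (trans (proj₁ simple j i) e)))

    linear-agree : ∀ h → Agree h (lift N (mat n h)) 0 N
    linear-agree h x y _ x<y y≤N = sym (trans (lift-mat N h (<-trans x<y (s≤s y≤N)) (s≤s y≤N)) (symm-< h x<y))

    decode : Con → Adj n
    decode c = mat n (decC c 0)

    module _ (c : Con) (sp : span c ≡ N) where
      private
        A = decode c
        simple : Simple A
        simple = mat-simple n (decC c 0)

      decode-rep : RepC (lift N A) c 0 N
      decode-rep = repC-transport (linear-agree (decC c 0)) (subst (RepC (decC c 0) c 0) sp (repC-dec c 0))

      decode-connected : Connected A
      decode-connected i j = path-trans N simple (path-sym N simple (from0 i)) (from0 j)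
        where
        from0 : ∀ i → Path A (0 mod n) i
        from0 i = subst (Path A (0 mod n)) (mod-toℕ N i)
          (repC-connected {g = lift N A} (λ x y → Path A (x mod n) (y mod n)) here (path-sym N simple) (path-trans N simple)
            decode-rep (λ x y _ _ _ e → step e here) (toℕ i) z≤n (≤-pred (toℕ<n i)))

      decode-edgeCount : edgeCount A ≡ N + marksC c
      decode-edgeCount = trans (edgeCount-mat N (decC c 0)) (trans
        (Σ<-cong n (λ x _ → Σ<-cong n (λ y _ → cong bit (drop x y))))
        (trans (countC edges edges-∅ edges-∨ {0} {N} (λ a b _ a<b b≤N → edges-edge a b a b (<-trans a<b (s≤s b≤N)) (s≤s b≤N) refl refl (λ _ _ _ _ p q → p , q)) c 0 z≤n (≤-reflexive sp))
          (cong (_+ marksC c) sp)))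
        where
        open DoubleSum n n (λ o δ → o) (λ o δ → δ)
        drop : ∀ x y → (x <ᵇ y) ∧ decC c 0 x y ≡ decC c 0 x y
        drop x y with decC c 0 x y in eq
        ... | true  rewrite <ᵇ-yes (proj₁ (proj₂ (decC-support c 0 x y eq))) = refl
        ... | false with x <ᵇ y
        ...   | true  = refl
        ...   | false = refl

      decode-good : ∀ {t} → marksC c ≡ t → InX n (N + t) A
      decode-good refl = simple , lift-noncrossing N {A} (repC-NC decode-rep) , decode-connected , decode-edgeCount

    encode : ∀ A → Simple A → NonCrossing A → Connected A → ∃ λ c → span c ≡ N × A ≡ decode c
    encode A simple nc con = describe (existsC (lift N A) N 0 N z≤n ≤-refl (noncrossing-lift N {A} nc) conn)
      where
      conn : Conn (lift N A) 0 N
      conn χ cl x _ x≤N = colouring-lift simple con χ (λ x y x<y y<n → cl x y z≤n x<y (≤-pred y<n)) x 0 (s≤s x≤N) (s≤s z≤n)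
      describe : (∃ λ c → RepC (lift N A) c 0 N) → ∃ λ c → span c ≡ N × A ≡ decode c
      describe (c , rep) = c , sp , mat-lift N simple (decC c 0) (λ x y x<y y<n → repC-agree rep rep′ x y z≤n x<y (≤-pred y<n))
        where
        sp : span c ≡ N
        sp = sym (repC-span rep)
        rep′ : RepC (decC c 0) c 0 N
        rep′ = subst (RepC (decC c 0) c 0) sp (repC-dec c 0)

    -- A single piece of length N; its marks are the t edges beyond N.
    linear-listing : ∀ t → Listing (InX n (N + t)) (length (stacks 1 0 N t))
    linear-listing t = listing (stacks 1 0 N t) (stacks-unique 1 0 N t) dec inj good cover
      where
      dec : Stack 1 0 → Adj n
      dec (c ∷ [] , []) = decode c
      props : ∀ {c} → (c ∷ [] , []) ∈ stacks 1 0 N t → span c ≡ N × marksC c ≡ t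
      props {c} s∈ with stacks-sound 1 0 N t s∈
      ... | e , m = trans (drop0 (span c)) e , trans (drop0 (marksC c)) m
        where
        drop0 : ∀ a → a ≡ a + 0 + 0
        drop0 a = sym (trans (+-identityʳ (a + 0)) (+-identityʳ a))
      inj : ∀ {s s′} → s ∈ stacks 1 0 N t → s′ ∈ stacks 1 0 N t → dec s ≡ dec s′ → s ≡ s′
      inj {c ∷ [] , []} {c′ ∷ [] , []} s∈ s′∈ eq = cong (λ z → z ∷ [] , []) (repC-unique (lift N (decode c)) (decode-rep c (proj₁ (props s∈)))
        (subst (λ M → RepC (lift N M) c′ 0 N) (sym eq) (decode-rep c′ (proj₁ (props s′∈)))))
      good : ∀ {s} → s ∈ stacks 1 0 N t → InX n (N + t) (dec s)
      good {c ∷ [] , []} s∈ = decode-good c (proj₁ (props s∈)) (proj₂ (props s∈))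
      cover : ∀ A → InX n (N + t) A → ∃ λ s → s ∈ stacks 1 0 N t × A ≡ dec s
      cover A (simple , nc , con , ec) = found (encode A simple nc con)
        where
        drop0 : ∀ a → a + 0 + 0 ≡ a
        drop0 a = trans (+-identityʳ (a + 0)) (+-identityʳ a)
        found : (∃ λ c → span c ≡ N × A ≡ decode c) → ∃ λ s → s ∈ stacks 1 0 N t × A ≡ dec s
        found (c , sp , A≡) = (c ∷ [] , []) , stacks-complete 1 0 N t _ (trans (drop0 (span c)) sp ,
          trans (drop0 (marksC c)) (+-cancelˡ-≡ N _ _ (trans (sym (decode-edgeCount c sp)) (trans (cong edgeCount (sym A≡)) ec)))) , A≡

-- From a tree of length m and a base point v to a graph on the circle.

module Periodic where
  open import Defs
  open Trees
  open Interval
  open Matrix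
  open import Data.Bool using (true; false; _∧_; _∨_)
  open import Data.Bool.Properties using (∨-comm)
  open import Data.Nat using (ℕ; zero; suc; _+_; _*_; _∸_; _≤_; _<_; z≤n; s≤s; _<ᵇ_; _<?_)
  open import Data.Nat.Properties
  open import Data.Nat.DivMod using (_mod_; _%_; _/_; m%n<n; m≡m%n+[m/n]*n; m<n⇒m%n≡m; [m+kn]%n≡m%n; [m+n]%n≡m%n)
  open import Data.Nat.Tactic.RingSolver using (solve-∀)
  open import Data.Fin using (toℕ)
  open import Data.Fin.Properties using (toℕ<n)
  open import Data.Product using (∃; _×_; _,_; proj₁; proj₂)
  open import Data.Sum using (_⊎_; inj₁; inj₂)
  open import Data.Empty using (⊥; ⊥-elim)
  open import Function using (_∘_)
  open import Relation.Nullary using (yes; no)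
  open import Relation.Binary.Definitions using (tri<; tri≈; tri>)
  open import Relation.Binary.PropositionalEquality using (_≡_; refl; sym; trans; cong; cong₂; subst; subst₂; module ≡-Reasoning)

  -- n = d m with d = 2 + d′ and m = suc μ: rotation by 2π/d is the shift by m.
  module Period (μ d′ N : ℕ) (n≡ : suc N ≡ (2 + d′) * suc μ) where
    m n d : ℕ
    m = suc μ
    n = suc N
    d = 2 + d′

    2m≤n : m + m ≤ n
    2m≤n = ≤-trans (+-monoʳ-≤ m (m≤m+n m (d′ * m))) (≤-reflexive (sym n≡))

    m<n : m < n
    m<n = <-≤-trans (m<m+n m (s≤s z≤n)) 2m≤n

    block : ∀ v a → v ≤ a → ∃ λ i → ∃ λ o → o < m × a ≡ i * m + (v + o)
    block v a v≤a = (a ∸ v) / m , (a ∸ v) % m , m%n<n (a ∸ v) m , (begin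
      a                                              ≡⟨ m+[n∸m]≡n v≤a ⟨
      v + (a ∸ v)                                    ≡⟨ cong (v +_) (m≡m%n+[m/n]*n (a ∸ v) m) ⟩
      v + ((a ∸ v) % m + (a ∸ v) / m * m)            ≡⟨ shape v ((a ∸ v) % m) ((a ∸ v) / m * m) ⟩
      (a ∸ v) / m * m + (v + (a ∸ v) % m)            ∎)
      where
      open ≡-Reasoning
      shape : ∀ a b c → a + (b + c) ≡ c + (a + b)
      shape = solve-∀

    -- The representative of x modulo m in [v , v + m). Adding `m ∸ v` replaces the subtraction of v
    -- from a possibly smaller x.
    reduce : ℕ → ℕ → ℕ
    reduce v x = v + (x + (m ∸ v)) % m

    -- The m-periodic graph on ℕ obtained by repeating the graph of c on [v , v + m].
    lineGraph : Con → ℕ → Graph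
    lineGraph c v x y = decC c v (reduce v x) (reduce v x + (y ∸ x))

    -- Winding the line graph around the circle ℤ/n.
    circleGraph : Con → ℕ → Graph
    circleGraph c v x y = lineGraph c v x y ∨ lineGraph c v y (x + n)

    decodeP : Con → ℕ → Adj n
    decodeP c v = mat n (circleGraph c v)

    module Line (c : Con) (v : ℕ) (v<m : v < m) (sp : span c ≡ m) where
      red : ℕ → ℕ
      red = reduce v

      H : Graph
      H = lineGraph c v

      rep : RepC (decC c v) c v (v + m)
      rep = subst (λ z → RepC (decC c v) c v (v + z)) sp (repC-dec c v)

      support : ∀ x y → decC c v x y ≡ true → v ≤ x × x < y × y ≤ v + m
      support x y e = subst (λ z → v ≤ x × x < y × y ≤ v + z) sp (decC-support c v x y e)

      red-shift : ∀ k x → red (k * m + x) ≡ red x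
      red-shift k x = cong (v +_) (trans (cong (_% m) (shape (k * m) x (m ∸ v))) ([m+kn]%n≡m%n (x + (m ∸ v)) k m))
        where
        shape : ∀ a b c → a + b + c ≡ b + c + a
        shape = solve-∀

      H-shift : ∀ k x y → H (k * m + x) (k * m + y) ≡ H x y
      H-shift k x y = cong₂ (λ r e → decC c v r (r + e)) (red-shift k x) ([m+n]∸[m+o]≡n∸o (k * m) y x)

      H-shift-n : ∀ k x y → H (x + k * n) (y + k * n) ≡ H x y
      H-shift-n k x y = trans (cong₂ H (eq x) (eq y)) (H-shift (k * d) x y)
        where
        shape : ∀ a b c x → x + a * (b * c) ≡ a * b * c + x
        shape = solve-∀
        eq : ∀ x → x + k * n ≡ k * d * m + x
        eq x = trans (cong (λ z → x + k * z) n≡) (shape k d m x)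

      H-period : ∀ x y → H (x + n) (y + n) ≡ H x y
      H-period x y = trans (cong₂ (λ a b → H (x + a) (y + b)) (sym (*-identityˡ n)) (sym (*-identityˡ n))) (H-shift-n 1 x y)

      red-block : ∀ i o → o < m → red (i * m + (v + o)) ≡ v + o
      red-block i o o<m = trans (red-shift i (v + o)) (cong (v +_) (begin
        (v + o + (m ∸ v)) % m      ≡⟨ cong (_% m) (trans (shape v o (m ∸ v)) (cong (o +_) (m+[n∸m]≡n (<⇒≤ v<m)))) ⟩
        (o + m) % m                ≡⟨ [m+n]%n≡m%n o m ⟩
        o % m                      ≡⟨ m<n⇒m%n≡m o<m ⟩
        o                          ∎))
        where
        open ≡-Reasoning
        shape : ∀ a b c → a + b + c ≡ b + (a + c)
        shape = solve-∀

      H-block : ∀ i o o′ → o < m → o ≤ o′ → H (i * m + (v + o)) (i * m + (v + o′)) ≡ decC c v (v + o) (v + o′)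
      H-block i o o′ o<m o≤o′ = cong₂ (decC c v) (red-block i o o<m) (begin
        red (i * m + (v + o)) + (i * m + (v + o′) ∸ (i * m + (v + o)))   ≡⟨ cong₂ _+_ (red-block i o o<m) (trans ([m+n]∸[m+o]≡n∸o (i * m) _ _) ([m+n]∸[m+o]≡n∸o v o′ o)) ⟩
        v + o + (o′ ∸ o)                                                 ≡⟨ +-assoc v o _ ⟩
        v + (o + (o′ ∸ o))                                               ≡⟨ cong (v +_) (m+[n∸m]≡n o≤o′) ⟩
        v + o′                                                           ∎)
        where open ≡-Reasoning

      H-< : ∀ x y → H x y ≡ true → x < y
      H-< x y e with x <? y
      ... | yes p = p
      ... | no x≮y = ⊥-elim (n≮n (red x) (subst (red x <_) (trans (cong (red x +_) (m≤n⇒m∸n≡0 (≮⇒≥ x≮y))) (+-identityʳ _)) (proj₁ (proj₂ (support _ _ e)))))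

      H-end : ∀ i o y → o < m → H (i * m + (v + o)) y ≡ true → y ≤ i * m + (v + m)
      H-end i o y o<m e = begin
        y                                         ≡⟨ m+[n∸m]≡n (<⇒≤ x<y) ⟨
        x + (y ∸ x)                               ≡⟨ +-assoc (i * m) (v + o) _ ⟩
        i * m + (v + o + (y ∸ x))                 ≤⟨ +-monoʳ-≤ (i * m) (subst (λ r → r + (y ∸ x) ≤ v + m) (red-block i o o<m) (proj₂ (proj₂ (support _ _ e)))) ⟩
        i * m + (v + m)                           ∎
        where
        open ≤-Reasoning
        x = i * m + (v + o)
        x<y = H-< x y e

      H-short : ∀ x y → H x y ≡ true → y ≤ x + m
      H-short x y e = begin
        y                       ≡⟨ m+[n∸m]≡n (<⇒≤ (H-< x y e)) ⟨
        x + (y ∸ x)             ≤⟨ +-monoʳ-≤ x (+-cancelˡ-≤ v _ _ (≤-trans (+-monoˡ-≤ (y ∸ x) (m≤m+n v _)) (proj₂ (proj₂ (support _ _ e))))) ⟩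
        x + m                   ∎
        where open ≤-Reasoning

      -- Points are moved up by one period before they are located in a translate, since `block`
      -- asks for v ≤ a.
      v≤m+ : ∀ x → v ≤ 1 * m + x
      v≤m+ x = ≤-trans (<⇒≤ v<m) (≤-trans (≤-reflexive (sym (*-identityˡ m))) (m≤m+n (1 * m) x))

      -- Every edge stays inside one translate of [v , v + m], so it passes over none of the common
      -- end points.
      H-uncrossed : ∀ k x y → x < k * m + v → k * m + v < y → H x y ≡ true → ⊥
      H-uncrossed k x y x<v v<y e with block v (1 * m + x) (v≤m+ x)
      ... | i , o , o<m , eq = <⇒≱ (+-monoʳ-< (1 * m) v<y) (begin
        1 * m + y              ≤⟨ H-end i o (1 * m + y) o<m (trans (cong (λ z → H z (1 * m + y)) (sym eq)) (trans (H-shift 1 x y) e)) ⟩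
        i * m + (v + m)        ≡⟨ shape (i * m) v m ⟩
        suc i * m + v          ≤⟨ +-monoˡ-≤ v (*-monoˡ-≤ m i<k) ⟩
        suc k * m + v          ≡⟨ shape′ m (k * m) v ⟩
        1 * m + (k * m + v)    ∎)
        where
        open ≤-Reasoning
        shape : ∀ a b c → a + (b + c) ≡ c + a + b
        shape = solve-∀
        shape′ : ∀ a b c → a + b + c ≡ 1 * a + (b + c)
        shape′ = solve-∀
        i<k : i < suc k
        i<k = *-cancelʳ-< m i (suc k) (+-cancelʳ-< v _ _ (begin-strict
          i * m + v                ≤⟨ +-monoʳ-≤ (i * m) (m≤m+n v o) ⟩
          i * m + (v + o)          ≡⟨ eq ⟨
          1 * m + x                <⟨ +-monoʳ-< (1 * m) x<v ⟩
          1 * m + (k * m + v)      ≡⟨ shape′ m (k * m) v ⟨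
          suc k * m + v            ∎))

      -- z lies under the edge starting at x, hence in the same translate, and the edge starting at
      -- z stays there too. The crossing would already occur in the graph of the tree.
      H-NC : ∀ x z y w → x < z → z < y → y < w → H x y ≡ true → H z w ≡ true → ⊥
      H-NC x z y w x<z z<y y<w xy zw with block v (1 * m + x) (v≤m+ x)
      ... | i , o , o<m , eq = repC-NC rep (v + o) (v + (z ⊖)) (v + (y ⊖)) (v + (w ⊖)) (m≤m+n v o)
          (lt eq (at z (<⇒≤ x<z)) x<z) (lt (at z (<⇒≤ x<z)) (at y (<⇒≤ x<y)) z<y) (lt (at y (<⇒≤ x<y)) (at w (<⇒≤ x<w)) y<w)
          (le (at w (<⇒≤ x<w)) w-end)
          (trans (sym (H-block i o (y ⊖) o<m (+-cancelˡ-≤ v _ _ (<⇒≤ (lt eq (at y (<⇒≤ x<y)) x<y))))) (trans (sym (cong₂ H eq (at y (<⇒≤ x<y)))) (trans (H-shift 1 x y) xy)))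
          (trans (sym (H-block i (z ⊖) (w ⊖) oz<m (+-cancelˡ-≤ v _ _ (<⇒≤ (lt (at z (<⇒≤ x<z)) (at w (<⇒≤ x<w)) z<w)))))
                 (trans (sym (cong₂ H (at z (<⇒≤ x<z)) (at w (<⇒≤ x<w)))) (trans (H-shift 1 z w) zw)))
        where
        x<y = <-trans x<z z<y
        z<w = <-trans z<y y<w
        x<w = <-trans x<y y<w
        base : ∀ a → x ≤ a → i * m + v ≤ 1 * m + a
        base a x≤a = ≤-trans (+-monoʳ-≤ (i * m) (m≤m+n v o)) (≤-trans (≤-reflexive (sym eq)) (+-monoʳ-≤ (1 * m) x≤a))
        _⊖ : ℕ → ℕ
        a ⊖ = (1 * m + a) ∸ (i * m + v)
        at : ∀ a → x ≤ a → 1 * m + a ≡ i * m + (v + (a ⊖))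
        at a x≤a = trans (sym (m+[n∸m]≡n (base a x≤a))) (+-assoc (i * m) v _)
        lt : ∀ {a b p q} → 1 * m + a ≡ i * m + p → 1 * m + b ≡ i * m + q → a < b → p < q
        lt p q a<b = +-cancelˡ-< (i * m) _ _ (subst₂ _<_ p q (+-monoʳ-< (1 * m) a<b))
        le : ∀ {a p q} → 1 * m + a ≡ i * m + p → 1 * m + a ≤ i * m + q → p ≤ q
        le {a} {p} {q} e f = +-cancelˡ-≤ (i * m) p q (subst (_≤ i * m + q) e f)
        y-end : 1 * m + y ≤ i * m + (v + m)
        y-end = H-end i o (1 * m + y) o<m (trans (cong (λ z → H z (1 * m + y)) (sym eq)) (trans (H-shift 1 x y) xy))
        oz<m : (z ⊖) < m
        oz<m = +-cancelˡ-< v _ _ (<-≤-trans (lt (at z (<⇒≤ x<z)) (at y (<⇒≤ x<y)) z<y) (le (at y (<⇒≤ x<y)) y-end))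
        w-end : 1 * m + w ≤ i * m + (v + m)
        w-end = H-end i (z ⊖) (1 * m + w) oz<m (trans (cong (λ q → H q (1 * m + w)) (sym (at z (<⇒≤ x<z)))) (trans (H-shift 1 z w) zw))

      h : Graph
      h = circleGraph c v

      decP : Adj n
      decP = decodeP c v

      simpleP : Simple decP
      simpleP = mat-simple n h

      private
        A : Adj n
        A = decP

      -- Both points are moved down by the same multiple of n, so that x lands in [0 , n). If y is
      -- then still at least n, it wraps to a smaller vertex and the two disjuncts change places.
      lift-H : ∀ x y → x < y → y < x + n → lift N A x y ≡ H x y ∨ H y (x + n)
      lift-H x y x<y y<x+n = cases (b <? n)
        where
        a = x % n
        k = x / n
        x≡ : x ≡ a + k * n
        x≡ = m≡m%n+[m/n]*n x n
        a<n : a < n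
        a<n = m%n<n x n
        k≤y : k * n ≤ y
        k≤y = ≤-trans (m≤n+m (k * n) a) (≤-trans (≤-reflexive (sym x≡)) (<⇒≤ x<y))
        b = y ∸ k * n
        y≡ : y ≡ b + k * n
        y≡ = sym (m∸n+n≡m k≤y)
        a<b : a < b
        a<b = +-cancelʳ-< (k * n) _ _ (subst₂ _<_ x≡ y≡ x<y)
        swap : ∀ a b c → a + b + c ≡ a + c + b
        swap = solve-∀
        b<a+n : b < a + n
        b<a+n = +-cancelʳ-< (k * n) _ _ (subst₂ _<_ y≡ (trans (cong (_+ n) x≡) (swap a (k * n) n)) y<x+n)
        mod≡ : ∀ {z r} → z ≡ r + k * n → r < n → z mod n ≡ r mod n
        mod≡ {z} {r} refl _ = mod-cong N {r + k * n} {r} ([m+kn]%n≡m%n r k n)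
        H₁ : H x y ≡ H a b
        H₁ = trans (cong₂ H x≡ y≡) (H-shift-n k a b)
        H₂ : H y (x + n) ≡ H b (a + n)
        H₂ = trans (cong₂ H y≡ (trans (cong (_+ n) x≡) (swap a (k * n) n))) (H-shift-n k b (a + n))
        cases : _ → lift N A x y ≡ H x y ∨ H y (x + n)
        cases (yes b<n) = trans (cong₂ (entry A) (mod≡ x≡ a<n) (mod≡ y≡ b<n))
          (trans (lift-mat N h a<n b<n) (trans (symm-< h a<b) (sym (cong₂ _∨_ H₁ H₂))))
        cases (no b≮n) = trans (cong₂ (entry A) (mod≡ x≡ a<n) (mod-cong N {y} {b′} (trans (cong (_% n) y≡′) (trans ([m+kn]%n≡m%n (b′ + n) k n) ([m+n]%n≡m%n b′ n)))))
          (trans (lift-mat N h a<n (<-trans b′<a a<n)) (trans (symm-comm h a b′) (trans (symm-< h b′<a)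
            (trans (∨-comm (H b′ a) (H a (b′ + n))) (sym (cong₂ _∨_ (trans H₁ (cong (H a) b≡)) (trans H₂ (trans (cong (λ z → H z (a + n)) b≡) (H-period b′ a)))))))))
          where
          b′ = b ∸ n
          b≡ : b ≡ b′ + n
          b≡ = sym (m∸n+n≡m (≮⇒≥ b≮n))
          y≡′ : y ≡ b′ + n + k * n
          y≡′ = trans y≡ (cong (_+ k * n) b≡)
          b′<a : b′ < a
          b′<a = +-cancelʳ-< n _ _ (subst (_< a + n) b≡ b<a+n)

      -- Two steps of at most m that close up to a full turn force n ≤ 2m; as n ≥ 2m, both are half
      -- turns.
      diameter : ∀ x y → y ≤ x + m → x + n ≤ y + m → n ≡ m + m × y ≡ x + m
      diameter x y p q = ≤-antisym n≤2m 2m≤n , ≤-antisym p (+-cancelʳ-≤ m _ _ (≤-trans (≤-reflexive (+-assoc x m m)) (≤-trans (+-monoʳ-≤ x 2m≤n) q)))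
        where
        n≤2m : n ≤ m + m
        n≤2m = +-cancelˡ-≤ x _ _ (≤-trans q (≤-trans (+-monoˡ-≤ m p) (≤-reflexive (+-assoc x m m))))

      -- The edge from y to x + n is then a half turn, and it is the edge from x to y moved by m.
      H-diameter : ∀ x y → y ≤ x + m → H y (x + n) ≡ true → H x y ≡ true
      H-diameter x y p e with diameter x y p (H-short y (x + n) e)
      ... | n≡2m , y≡ = trans (trans (cong (H x) y≡) (sym (trans (cong₂ H (trans y≡ (shape₁ x m)) (trans (cong (x +_) n≡2m) (shape₂ x m))) (H-shift 1 x (x + m))))) e
        where
        shape₁ : ∀ x m → x + m ≡ 1 * m + x
        shape₁ = solve-∀
        shape₂ : ∀ x m → x + (m + m) ≡ 1 * m + (x + m)
        shape₂ = solve-∀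

      lift-short : ∀ x y → x < y → y ≤ x + m → lift N A x y ≡ H x y
      lift-short x y x<y y≤ = trans (lift-H x y x<y (≤-<-trans y≤ (+-monoʳ-< x m<n)))
        (bool-ext (λ e → or (∨-true (H x y) e)) (∨-introˡ (H y (x + n))))
        where
        or : H x y ≡ true ⊎ H y (x + n) ≡ true → H x y ≡ true
        or (inj₁ e) = e
        or (inj₂ e) = H-diameter x y y≤ e

      H-base : ∀ x y → v ≤ x → x < y → y ≤ v + m → H x y ≡ decC c v x y
      H-base x y v≤x x<y y≤ = trans (cong₂ H (sym (m+[n∸m]≡n v≤x)) (sym (m+[n∸m]≡n v≤y)))
        (trans (H-block 0 (x ∸ v) (y ∸ v) (+-cancelˡ-< v _ _ (subst (_< v + m) (sym (m+[n∸m]≡n v≤x)) (<-≤-trans x<y y≤))) (∸-monoˡ-≤ v (<⇒≤ x<y)))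
          (cong₂ (decC c v) (m+[n∸m]≡n v≤x) (m+[n∸m]≡n v≤y)))
        where
        v≤y = ≤-trans v≤x (<⇒≤ x<y)

      repP : RepC (lift N A) c v (v + m)
      repP = repC-transport (λ x y v≤x x<y y≤ → sym (trans (lift-short x y x<y (≤-trans y≤ (+-monoˡ-≤ m v≤x))) (H-base x y v≤x x<y y≤))) rep

      -- Either chord may be read forwards or across the end of the circle. In each of the four
      -- combinations the crossing unrolls to a crossing on the line.
      noncrossingP : NonCrossing A
      noncrossingP = lift-noncrossing N {A} nc
        where
        nc : NC (lift N A) 0 N
        nc a c b e _ a<c c<b b<e e≤N ab ce with
            ∨-true (H a b) (trans (sym (lift-H a b (<-trans a<c c<b) (<-≤-trans (<-trans b<e (s≤s e≤N)) (m≤n+m n a)))) ab)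
          | ∨-true (H c e) (trans (sym (lift-H c e (<-trans c<b b<e) (<-≤-trans (s≤s e≤N) (m≤n+m n c)))) ce)
        ... | inj₁ p | inj₁ q = H-NC a c b e a<c c<b b<e p q
        ... | inj₁ p | inj₂ q = H-NC e (a + n) (c + n) (b + n) (<-≤-trans (s≤s e≤N) (m≤n+m n a)) (+-monoˡ-< n a<c) (+-monoˡ-< n c<b) q (trans (H-period a b) p)
        ... | inj₂ p | inj₁ q = H-NC c b e (a + n) c<b b<e (<-≤-trans (s≤s e≤N) (m≤n+m n a)) q p
        ... | inj₂ p | inj₂ q = H-NC b e (a + n) (c + n) b<e (<-≤-trans (s≤s e≤N) (m≤n+m n a)) (+-monoˡ-< n a<c) p q

      lift-shift-< : ∀ x y → x < y → y < n → lift N A (x + m) (y + m) ≡ lift N A x y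
      lift-shift-< x y x<y y<n = trans (lift-H (x + m) (y + m) (+-monoˡ-< m x<y) (subst (y + m <_) (exch x m n) (+-monoˡ-< m (<-≤-trans y<n (m≤n+m n x)))))
        (trans (cong₂ _∨_ (trans (cong₂ H (swap x m) (swap y m)) (H-shift 1 x y)) (trans (cong₂ H (swap y m) (swap′ x m n)) (H-shift 1 y (x + n))))
          (sym (lift-H x y x<y (<-≤-trans y<n (m≤n+m n x)))))
        where
        exch : ∀ x m n → x + n + m ≡ x + m + n
        exch = solve-∀
        swap : ∀ x m → x + m ≡ 1 * m + x
        swap = solve-∀
        swap′ : ∀ x m n → x + m + n ≡ 1 * m + (x + n)
        swap′ = solve-∀

      lift-shift : ∀ x y → x < n → y < n → lift N A (x + m) (y + m) ≡ lift N A x y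
      lift-shift x y x<n y<n with <-cmp x y
      ... | tri≈ _ refl _ = trans (lift-diag N {A} simpleP {x + m} {x + m} refl) (sym (lift-diag N {A} simpleP {x} {x} refl))
      ... | tri< x<y _ _ = lift-shift-< x y x<y y<n
      ... | tri> _ _ y<x = trans (lift-comm N {A} simpleP (x + m) (y + m)) (trans (lift-shift-< y x y<x x<n) (lift-comm N {A} simpleP y x))

      fixedP : FixedBy m A
      fixedP i j = trans (lift-shift (toℕ i) (toℕ j) (toℕ<n i) (toℕ<n j)) (lift-toℕ N A i j)

      -- Each translate of [v , v + m] is connected and shares an end point with the next.
      connectedP : Connected A
      connectedP i j = path-trans N {A} simpleP (path-sym N {A} simpleP (reach i)) (reach j)
        where
        _~_ : ℕ → ℕ → Set
        x ~ y = Path A (x mod n) (y mod n)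
        inBlock : ∀ i o → o ≤ m → (i * m + v) ~ (i * m + (v + o))
        inBlock i o o≤m = repC-connected {g = lift N A} (λ x y → (i * m + x) ~ (i * m + y)) here (path-sym N {A} simpleP) (path-trans N {A} simpleP) repP
          (λ x y v≤x x<y y≤ e → step (trans (lift-short (i * m + x) (i * m + y) (+-monoʳ-< (i * m) x<y) (≤-trans (+-monoʳ-≤ (i * m) (≤-trans y≤ (+-monoˡ-≤ m v≤x))) (≤-reflexive (sym (+-assoc (i * m) x m)))))
                                       (trans (H-shift i x y) (trans (sym (lift-short x y x<y (≤-trans y≤ (+-monoˡ-≤ m v≤x)))) e))) here)
          (v + o) (m≤m+n v o) (+-monoʳ-≤ v o≤m)
        toBlock : ∀ i → v ~ (i * m + v)
        toBlock zero    = here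
        toBlock (suc i) = path-trans N {A} simpleP (toBlock i) (subst (λ z → (i * m + v) ~ z) (shape (i * m) v m) (inBlock i m ≤-refl))
          where
          shape : ∀ a b c → a + (b + c) ≡ c + a + b
          shape = solve-∀
        reach : ∀ j → Path A (v mod n) j
        reach j with block v (toℕ j + n) (≤-trans (<⇒≤ (<-trans v<m m<n)) (m≤n+m n (toℕ j)))
        ... | i , o , o<m , eq = subst (Path A (v mod n)) (trans (mod-cong N {toℕ j + n} {toℕ j} ([m+n]%n≡m%n (toℕ j) n)) (mod-toℕ N j))
          (subst (v ~_) (sym eq) (path-trans N {A} simpleP (toBlock i) (inBlock i o (<⇒≤ o<m))))

      private
        base : Graph
        base = decC c v
        weight : ℕ → ℕ
        weight a = Σ< n (λ δ → bit (base a (a + δ)))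

        base-diag : ∀ a → base a a ≡ false
        base-diag a = ¬true⇒false (λ e → n≮n a (proj₁ (proj₂ (support a a e))))

        -- The edges starting at x, sorted by length δ: those with x + δ < n are found forwards, the
        -- others after wrapping.
        row : ∀ x → x < n → Σ< n (λ y → bit ((x <ᵇ y) ∧ H x y) + bit ((y <ᵇ x) ∧ H x (y + n))) ≡ weight (red x)
        row x x<n = begin
          Σ< n (λ y → f y + g y)                                          ≡⟨ Σ<-+ n f g ⟩
          Σ< n f + Σ< n g                                                 ≡⟨ cong (λ z → Σ< z f + Σ< z g) n≡x+r ⟩
          Σ< (x + r) f + Σ< (x + r) g                                     ≡⟨ cong₂ _+_ (Σ<-split x r f) (Σ<-split x r g) ⟩
          (Σ< x f + Σ< r (f ∘ (x +_))) + (Σ< x g + Σ< r (g ∘ (x +_)))     ≡⟨ cong₂ (λ a b → (a + Σ< r (f ∘ (x +_))) + (Σ< x g + b)) (Σ<-zero x f-low) (Σ<-zero r g-high) ⟩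
          Σ< r (f ∘ (x +_)) + (Σ< x g + 0)                                ≡⟨ cong₂ _+_ (Σ<-cong r f-high) (trans (+-identityʳ _) (Σ<-cong x g-low)) ⟩
          Σ< r φ + Σ< x (φ ∘ (r +_))                                      ≡⟨ Σ<-split r x φ ⟨
          Σ< (r + x) φ                                                    ≡⟨ cong (λ z → Σ< z φ) (trans (+-comm r x) (sym n≡x+r)) ⟩
          weight (red x)                                                  ∎
          where
          open ≡-Reasoning
          r = n ∸ x
          n≡x+r : n ≡ x + r
          n≡x+r = sym (m+[n∸m]≡n (<⇒≤ x<n))
          f g φ : ℕ → ℕ
          f y = bit ((x <ᵇ y) ∧ H x y)
          g y = bit ((y <ᵇ x) ∧ H x (y + n))
          φ δ = bit (base (red x) (red x + δ))
          f-low : ∀ y → y < x → f y ≡ 0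
          f-low y y<x = cong (λ b → bit (b ∧ H x y)) (<ᵇ-no (<⇒≤ y<x))
          g-high : ∀ y → y < r → g (x + y) ≡ 0
          g-high y _ = cong (λ b → bit (b ∧ H x (x + y + n))) (<ᵇ-no (m≤m+n x y))
          f-high : ∀ δ → δ < r → f (x + δ) ≡ φ δ
          f-high zero    _ = trans (cong (λ b → bit (b ∧ H x (x + 0))) (<ᵇ-no (≤-reflexive (+-identityʳ x))))
            (sym (cong bit (trans (cong (base (red x)) (+-identityʳ (red x))) (base-diag (red x)))))
          f-high (suc δ) _ = trans (cong (λ b → bit (b ∧ H x (x + suc δ))) (<ᵇ-yes (m<m+n x (s≤s z≤n))))
            (cong (λ e → bit (base (red x) (red x + e))) (m+n∸m≡n x (suc δ)))
          g-low : ∀ y → y < x → g y ≡ φ (r + y)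
          g-low y y<x = trans (cong (λ b → bit (b ∧ H x (y + n))) (<ᵇ-yes y<x))
            (cong (λ e → bit (base (red x) (red x + e))) (trans (cong (_∸ x) (trans (cong (y +_) n≡x+r) (shape y x r))) (m+n∸m≡n x (r + y))))
            where
            shape : ∀ y x r → y + (x + r) ≡ x + (r + y)
            shape = solve-∀

        rows : Σ< n (λ x → weight (red x)) ≡ d * Σ< m (λ o → weight (v + o))
        rows = begin
          Σ< n (weight ∘ red)               ≡⟨ cong (λ z → Σ< z (weight ∘ red)) n≡ ⟩
          Σ< (d * m) (weight ∘ red)         ≡⟨ Σ<-repeat d m (weight ∘ red) (λ x → cong weight (trans (cong red (cong (_+ x) (sym (*-identityˡ m)))) (red-shift 1 x))) ⟩
          d * Σ< m (weight ∘ red)           ≡⟨ cong (d *_) one-period ⟩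
          d * Σ< m (λ o → weight (v + o))   ∎
          where
          open ≡-Reasoning
          s = m ∸ v
          m≡ : m ≡ v + s
          m≡ = sym (m+[n∸m]≡n (<⇒≤ v<m))
          red-low : ∀ x → x < v → red x ≡ v + (s + x)
          red-low x x<v = cong (v +_) (trans (m<n⇒m%n≡m (subst (x + s <_) (sym m≡) (+-monoˡ-< s x<v))) (+-comm x s))
          red-high : ∀ y → y < s → red (v + y) ≡ v + y
          red-high y y<s = red-block 0 y (<-≤-trans y<s (m∸n≤m m v))
          -- One period is rotated so that it starts at v instead of 0.
          one-period : Σ< m (weight ∘ red) ≡ Σ< m (λ o → weight (v + o))
          one-period = begin
            Σ< m (weight ∘ red)                                                       ≡⟨ cong (λ z → Σ< z (weight ∘ red)) m≡ ⟩
            Σ< (v + s) (weight ∘ red)                                                 ≡⟨ Σ<-split v s (weight ∘ red) ⟩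
            Σ< v (weight ∘ red) + Σ< s (λ y → weight (red (v + y)))                   ≡⟨ cong₂ _+_ (Σ<-cong v (λ x x<v → cong weight (red-low x x<v))) (Σ<-cong s (λ y y<s → cong weight (red-high y y<s))) ⟩
            Σ< v (λ x → weight (v + (s + x))) + Σ< s (λ y → weight (v + y))           ≡⟨ +-comm _ (Σ< s (λ y → weight (v + y))) ⟩
            Σ< s (λ y → weight (v + y)) + Σ< v (λ x → weight (v + (s + x)))           ≡⟨ Σ<-split s v (λ o → weight (v + o)) ⟨
            Σ< (s + v) (λ o → weight (v + o))                                         ≡⟨ cong (λ z → Σ< z (λ o → weight (v + o))) (trans (+-comm s v) (sym m≡)) ⟩
            Σ< m (λ o → weight (v + o))                                               ∎

        period-edges : Σ< m (λ o → weight (v + o)) ≡ m + marksC c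
        period-edges = trans (countC edges edges-∅ edges-∨ {v} {v + m} single c v ≤-refl (≤-reflexive (cong (v +_) sp))) (cong (_+ marksC c) sp)
          where
          open DoubleSum m n (λ o δ → v + o) (λ o δ → v + o + δ)
          single : ∀ a b → v ≤ a → a < b → b ≤ v + m → edges (edge a b) ≡ 1
          single a b v≤a a<b b≤ = edges-edge a b (a ∸ v) (b ∸ a)
            (+-cancelˡ-< v _ _ (subst (_< v + m) (sym (m+[n∸m]≡n v≤a)) (<-≤-trans a<b b≤)))
            (+-cancelˡ-< a _ _ (subst (_< a + n) (sym (m+[n∸m]≡n (<⇒≤ a<b))) (≤-<-trans b≤ (+-mono-≤-< v≤a m<n))))
            (m+[n∸m]≡n v≤a) (trans (cong (_+ (b ∸ a)) (m+[n∸m]≡n v≤a)) (m+[n∸m]≡n (<⇒≤ a<b)))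
            (λ { o δ _ _ refl refl → sym (m+n∸m≡n v o) , sym (m+n∸m≡n (v + o) δ) })

      -- Pairs whose two connecting ways around the circle are both edges of the line; the circle
      -- has only one edge for them. Only a diameter can be such a pair.
      bothWays : ℕ
      bothWays = Σ< n (λ x → Σ< n (λ y → bit ((x <ᵇ y) ∧ (H x y ∧ H y (x + n)))))

      -- Inclusion and exclusion for the two disjuncts of `circleGraph`; one turn comprises d
      -- periods of the line graph.
      edgeCountP : edgeCount A + bothWays ≡ d * (m + marksC c)
      edgeCountP = trans (cong (_+ bothWays) (edgeCount-mat N h))
        (trans (Σ<-pair-up n (λ x y → bit ((x <ᵇ y) ∧ h x y)) (λ x y → bit ((x <ᵇ y) ∧ (H x y ∧ H y (x + n)))) P Q (weight ∘ red)
                  (λ x y → incl-excl (x <ᵇ y) (H x y) (H y (x + n))) row)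
        (trans rows (cong (d *_) period-edges)))
        where
        P Q : ℕ → ℕ → ℕ
        P x y = bit ((x <ᵇ y) ∧ H x y)
        Q x y = bit ((x <ᵇ y) ∧ H y (x + n))
        incl-excl : ∀ a b c → bit (a ∧ (b ∨ c)) + bit (a ∧ (b ∧ c)) ≡ bit (a ∧ b) + bit (a ∧ c)
        incl-excl false b c = refl
        incl-excl true true c = refl
        incl-excl true false c = +-identityʳ (bit c)

      private
        both-diameter : ∀ x y → (x <ᵇ y) ∧ (H x y ∧ H y (x + n)) ≡ true → x < n → y < n →
          n ≡ m + m × x ≡ v × y ≡ v + m × decC c v v (v + m) ≡ true
        both-diameter x y e x<n y<n with ∧-true (x <ᵇ y) e
        ... | _ , e′ with ∧-true (H x y) e′
        ...   | p , q with diameter x y (H-short x y p) (H-short y (x + n) q)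
        ...     | n≡2m , y≡ = n≡2m , x≡v , trans y≡ (cong (_+ m) x≡v) ,
            trans (sym (H-base v (v + m) ≤-refl (m<m+n v (s≤s z≤n)) ≤-refl)) (trans (cong₂ H (sym x≡v) (trans (cong (_+ m) (sym x≡v)) (sym y≡))) p)
          where
          x<m : x < m
          x<m = +-cancelʳ-< m _ _ (subst₂ _<_ y≡ n≡2m y<n)
          -- A half turn starting elsewhere would pass over v or v + m, which no edge does.
          x≡v : x ≡ v
          x≡v with <-cmp x v
          ... | tri≈ _ x≡v _ = x≡v
          ... | tri< x<v _ _ = ⊥-elim (H-uncrossed 0 x y x<v (<-≤-trans v<m (subst (m ≤_) (sym y≡) (m≤n+m m x))) p)
          ... | tri> _ _ v<x = ⊥-elim (H-uncrossed 1 x y (<-≤-trans x<m (subst (_≤ 1 * m + v) (*-identityˡ m) (m≤m+n (1 * m) v)))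
                  (subst₂ _<_ (trans (+-comm v m) (cong (_+ v) (sym (*-identityˡ m)))) (sym y≡) (+-monoˡ-< m v<x)) p)

      bothWays-0 : (n ≡ m + m → decC c v v (v + m) ≡ false) → bothWays ≡ 0
      bothWays-0 none = Σ<-zero n (λ x x<n → Σ<-zero n (λ y y<n → cong bit (¬true⇒false (λ e →
        let (n≡2m , _ , _ , t) = both-diameter x y e x<n y<n in true≢false t (none n≡2m)))))

      bothWays-1 : n ≡ m + m → decC c v v (v + m) ≡ true → bothWays ≡ 1
      bothWays-1 n≡2m top = trans (Σ<-single n v v<n (λ x x<n x≢v → Σ<-zero n (λ y y<n → cong bit (¬true⇒false (λ e → x≢v (proj₁ (proj₂ (both-diameter x y e x<n y<n))))))))
        (trans (Σ<-single n (v + m) v+m<n (λ y y<n y≢ → cong bit (¬true⇒false (λ e → y≢ (proj₁ (proj₂ (proj₂ (both-diameter v y e v<n y<n))))))))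
          (cong bit (cong₂ _∧_ (<ᵇ-yes (m<m+n v (s≤s z≤n))) (cong₂ _∧_ H₁ H₂))))
        where
        v<n = <-trans v<m m<n
        v+m<n : v + m < n
        v+m<n = <-≤-trans (+-monoˡ-< m v<m) 2m≤n
        H₁ : H v (v + m) ≡ true
        H₁ = trans (H-base v (v + m) ≤-refl (m<m+n v (s≤s z≤n)) ≤-refl) top
        shape₁ : ∀ x m → x + m ≡ 1 * m + x
        shape₁ = solve-∀
        shape₂ : ∀ x m → x + (m + m) ≡ 1 * m + (x + m)
        shape₂ = solve-∀
        H₂ : H (v + m) (v + n) ≡ true
        H₂ = trans (cong₂ H (shape₁ v m) (trans (cong (v +_) n≡2m) (shape₂ v m))) (trans (H-shift 1 v (v + m)) H₁)

    -- The last arc of a stack passes over every position below its base point,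
    -- so the base point is the least position that no arc passes over.
    private
      base-least : ∀ c v v<m sp c′ f′ v′ v′<m sp′ → v′ < suc (excess f′) → decodeP c v ≡ decodeP (snoc c′ f′) v′ → v < v′ → ⊥
      base-least c v v<m sp c′ f′ v′ v′<m sp′ ok′ eq v<v′ = covered (Line.repP (snoc c′ f′) v′ v′<m sp′)
        where
        open Line c v v<m sp
        covered : RepC (lift N (decodeP (snoc c′ f′) v′)) (snoc c′ f′) v′ (v′ + m) → ⊥
        covered (snoc {v = w} p q e _) = go
          where
          v+m<top : 1 * m + v < v′ + m
          v+m<top = subst (_< v′ + m) (trans (+-comm v m) (cong (_+ v) (sym (*-identityˡ m)))) (+-monoˡ-< m v<v′)
          -- `ok′` says that the last arc, which ends at v′ + m, is longer than v′; so it starts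
          -- before m.
          w<m : w < m
          w<m = +-cancelʳ-< v′ _ _ (<-≤-trans (+-monoʳ-< w ok′) (≤-reflexive (trans (sym (repA-span q)) (+-comm v′ m))))
          top≤ : v′ + m ≤ w + m
          top≤ = +-monoˡ-≤ m (repC-≤ p)
          w<v+m : w < 1 * m + v
          w<v+m = <-≤-trans w<m (subst (_≤ 1 * m + v) (*-identityˡ m) (m≤m+n (1 * m) v))
          e′ : H w (v′ + m) ≡ true
          e′ = trans (sym (lift-short w (v′ + m) (<-trans w<v+m v+m<top) top≤)) (trans (cong (λ M → lift N M w (v′ + m)) eq) e)
          go : ⊥
          go = H-uncrossed 1 w (v′ + m) w<v+m v+m<top e′

    uniqueP : ∀ c f v v<m sp c′ f′ v′ v′<m sp′ → v < suc (excess f) → v′ < suc (excess f′) →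
      decodeP (snoc c f) v ≡ decodeP (snoc c′ f′) v′ → snoc c f ≡ snoc c′ f′ × v ≡ v′
    uniqueP c f v v<m sp c′ f′ v′ v′<m sp′ ok ok′ eq with <-cmp v v′
    ... | tri≈ _ refl _ = repC-unique (lift N (decodeP (snoc c f) v)) (Line.repP (snoc c f) v v<m sp)
            (subst (λ M → RepC (lift N M) (snoc c′ f′) v (v + m)) (sym eq) (Line.repP (snoc c′ f′) v v′<m sp′)) , refl
    ... | tri< v<v′ _ _ = ⊥-elim (base-least (snoc c f) v v<m sp c′ f′ v′ v′<m sp′ ok′ eq v<v′)
    ... | tri> _ _ v′<v = ⊥-elim (base-least (snoc c′ f′) v′ v′<m sp′ c f v v<m sp ok (sym eq) v′<v)

-- Every symmetric graph comes from a tree with a base point.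

module Symmetric where
  open import Defs
  open Trees
  open Interval
  open Matrix
  open Linear using (colouring-lift)
  open Periodic
  open import Data.Bool using (Bool; true; false; if_then_else_)
  import Data.Bool as Bool
  open import Data.Nat using (ℕ; zero; suc; _+_; _*_; _∸_; _≤_; _<_; z≤n; s≤s; _≤?_; _<?_; _≟_; _≡ᵇ_)
  open import Data.Nat.Properties
  open import Data.Nat.DivMod using (_mod_; _%_; _/_; m%n<n; m≡m%n+[m/n]*n; m<n⇒m%n≡m; [m+kn]%n≡m%n; [m+n]%n≡m%n; %-distribˡ-+; m%n%n≡m%n; +-distrib-/-∣ˡ; m*n/n≡m; m<n⇒m/n≡0)
  open import Data.Nat.Divisibility using (divides)
  open import Data.Nat.Tactic.RingSolver using (solve-∀)
  open import Data.Product using (∃; _×_; _,_)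
  open import Data.Sum using (_⊎_; inj₁; inj₂)
  open import Data.Empty using (⊥; ⊥-elim)
  open import Relation.Nullary using (¬_; Dec; yes; no; does)
  open import Relation.Nullary.Decidable using (_×-dec_)
  open import Relation.Binary.PropositionalEquality using (_≡_; refl; sym; trans; cong; cong₂; subst; subst₂; module ≡-Reasoning)

  module Classify (μ d′ N : ℕ) (n≡ : suc N ≡ (2 + d′) * suc μ) (A : Adj (suc N))
                  (simple : Simple A) (nc : NonCrossing A) (con : Connected A) (fixed : FixedBy (suc μ) A) where
    open Period μ d′ N n≡

    private
      g : Graph
      g = lift N A

      g-comm : ∀ x y → g x y ≡ g y x
      g-comm = lift-comm N {A} simple

      mod-n : ∀ x k → (x + k * n) mod n ≡ x mod n
      mod-n x k = mod-cong N {x + k * n} {x} ([m+kn]%n≡m%n x k n)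

      g-shift-n : ∀ k x y → g (x + k * n) (y + k * n) ≡ g x y
      g-shift-n k x y = cong₂ (entry A) (mod-n x k) (mod-n y k)

      mod+n : ∀ x → (x + n) mod n ≡ x mod n
      mod+n x = mod-cong N {x + n} {x} ([m+n]%n≡m%n x n)

      g-periodˡ : ∀ x y → g (x + n) y ≡ g x y
      g-periodˡ x y = cong (λ z → entry A z (y mod n)) (mod+n x)

      g-periodʳ : ∀ x y → g x (y + n) ≡ g x y
      g-periodʳ x y = cong (entry A (x mod n)) (mod+n y)

      rot-mod : ∀ x → (x + m) mod n ≡ rot m (x mod n)
      rot-mod x = mod-cong N {x + m} {Data.Fin.toℕ (x mod n) + m} (begin
        (x + m) % n                              ≡⟨ %-distribˡ-+ x m n ⟩
        (x % n + m % n) % n                      ≡⟨ cong (λ z → (z + m % n) % n) (m%n%n≡m%n x n) ⟨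
        (x % n % n + m % n) % n                  ≡⟨ %-distribˡ-+ (x % n) m n ⟨
        (x % n + m) % n                          ≡⟨ cong (λ z → (z + m) % n) (toℕ-mod N x) ⟨
        (Data.Fin.toℕ (x mod n) + m) % n         ∎)
        where
        open ≡-Reasoning
        import Data.Fin

      g-step : ∀ x y → g (x + m) (y + m) ≡ g x y
      g-step x y = trans (cong₂ (entry A) (rot-mod x) (rot-mod y)) (fixed (x mod n) (y mod n))

      g-shift : ∀ k x y → g (k * m + x) (k * m + y) ≡ g x y
      g-shift zero    x y = refl
      g-shift (suc k) x y = trans (cong₂ g (shape m (k * m) x) (shape m (k * m) y)) (trans (g-step (k * m + x) (k * m + y)) (g-shift k x y))
        where
        shape : ∀ a b c → a + b + c ≡ b + c + a
        shape = solve-∀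

      nc₀ : NC g 0 N
      nc₀ = noncrossing-lift N {A} nc

      -- Non-crossing for four points within one turn. With x moved into [0 , n), the points from n
      -- on wrap to the front, and each of the four resulting orders is an instance of the linear
      -- condition.
      cyclic-NC : ∀ x z y w → x < z → z < y → y < w → w < x + n → g x y ≡ true → g z w ≡ true → ⊥
      cyclic-NC x z y w x<z z<y y<w w<x+n xy zw =
        reduced (x % n) (z ∸ k * n) (y ∸ k * n) (w ∸ k * n) (m%n<n x n)
          (lt x≡ z≡ x<z) (lt z≡ y≡ z<y) (lt y≡ w≡ y<w) (lt w≡ (trans (cong (_+ n) x≡) (swap (x % n) (k * n) n)) w<x+n)
          (trans (sym (g-shift-n k (x % n) (y ∸ k * n))) (trans (cong₂ g (sym x≡) (sym y≡)) xy))
          (trans (sym (g-shift-n k (z ∸ k * n) (w ∸ k * n))) (trans (cong₂ g (sym z≡) (sym w≡)) zw))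
        where
        k = x / n
        x≡ : x ≡ x % n + k * n
        x≡ = m≡m%n+[m/n]*n x n
        swap : ∀ a b c → a + b + c ≡ a + c + b
        swap = solve-∀
        above : ∀ {a} → x ≤ a → a ≡ (a ∸ k * n) + k * n
        above x≤a = sym (m∸n+n≡m (≤-trans (m≤n+m (k * n) (x % n)) (≤-trans (≤-reflexive (sym x≡)) x≤a)))
        z≡ = above (<⇒≤ x<z)
        y≡ = above (<⇒≤ (<-trans x<z z<y))
        w≡ = above (<⇒≤ (<-trans x<z (<-trans z<y y<w)))
        lt : ∀ {a b a′ b′} → a ≡ a′ + k * n → b ≡ b′ + k * n → a < b → a′ < b′
        lt p q a<b = +-cancelʳ-< (k * n) _ _ (subst₂ _<_ p q a<b)
        down : ∀ {a x} → ¬ (a < n) → a < x + n → a ∸ n < x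
        down {a} {x} a≮n a< = +-cancelʳ-< n _ _ (subst (_< x + n) (sym (m∸n+n≡m (≮⇒≥ a≮n))) a<)
        dropʳ : ∀ a {b} → ¬ (b < n) → g a (b ∸ n) ≡ g a b
        dropʳ a {b} b≮n = trans (sym (g-periodʳ a (b ∸ n))) (cong (g a) (m∸n+n≡m (≮⇒≥ b≮n)))
        reduced : ∀ x z y w → x < n → x < z → z < y → y < w → w < x + n → g x y ≡ true → g z w ≡ true → ⊥
        reduced x z y w x<n x<z z<y y<w w<x+n xy zw with w <? n | y <? n | z <? n
        ... | yes w<n | _ | _ = nc₀ x z y w z≤n x<z z<y y<w (≤-pred w<n) xy zw
        ... | no w≮n | yes y<n | _ = nc₀ (w ∸ n) x z y z≤n (down w≮n w<x+n) x<z z<y (≤-pred y<n) (trans (g-comm (w ∸ n) z) (trans (dropʳ z w≮n) zw)) xy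
        ... | no w≮n | no y≮n | yes z<n = nc₀ (y ∸ n) (w ∸ n) x z z≤n (∸-monoˡ-< y<w (≮⇒≥ y≮n)) (down w≮n w<x+n) x<z (≤-pred z<n)
            (trans (g-comm (y ∸ n) x) (trans (dropʳ x y≮n) xy)) (trans (g-comm (w ∸ n) z) (trans (dropʳ z w≮n) zw))
        ... | no w≮n | no y≮n | no z≮n = nc₀ (z ∸ n) (y ∸ n) (w ∸ n) x z≤n (∸-monoˡ-< z<y (≮⇒≥ z≮n)) (∸-monoˡ-< y<w (≮⇒≥ y≮n)) (down w≮n w<x+n) (≤-pred x<n)
            (trans (dropʳ (z ∸ n) w≮n) (trans (trans (g-comm (z ∸ n) w) (dropʳ w z≮n)) (trans (g-comm w z) zw))) (trans (g-comm (y ∸ n) x) (trans (dropʳ x y≮n) xy))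

      -- A longer edge would cross its own rotation by m.
      short : ∀ x y → x < y → y < x + n → g x y ≡ true → y ≤ x + m ⊎ x + n ≤ y + m
      short x y x<y y<x+n e with y ≤? x + m | x + n ≤? y + m
      ... | yes p | _     = inj₁ p
      ... | _     | yes p = inj₂ p
      ... | no  p | no  q = ⊥-elim (cyclic-NC x (x + m) y (y + m) (m<m+n x (s≤s z≤n)) (≰⇒> p) (m<m+n y (s≤s z≤n)) (≰⇒> q) e (trans (g-step x y) e))

      -- Two crossing edges of length at most m fit into one turn, so the cyclic condition applies.
      line-NC : ∀ x z y w → x < z → z < y → y < w → y ≤ x + m → w ≤ z + m → g x y ≡ true → g z w ≡ true → ⊥
      line-NC x z y w x<z z<y y<w y≤ w≤ = cyclic-NC x z y w x<z z<y y<w (begin-strict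
        w              ≤⟨ w≤ ⟩
        z + m          <⟨ +-monoˡ-< m z<y ⟩
        y + m          ≤⟨ +-monoˡ-≤ m y≤ ⟩
        x + m + m      ≡⟨ +-assoc x m m ⟩
        x + (m + m)    ≤⟨ +-monoʳ-≤ x 2m≤n ⟩
        x + n          ∎)
        where open ≤-Reasoning

      -- An edge longer than m is a short one when seen from its other end, so an n-periodic
      -- colouring has to be checked on short edges only.
      short-colouring : (χ : ℕ → ℕ) → (∀ x → χ (x + n) ≡ χ x) → (∀ x y → x < y → y ≤ x + m → g x y ≡ true → χ x ≡ χ y) →
        ∀ x y → x < n → y < n → χ x ≡ χ y
      short-colouring χ per cl = colouring-lift N {A} simple con χ closed
        where
        closed : ∀ x y → x < y → y < n → g x y ≡ true → χ x ≡ χ y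
        closed x y x<y y<n e with short x y x<y (<-≤-trans y<n (m≤n+m n x)) e
        ... | inj₁ p = cl x y x<y p e
        ... | inj₂ p = sym (trans (cl y (x + n) (<-≤-trans y<n (m≤n+m n x)) p (trans (g-periodʳ y x) (trans (g-comm y x) e))) (per x))

      -- By periodicity a start below m suffices, which makes this decidable by finite search.
      HasSpan : ℕ → Set
      HasSpan s = ∃ λ x → x < m × g x (x + s) ≡ true

      hasSpan? : ∀ s → Dec (HasSpan s)
      hasSpan? s = anyUpTo? (λ x → g x (x + s) Bool.≟ true) m

      hasSpan : ∀ x y → x < y → g x y ≡ true → HasSpan (y ∸ x)
      hasSpan x y x<y e with block 0 x z≤n
      ... | i , o , o<m , eq = o , o<m , trans (sym (g-shift i o (o + (y ∸ x)))) (trans (cong₂ g (sym eq) eq′) e)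
        where
        eq′ : i * m + (o + (y ∸ x)) ≡ y
        eq′ = trans (sym (+-assoc (i * m) o _)) (trans (cong (_+ (y ∸ x)) (sym eq)) (m+[n∸m]≡n (<⇒≤ x<y)))

      maxSpan : ∀ s → (∃ λ s′ → 0 < s′ × s′ ≤ s × HasSpan s′ × (∀ s″ → s′ < s″ → s″ ≤ s → ¬ HasSpan s″)) ⊎ (∀ s′ → 0 < s′ → s′ ≤ s → ¬ HasSpan s′)
      maxSpan zero = inj₂ (λ s′ 0<s′ s′≤0 _ → <⇒≱ 0<s′ s′≤0)
      maxSpan (suc s) with hasSpan? (suc s)
      ... | yes h = inj₁ (suc s , s≤s z≤n , ≤-refl , h , λ s″ p q _ → <⇒≱ p q)
      ... | no ¬h with maxSpan s
      ...   | inj₂ none = inj₂ (λ s′ 0<s′ s′≤ → extend s′ (m≤n⇒m<n∨m≡n s′≤) 0<s′)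
        where
        extend : ∀ s′ → s′ < suc s ⊎ s′ ≡ suc s → 0 < s′ → ¬ HasSpan s′
        extend s′ (inj₁ p) 0<s′ = none s′ 0<s′ (≤-pred p)
        extend s′ (inj₂ refl) _ = ¬h
      ...   | inj₁ (s′ , 0<s′ , s′≤s , h , above) = inj₁ (s′ , 0<s′ , m≤n⇒m≤1+n s′≤s , h , λ s″ p q → extend s″ p (m≤n⇒m<n∨m≡n q))
        where
        extend : ∀ s″ → s′ < s″ → s″ < suc s ⊎ s″ ≡ suc s → ¬ HasSpan s″
        extend s″ p (inj₁ q) = above s″ p (≤-pred q)
        extend s″ p (inj₂ refl) = ¬h

      -- Without short edges the residue modulo n would be an admissible colouring, yet it separates
      -- 0 from 1.
      some-edge : (∀ s → 0 < s → s ≤ m → ¬ HasSpan s) → ⊥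
      some-edge none = 0≢1 (trans (short-colouring (_% n) (λ x → [m+n]%n≡m%n x n)
          (λ x y x<y y≤ e → ⊥-elim (none (y ∸ x) (m<n⇒0<n∸m x<y) (m≤n+o⇒m∸n≤o y x y≤) (hasSpan x y x<y e))) 0 1 (s≤s z≤n) 1<n) (m<n⇒m%n≡m 1<n))
        where
        1<n : 1 < n
        1<n = ≤-<-trans (s≤s z≤n) m<n
        0≢1 : 0 ≡ 1 → ⊥
        0≢1 ()

    -- By periodicity it does not matter which v + k m is looked at.
    Uncovered : ℕ → Set
    Uncovered v = ∀ x y → x < v + m → v + m < y → y ≤ x + m → g x y ≡ true → ⊥

    private
      uncovered? : ∀ v → Dec (Uncovered v)
      uncovered? v with anyUpTo? (λ x → anyUpTo? (λ y → (v + m <? y) ×-dec (g x y Bool.≟ true)) (suc (x + m))) (v + m)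
      ... | yes (x , x< , y , y< , v<y , e) = no (λ u → u x y x< v<y (≤-pred y<) e)
      ... | no  none = yes (λ x y x< v<y y≤ e → none (x , x< , y , s≤s y≤ , v<y , e))

      -- The left end of a longest short edge: a short edge passing over it would either cross that
      -- edge or be longer.
      longest-uncovered : ∃ λ v → v < m × Uncovered v
      longest-uncovered with maxSpan m
      ... | inj₂ none = ⊥-elim (some-edge none)
      ... | inj₁ (s , 0<s , s≤m , (v , v<m , e) , above) = v , v<m , unc
        where
        unc : Uncovered v
        unc x y x<p p<y y≤ xy with y <? v + m + s
        ... | yes y< = line-NC x (v + m) y (v + m + s) x<p p<y y< y≤ (+-monoʳ-≤ (v + m) s≤m) xy
                         (trans (cong (g (v + m)) (shape v m s)) (trans (g-step v (v + s)) e))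
          where
          shape : ∀ a b c → a + b + c ≡ a + c + b
          shape = solve-∀
        ... | no y≮ = above (y ∸ x) (+-cancelˡ-< x _ _ (<-≤-trans (+-monoˡ-< s x<p) (≤-trans (≮⇒≥ y≮) (≤-reflexive (sym (m+[n∸m]≡n (<⇒≤ (<-trans x<p p<y))))))))
                        (m≤n+o⇒m∸n≤o y x y≤) (hasSpan x y (<-trans x<p p<y) xy)

      -- Minimality makes the base point canonical and will force the last arc to be longer than v.
      least-uncovered : ∃ λ v → v < m × Uncovered v × (∀ w → w < v → ¬ Uncovered w)
      least-uncovered with longest-uncovered
      ... | v₀ , v₀<m , u₀ with leastTrue (λ v → does (uncovered? v)) 0 (suc v₀)
      ...   | inj₁ none = ⊥-elim (sound (none v₀ z≤n ≤-refl) u₀)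
        where
        sound : ∀ {w} → does (uncovered? w) ≡ false → ¬ Uncovered w
        sound {w} p u with uncovered? w
        ... | no ¬u = ¬u u
      ...   | inj₂ (v , _ , v≤v₀ , t , below) = v , ≤-<-trans (≤-pred v≤v₀) v₀<m , yes-sound t , (λ w w<v → sound (below w z≤n w<v))
        where
        sound : ∀ {w} → does (uncovered? w) ≡ false → ¬ Uncovered w
        sound {w} p u with uncovered? w
        ... | no ¬u = ¬u u
        yes-sound : ∀ {w} → does (uncovered? w) ≡ true → Uncovered w
        yes-sound {w} p with uncovered? w
        ... | yes u = u

    module _ (v : ℕ) (v<m : v < m) (unc : Uncovered v) where
      -- Λ i o is the colour of offset o in the i-th translate of [v , v + m].
      block-constant : (Λ : ℕ → ℕ → ℕ) → (∀ i → Λ i m ≡ Λ (suc i) 0) → (∀ i o → Λ (i + d) o ≡ Λ i o) →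
        (∀ i o o′ → o < o′ → o′ ≤ m → g (v + o) (v + o′) ≡ true → Λ i o ≡ Λ i o′) → ∀ o → o ≤ m → Λ 0 o ≡ Λ 0 0
      block-constant Λ glue per cl o o≤m = trans (sym (per 0 o)) (trans (sym (col-at o o≤m)) (trans same (trans (col-at 0 z≤n) (per 0 0))))
        where
        -- Division of x + s by m finds the translate and the offset of x without subtracting v. The
        -- vertices v + o land in translate d, which is coloured like translate 0.
        s = n ∸ v
        v≤n = <⇒≤ (<-trans v<m m<n)
        col : ℕ → ℕ
        col x = Λ ((x + s) / m) ((x + s) % m)
        div-block : ∀ i o → o < m → (i * m + o) / m ≡ i
        div-block i o o<m = trans (+-distrib-/-∣ˡ o (divides i refl)) (trans (cong₂ _+_ (m*n/n≡m i m) (m<n⇒m/n≡0 o<m)) (+-identityʳ i))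
        mod-block : ∀ i o → o < m → (i * m + o) % m ≡ o
        mod-block i o o<m = trans (cong (_% m) (+-comm (i * m) o)) (trans ([m+kn]%n≡m%n o i m) (m<n⇒m%n≡m o<m))
        col-block : ∀ x i o → x + s ≡ i * m + o → o ≤ m → col x ≡ Λ i o
        col-block x i o eq o≤m with m≤n⇒m<n∨m≡n o≤m
        ... | inj₁ o<m = cong₂ Λ (trans (cong (_/ m) eq) (div-block i o o<m)) (trans (cong (_% m) eq) (mod-block i o o<m))
        ... | inj₂ refl = trans (cong₂ Λ (trans (cong (_/ m) eq′) (div-block (suc i) 0 (s≤s z≤n))) (trans (cong (_% m) eq′) (mod-block (suc i) 0 (s≤s z≤n)))) (sym (glue i))
          where
          shape : ∀ a b → a + b ≡ b + a + 0
          shape = solve-∀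
          eq′ : x + s ≡ suc i * m + 0
          eq′ = trans eq (shape (i * m) m)
        col-at : ∀ o → o ≤ m → col (v + o) ≡ Λ d o
        col-at o o≤m = col-block (v + o) d o (trans (shape v o s) (cong (_+ o) (trans (m+[n∸m]≡n v≤n) n≡))) o≤m
          where
          shape : ∀ a b c → a + b + c ≡ a + c + b
          shape = solve-∀
        col-per : ∀ x → col (x + n) ≡ col x
        col-per x = trans (col-block (x + n) ((x + s) / m + d) ((x + s) % m) eq (<⇒≤ (m%n<n (x + s) m))) (per _ _)
          where
          shape₁ : ∀ a b c → a + b + c ≡ a + c + b
          shape₁ = solve-∀
          shape₂ : ∀ r k d m → r + k * m + d * m ≡ (k + d) * m + r
          shape₂ = solve-∀
          eq : x + n + s ≡ ((x + s) / m + d) * m + (x + s) % m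
          eq = trans (shape₁ x n s) (trans (cong₂ _+_ (m≡m%n+[m/n]*n (x + s) m) n≡) (shape₂ ((x + s) % m) ((x + s) / m) d m))
        col-short : ∀ x y → x < y → y ≤ x + m → g x y ≡ true → col x ≡ col y
        col-short x y x<y y≤ e = go (o′ ≤? m)
          where
          i = (x + s) / m
          o₀ = (x + s) % m
          o₀<m : o₀ < m
          o₀<m = m%n<n (x + s) m
          o′ = o₀ + (y ∸ x)
          x≡ : x + s ≡ i * m + o₀
          x≡ = trans (m≡m%n+[m/n]*n (x + s) m) (+-comm o₀ (i * m))
          y≡ : y + s ≡ i * m + o′
          y≡ = trans (cong (_+ s) (sym (m+[n∸m]≡n (<⇒≤ x<y)))) (trans (shape x (y ∸ x) s) (trans (cong (_+ (y ∸ x)) x≡) (+-assoc (i * m) o₀ _)))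
            where
            shape : ∀ a b c → a + b + c ≡ a + c + b
            shape = solve-∀
          lift≡ : ∀ z p → z + s ≡ i * m + p → z + n ≡ i * m + (v + p)
          lift≡ z p eq = trans (cong (z +_) (trans (sym (m+[n∸m]≡n v≤n)) (+-comm v s))) (trans (sym (+-assoc z s v)) (trans (cong (_+ v) eq) (shape (i * m) p v)))
            where
            shape : ∀ a b c → a + b + c ≡ a + (c + b)
            shape = solve-∀
          e′ : g (v + o₀) (v + o′) ≡ true
          e′ = trans (sym (g-shift i (v + o₀) (v + o′))) (trans (cong₂ g (sym (lift≡ x o₀ x≡)) (sym (lift≡ y o′ y≡))) (trans (g-periodˡ x (y + n)) (trans (g-periodʳ x y) e)))
          go : Dec (o′ ≤ m) → col x ≡ col y
          go (yes o′≤m) = trans (col-block x i o₀ x≡ (<⇒≤ o₀<m)) (trans (cl i o₀ o′ (m<m+n o₀ (m<n⇒0<n∸m x<y)) o′≤m e′) (sym (col-block y i o′ y≡ o′≤m)))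
          -- An edge leaving its translate would pass over an uncovered point.
          go (no o′≰m) = ⊥-elim (unc (v + o₀) (v + o′) (+-monoʳ-< v o₀<m) (+-monoʳ-< v (≰⇒> o′≰m))
            (≤-trans (+-monoʳ-≤ v (+-monoʳ-≤ o₀ (m≤n+o⇒m∸n≤o y x y≤))) (≤-reflexive (sym (+-assoc v o₀ m)))) e′)
        same : col (v + o) ≡ col (v + 0)
        same = short-colouring col col-per col-short (v + o) (v + 0) (≤-<-trans (+-monoʳ-≤ v o≤m) (<-≤-trans (+-monoˡ-< m v<m) 2m≤n))
          (≤-<-trans (≤-reflexive (+-identityʳ v)) (<-trans v<m m<n))

      -- If the ends of [v , v + m] got different colours, giving the two colour
      -- classes of the i-th translate the labels i and i + 1 (mod d) would
      -- disconnect the graph.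
      conn : Conn g v (v + m)
      conn χ cl = constant
        where
        closed : ∀ o o′ → o < o′ → o′ ≤ m → g (v + o) (v + o′) ≡ true → χ (v + o) ≡ χ (v + o′)
        closed o o′ o<o′ o′≤m e = cl (v + o) (v + o′) (m≤m+n v o) (+-monoʳ-< v o<o′) (+-monoʳ-≤ v o′≤m) e
        χ0 : χ (v + 0) ≡ χ v
        χ0 = cong χ (+-identityʳ v)
        ends : χ (v + m) ≡ χ v
        ends with χ (v + m) ≟ χ v
        ... | yes p = p
        ... | no  ¬p = ⊥-elim (1≢0 (trans (sym Λ0m) (trans (block-constant Λ glue per Λ-closed m ≤-refl) Λ00)))
          where
          1≢0 : 1 ≡ 0 → ⊥
          1≢0 ()
          Λ : ℕ → ℕ → ℕ
          Λ i o = (if χ (v + o) ≡ᵇ χ v then i else suc i) % d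
          at-0 : ∀ i → Λ i 0 ≡ i % d
          at-0 i = cong (λ b → (if b then i else suc i) % d) (trans (cong (_≡ᵇ χ v) χ0) (≡ᵇ-refl (χ v)))
          at-m : ∀ i → Λ i m ≡ suc i % d
          at-m i = cong (λ b → (if b then i else suc i) % d) (¬true⇒false (λ e → ¬p (≡ᵇ-true _ _ e)))
          glue : ∀ i → Λ i m ≡ Λ (suc i) 0
          glue i = trans (at-m i) (sym (at-0 (suc i)))
          per : ∀ i o → Λ (i + d) o ≡ Λ i o
          per i o with χ (v + o) ≡ᵇ χ v
          ... | true  = [m+n]%n≡m%n i d
          ... | false = [m+n]%n≡m%n (suc i) d
          Λ-closed : ∀ i o o′ → o < o′ → o′ ≤ m → g (v + o) (v + o′) ≡ true → Λ i o ≡ Λ i o′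
          Λ-closed i o o′ p q e = cong (λ c → (if c ≡ᵇ χ v then i else suc i) % d) (closed o o′ p q e)
          Λ0m : Λ 0 m ≡ 1
          Λ0m = at-m 0
          Λ00 : Λ 0 0 ≡ 0
          Λ00 = at-0 0
        constant : Constant v (v + m) χ
        constant x v≤x x≤ = trans (cong χ (sym (m+[n∸m]≡n v≤x))) (trans
          (block-constant (λ _ o → χ (v + o)) (λ _ → trans ends (sym χ0)) (λ _ _ → refl) (λ _ → closed) (x ∸ v) (m≤n+o⇒m∸n≤o x v x≤)) χ0)

    private
      ncᵥ : ∀ v → NC g v (v + m)
      ncᵥ v a c b e v≤a a<c c<b b<e e≤ = line-NC a c b e a<c c<b b<e (≤-trans (<⇒≤ b<e) (≤-trans e≤ (+-monoˡ-≤ m v≤a)))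
        (≤-trans e≤ (+-monoˡ-≤ m (≤-trans v≤a (<⇒≤ a<c))))

      module Agreement (c : Con) (v : ℕ) (v<m : v < m) (unc : Uncovered v) (repg : RepC g c v (v + m)) where
        sp : span c ≡ m
        sp = +-cancelˡ-≡ v _ _ (sym (repC-span repg))
        open Line c v v<m sp

        -- Inside a translate both graphs are read off the same tree. Neither has a short edge
        -- leaving the translate: for g by `unc`, for the line graph by `H-end`.
        g-H : ∀ x y → x < y → y ≤ x + m → g x y ≡ H x y
        g-H x y x<y y≤ with block v (1 * m + x) (v≤m+ x)
        ... | i , o , o<m , eq = trans (sym (g-shift 1 x y)) (trans (cong₂ g eq eqy) (trans main (trans (cong₂ H (sym eq) (sym eqy)) (H-shift 1 x y))))
          where
          o′ = o + (y ∸ x)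
          eqy : 1 * m + y ≡ i * m + (v + o′)
          eqy = trans (cong (1 * m +_) (sym (m+[n∸m]≡n (<⇒≤ x<y)))) (trans (sym (+-assoc (1 * m) x _)) (trans (cong (_+ (y ∸ x)) eq) (shape (i * m) v o (y ∸ x))))
            where
            shape : ∀ a b c d → a + (b + c) + d ≡ a + (b + (c + d))
            shape = solve-∀
          o<o′ : o < o′
          o<o′ = m<m+n o (m<n⇒0<n∸m x<y)
          main : g (i * m + (v + o)) (i * m + (v + o′)) ≡ H (i * m + (v + o)) (i * m + (v + o′))
          main with o′ ≤? m
          ... | yes o′≤m = trans (g-shift i (v + o) (v + o′)) (trans (repC-agree repg rep (v + o) (v + o′) (m≤m+n v o) (+-monoʳ-< v o<o′) (+-monoʳ-≤ v o′≤m))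
                             (sym (H-block i o o′ o<m (<⇒≤ o<o′))))
          ... | no o′≰m = trans (¬true⇒false (λ e → unc (v + o) (v + o′) (+-monoʳ-< v o<m) (+-monoʳ-< v (≰⇒> o′≰m))
                              (≤-trans (+-monoʳ-≤ v (+-monoʳ-≤ o (m≤n+o⇒m∸n≤o y x y≤))) (≤-reflexive (sym (+-assoc v o m)))) (trans (sym (g-shift i (v + o) (v + o′))) e)))
                            (sym (¬true⇒false (λ e → <⇒≱ (+-monoʳ-< (i * m) (+-monoʳ-< v (≰⇒> o′≰m))) (H-end i o _ o<m e))))

        A≡decP : A ≡ decP
        A≡decP = mat-lift N {A} simple h (λ x y x<y y<n → bool-ext (to x y x<y y<n) (from x y x<y y<n))
          where
          to : ∀ x y → x < y → y < n → g x y ≡ true → h x y ≡ true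
          to x y x<y y<n e with short x y x<y (<-≤-trans y<n (m≤n+m n x)) e
          ... | inj₁ p = ∨-introˡ (H y (x + n)) (trans (sym (g-H x y x<y p)) e)
          ... | inj₂ p = ∨-introʳ (H x y) (trans (sym (g-H y (x + n) (<-≤-trans y<n (m≤n+m n x)) p)) (trans (g-periodʳ y x) (trans (g-comm y x) e)))
          from : ∀ x y → x < y → y < n → h x y ≡ true → g x y ≡ true
          from x y x<y y<n e with ∨-true (H x y) e
          ... | inj₁ p = trans (g-H x y x<y (H-short x y p)) p
          ... | inj₂ p = trans (sym (trans (g-periodʳ y x) (g-comm y x))) (trans (g-H y (x + n) (<-≤-trans y<n (m≤n+m n x)) (H-short y (x + n) p)) p)

    encodeP : ∃ λ c → ∃ λ f → ∃ λ v → span (snoc c f) ≡ m × v < suc (excess f) × A ≡ decodeP (snoc c f) v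
    encodeP with least-uncovered
    ... | v , v<m , unc , least with existsC g m v (v + m) (m≤m+n v m) ≤-refl (ncᵥ v) (conn v v<m unc)
    ...   | nil , repg with +-cancelˡ-≡ v m 0 (repC-span repg)
    ...     | ()
    encodeP | v , v<m , unc , least | snoc c f , repg@(snoc {v = w} p q e cut) =
        c , f , v , sp , +-cancelˡ-< w _ _ (<-≤-trans (+-monoˡ-< v w<m) (≤-trans (≤-reflexive (+-comm m v)) (≤-reflexive (repA-span q)))) , A≡decP
      where
      open Agreement (snoc c f) v v<m unc repg
      -- As the last arc ends at v + m, this says that it is longer than v. Otherwise w - m would be
      -- an uncovered point below the least one.
      w<m : w < m
      w<m with w <? m
      ... | yes p = p
      ... | no w≮m = ⊥-elim (least (w ∸ m) (+-cancelʳ-< m _ _ (subst (_< v + m) (sym w≡) (repA-< q))) unc-w)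
        where
        w≡ : (w ∸ m) + m ≡ w
        w≡ = m∸n+n≡m (≮⇒≥ w≮m)
        -- An edge over w passes over v + m, or lies in [v , v + m] against the cut condition, or
        -- starts before v and passes over v + m once rotated.
        unc-w : Uncovered (w ∸ m)
        unc-w x y x<w w<y y≤ xy with y ≤? v + m | v ≤? x
        ... | no  y≰ | _ = unc x y (<-trans (subst (x <_) w≡ x<w) (repA-< q)) (≰⇒> y≰) y≤ xy
        ... | yes y≤v+m | yes v≤x = true≢false xy (cut v≤x (subst (x <_) w≡ x<w) (subst (_< y) w≡ w<y) y≤v+m)
        ... | yes _ | no v≰x = unc (x + m) (y + m) (+-monoˡ-< m (≰⇒> v≰x)) (+-monoˡ-< m (<-trans (<-≤-trans v<m (≮⇒≥ w≮m)) (subst (_< y) w≡ w<y)))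
            (+-monoˡ-≤ m y≤) (trans (g-step x y) xy)

-- Enumerating the symmetric graphs by pointed trees.

open import Defs
open import Level using (Level)
open import Data.Bool using (true; false)
open import Data.Nat using (ℕ; zero; suc; _+_; _*_; _≤_; _<_; z≤n; s≤s; _≤?_)
open import Data.Nat.Properties
open import Data.Nat.DivMod using (_/_; _%_; m≡m%n+[m/n]*n; m%n<n; [m+n]%n≡m%n; [m+kn]%n≡m%n; m*n%n≡0; m<n⇒m%n≡m)
open import Data.Nat.Divisibility using (_∣_; divides; quotient)
open import Data.Nat.Tactic.RingSolver using (solve-∀)
import Data.Fin as Fin
open import Data.Fin using (Fin; toℕ)
open import Data.List using (List; []; _∷_; map; length; _++_; upTo)
open import Data.List.Properties using (length-map; length-++; length-upTo)
open import Data.List.Membership.Propositional using (_∈_)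
open import Data.List.Membership.Propositional.Properties using (∈-map⁺; ∈-map⁻; ∈-++⁺ˡ; ∈-++⁺ʳ; ∈-++⁻; ∈-upTo⁺; ∈-upTo⁻)
open import Data.List.Relation.Unary.Any using (here; there)
import Data.List.Relation.Unary.All as All
open import Data.List.Relation.Unary.AllPairs using ([]; _∷_)
open import Data.List.Relation.Unary.Unique.Propositional using (Unique)
import Data.List.Relation.Unary.Unique.Propositional.Properties as Unique
open import Data.Vec using ([]; _∷_)
open import Data.Product using (Σ; ∃; _×_; _,_; proj₁; proj₂)
open import Data.Sum using (inj₁; inj₂)
open import Data.Empty using (⊥; ⊥-elim)
open import Function.Bundles using (_⇔_; mk⇔; Equivalence)
open import Relation.Nullary using (yes; no)
open import Relation.Binary.PropositionalEquality using (_≡_; _≢_; refl; sym; trans; cong; cong₂; subst; module ≡-Reasoning)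
open import Algebra.Bundles using (CommutativeRing)
open Gauss using (binom; module GaussianBinomials)
open PolyRing
open Roots
open Trees
open Count
open Interval
open Matrix
open Linear
open Periodic
open Symmetric

-- v tells where the origin lies under the last arc. It takes as many values as that arc has units
-- of span, so the list of pointed trees has the sum of spans as its length.
points : Con → Arc → List (Con × ℕ)
points c f = map (λ v → snoc c f , v) (upTo (suc (excess f)))

pointed : ∀ {S : Set} → (S → Con) → (S → Arc) → List S → List (Con × ℕ)
pointed c f []       = []
pointed c f (s ∷ ss) = points (c s) (f s) ++ pointed c f ss

module _ {S : Set} (c : S → Con) (f : S → Arc) where
  pointed-length : ∀ ss → length (pointed c f ss) ≡ ∑ (λ s → suc (excess (f s))) ss
  pointed-length []       = refl
  pointed-length (s ∷ ss) = trans (length-++ (points (c s) (f s))) (cong₂ _+_ (trans (length-map _ (upTo (suc (excess (f s))))) (length-upTo (suc (excess (f s))))) (pointed-length ss))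

  points⁻ : ∀ {s p} → p ∈ points (c s) (f s) → ∃ λ v → v < suc (excess (f s)) × p ≡ (snoc (c s) (f s) , v)
  points⁻ {s} p∈ with ∈-map⁻ (λ v → snoc (c s) (f s) , v) p∈
  ... | v , v∈ , eq = v , ∈-upTo⁻ v∈ , eq

  pointed⁻ : ∀ ss {p} → p ∈ pointed c f ss → ∃ λ s → ∃ λ v → s ∈ ss × v < suc (excess (f s)) × p ≡ (snoc (c s) (f s) , v)
  pointed⁻ (s ∷ ss) p∈ with ∈-++⁻ (points (c s) (f s)) p∈
  ... | inj₁ q = let (v , v< , eq) = points⁻ {s} q in s , v , here refl , v< , eq
  ... | inj₂ q = let (s′ , v , s∈ , v< , eq) = pointed⁻ ss q in s′ , v , there s∈ , v< , eq

  pointed⁺ : ∀ ss {s v} → s ∈ ss → v < suc (excess (f s)) → (snoc (c s) (f s) , v) ∈ pointed c f ss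
  pointed⁺ (s ∷ ss) (here refl) v< = ∈-++⁺ˡ (∈-map⁺ (λ v → snoc (c s) (f s) , v) (∈-upTo⁺ v<))
  pointed⁺ (s ∷ ss) (there s∈)  v< = ∈-++⁺ʳ (points (c s) (f s)) (pointed⁺ ss s∈ v<)

  pointed-unique : (∀ {s s′} → snoc (c s) (f s) ≡ snoc (c s′) (f s′) → s ≡ s′) → ∀ ss → Unique ss → Unique (pointed c f ss)
  pointed-unique inj []       []        = []
  pointed-unique inj (s ∷ ss) (s∉ ∷ us) = Unique.++⁺ (Unique.map⁺ (cong proj₂) (Unique.upTo⁺ (suc (excess (f s))))) (pointed-unique inj ss us) disjoint
    where
    disjoint : ∀ {p} → p ∈ points (c s) (f s) × p ∈ pointed c f ss → ⊥
    disjoint (p , q) with points⁻ {s} p | pointed⁻ ss q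
    ... | v , _ , refl | s′ , v′ , s′∈ , _ , eq = All.lookup s∉ s′∈ (inj (cong proj₁ eq))

module Pointed (μ d′ N : ℕ) (n≡ : suc N ≡ (2 + d′) * suc μ) where
  open Period μ d′ N n≡

  Symmetric : ℕ → Adj n → Set
  Symmetric k A = InX n k A × FixedBy m A

  below : ∀ c f {v} → span (snoc c f) ≡ m → v < suc (excess f) → v < m
  below c f sp v< = <-≤-trans v< (≤-trans (m≤n+m (suc (excess f)) (span c)) (≤-reflexive sp))

  -- `c` and `f` extract from a stack the parts of the tree `snoc c f`; the three shapes of stacks
  -- below share this argument.
  pointed-listing : ∀ k {S : Set} (c : S → Con) (f : S → Arc) (ss : List S) → Unique ss →
    (∀ {s s′} → snoc (c s) (f s) ≡ snoc (c s′) (f s′) → s ≡ s′) →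
    (∀ {s} → s ∈ ss → span (snoc (c s) (f s)) ≡ m) →
    (∀ {s v} → s ∈ ss → v < suc (excess (f s)) → edgeCount (decodeP (snoc (c s) (f s)) v) ≡ k) →
    (∀ c′ f′ v → span (snoc c′ f′) ≡ m → v < suc (excess f′) → edgeCount (decodeP (snoc c′ f′) v) ≡ k →
      ∃ λ s → s ∈ ss × c′ ≡ c s × f′ ≡ f s) →
    Listing (Symmetric k) (∑ (λ s → suc (excess (f s))) ss)
  pointed-listing k c f ss uniq inj spans count cover =
    subst (Listing (Symmetric k)) (pointed-length c f ss)
      (listing (pointed c f ss) (pointed-unique c f inj ss uniq) (λ p → decodeP (proj₁ p) (proj₂ p)) injective good covering)
    where
    injective : ∀ {p p′} → p ∈ pointed c f ss → p′ ∈ pointed c f ss → decodeP (proj₁ p) (proj₂ p) ≡ decodeP (proj₁ p′) (proj₂ p′) → p ≡ p′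
    injective p∈ p′∈ eq with pointed⁻ c f ss p∈ | pointed⁻ c f ss p′∈
    ... | s , v , s∈ , v< , refl | s′ , v′ , s′∈ , v′< , refl =
      let (e₁ , e₂) = uniqueP (c s) (f s) v (below (c s) (f s) (spans s∈) v<) (spans s∈) (c s′) (f s′) v′ (below (c s′) (f s′) (spans s′∈) v′<) (spans s′∈) v< v′< eq
      in cong₂ _,_ e₁ e₂
    good : ∀ {p} → p ∈ pointed c f ss → Symmetric k (decodeP (proj₁ p) (proj₂ p))
    good p∈ with pointed⁻ c f ss p∈
    ... | s , v , s∈ , v< , refl = (simpleP , noncrossingP , connectedP , count s∈ v<) , fixedP
      where open Line (snoc (c s) (f s)) v (below (c s) (f s) (spans s∈) v<) (spans s∈)
    found : ∀ {A} → edgeCount A ≡ k → (∃ λ c′ → ∃ λ f′ → ∃ λ v → span (snoc c′ f′) ≡ m × v < suc (excess f′) × A ≡ decodeP (snoc c′ f′) v) →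
      ∃ λ p → p ∈ pointed c f ss × A ≡ decodeP (proj₁ p) (proj₂ p)
    found ec (c′ , f′ , v , sp , v< , A≡) = place (cover c′ f′ v sp v< (trans (cong edgeCount (sym A≡)) ec))
      where
      place : (∃ λ s → s ∈ ss × c′ ≡ c s × f′ ≡ f s) → _
      place (s , s∈ , refl , refl) = _ , pointed⁺ c f ss s∈ v< , A≡
    covering : ∀ A → Symmetric k A → ∃ λ p → p ∈ pointed c f ss × A ≡ decodeP (proj₁ p) (proj₂ p)
    covering A ((simple , nc , con , ec) , fixed) = found ec (Classify.encodeP μ d′ N n≡ A simple nc con fixed)

  -- Only for d = 2 can the polygon around the centre degenerate to a diameter.
  edges-polygon : ∀ c f v → span (snoc c f) ≡ m → v < suc (excess f) → (n ≡ m + m → c ≢ nil) →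
    edgeCount (decodeP (snoc c f) v) ≡ d * (m + marksC (snoc c f))
  edges-polygon c f v sp v< c≢nil = trans (sym (trans (cong (edgeCount decP +_) (bothWays-0 no-top)) (+-identityʳ _))) edgeCountP
    where
    open Line (snoc c f) v (below c f sp v<) sp
    no-top : n ≡ m + m → decC (snoc c f) v v (v + m) ≡ false
    no-top n≡2m with rep
    ... | snoc nil q _ _ = ⊥-elim (c≢nil n≡2m refl)
    -- With a second arc the cut vertex lies strictly between v and v + m, and {v, v + m} would pass
    -- over it.
    ... | snoc (snoc p q′ _ _) q _ cut = cut ≤-refl (≤-<-trans (repC-≤ p) (repA-< q′)) (repA-< q) ≤-refl

  -- Both half turns count the diameter, whence the `+ 1`.
  edges-diameter : ∀ f v → span (snoc nil f) ≡ m → v < suc (excess f) → n ≡ m + m →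
    edgeCount (decodeP (snoc nil f) v) + 1 ≡ d * (m + marksC (snoc nil f))
  edges-diameter f v sp v< n≡2m = trans (cong (edgeCount decP +_) (sym (bothWays-1 n≡2m top))) edgeCountP
    where
    open Line (snoc nil f) v (below nil f sp v<) sp
    top : decC (snoc nil f) v v (v + m) ≡ true
    top with rep
    ... | snoc nil _ e _ = e

private
  shape-pair : ∀ a b → a + 0 + (b + 0) ≡ a + b
  shape-pair = solve-∀

  shape-pair-suc : ∀ a b → a + suc b ≡ suc (a + 0 + (b + 0))
  shape-pair-suc = solve-∀

not-double : ∀ μ δ N → suc N ≡ (3 + δ) * suc μ → suc N ≢ suc μ + suc μ
not-double μ δ N n≡ eq = n≮n (m + m) (<-≤-trans (m<m+n (m + m) (s≤s z≤n)) (≤-trans (≤-reflexive (shape m))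
  (≤-trans (m≤m+n (3 * m) (δ * m)) (≤-reflexive (trans (sym (*-distribʳ-+ m 3 δ)) (trans (sym n≡) eq))))))
  where
  m = suc μ
  shape : ∀ m → m + m + m ≡ 3 * m
  shape = solve-∀

-- One piece and one arc of total span μ + 1, that is of total excess μ.
polygons : ∀ μ δ N (n≡ : suc N ≡ (3 + δ) * suc μ) t →
  Listing (λ A → InX (suc N) ((3 + δ) * (suc μ + t)) A × FixedBy (suc μ) A) (arcSum 1 0 μ t)
polygons μ δ N n≡ t = subst (Listing _) (∑-arcSpan 1 0 μ t Fin.zero)
  (subst (Listing _) (∑-cong ss (λ { {c ∷ [] , f ∷ []} _ → refl }))
    (pointed-listing k con arc ss (stacks-unique 1 1 μ t) inj spans count cover))
  where
  open Period μ (suc δ) N n≡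
  open Pointed μ (suc δ) N n≡
  k = (3 + δ) * (suc μ + t)
  ss = stacks 1 1 μ t
  con : Stack 1 1 → Con
  con (c ∷ [] , _) = c
  arc : Stack 1 1 → Arc
  arc (_ , f ∷ []) = f
  inj : ∀ {s s′} → snoc (con s) (arc s) ≡ snoc (con s′) (arc s′) → s ≡ s′
  inj {c ∷ [] , f ∷ []} {c′ ∷ [] , f′ ∷ []} refl = refl
  spans : ∀ {s} → s ∈ ss → span (snoc (con s) (arc s)) ≡ m
  spans {c ∷ [] , f ∷ []} s∈ = trans (shape-pair-suc (span c) (excess f)) (cong suc (proj₁ (stacks-sound 1 1 μ t s∈)))
  n≢2m = not-double μ δ N n≡
  count : ∀ {s v} → s ∈ ss → v < suc (excess (arc s)) → edgeCount (decodeP (snoc (con s) (arc s)) v) ≡ k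
  count {c ∷ [] , f ∷ []} {v} s∈ v< = trans (edges-polygon c f v (spans s∈) v< (λ eq _ → n≢2m eq))
    (cong (λ z → (3 + δ) * (suc μ + z)) (trans (sym (shape-pair (marksC c) (marksA f))) (proj₂ (stacks-sound 1 1 μ t s∈))))
  cover : ∀ c f v → span (snoc c f) ≡ m → v < suc (excess f) → edgeCount (decodeP (snoc c f) v) ≡ k → ∃ λ s → s ∈ ss × c ≡ con s × f ≡ arc s
  cover c f v sp v< ec = (c ∷ [] , f ∷ []) , stacks-complete 1 1 μ t _
    (suc-injective (trans (sym (shape-pair-suc (span c) (excess f))) sp) ,
     trans (shape-pair (marksC c) (marksA f)) (+-cancelˡ-≡ (suc μ) _ _ (*-cancelˡ-≡ _ _ (3 + δ) (trans (sym (edges-polygon c f v sp v< (λ eq _ → n≢2m eq))) ec)))) ,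
    refl , refl

-- For d ≥ 3 the rotations act freely on edges, so the number of edges is a multiple of d.
no-polygons : ∀ μ δ N → suc N ≡ (3 + δ) * suc μ → ∀ e ρ → suc ρ < 3 + δ →
  Listing (λ A → InX (suc N) (e * (3 + δ) + suc ρ) A × FixedBy (suc μ) A) 0
no-polygons μ δ N n≡ e ρ ρ< = mkListing [] [] (λ A → mk⇔ (λ ()) (λ g → ⊥-elim (none A g))) refl
  where
  open Period μ (suc δ) N n≡
  open Pointed μ (suc δ) N n≡
  none : ∀ A → Symmetric (e * (3 + δ) + suc ρ) A → ⊥
  none A ((simple , nc , con , ec) , fixed) = absurd (Classify.encodeP μ (suc δ) N n≡ A simple nc con fixed)
    where
    absurd : (∃ λ c → ∃ λ f → ∃ λ v → span (snoc c f) ≡ m × v < suc (excess f) × A ≡ decodeP (snoc c f) v) → ⊥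
    absurd (c , f , v , sp , v< , A≡) = 1+n≢0 (begin
      suc ρ                                        ≡⟨ m<n⇒m%n≡m ρ< ⟨
      suc ρ % (3 + δ)                              ≡⟨ [m+kn]%n≡m%n (suc ρ) e (3 + δ) ⟨
      (suc ρ + e * (3 + δ)) % (3 + δ)              ≡⟨ cong (_% (3 + δ)) (+-comm (suc ρ) (e * (3 + δ))) ⟩
      (e * (3 + δ) + suc ρ) % (3 + δ)              ≡⟨ cong (_% (3 + δ)) (trans (sym ec) (trans (cong edgeCount A≡) (edges-polygon c f v sp v< (λ eq _ → not-double μ δ N n≡ eq)))) ⟩
      ((3 + δ) * (m + marksC (snoc c f))) % (3 + δ) ≡⟨ cong (_% (3 + δ)) (*-comm (3 + δ) (m + marksC (snoc c f))) ⟩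
      ((m + marksC (snoc c f)) * (3 + δ)) % (3 + δ) ≡⟨ m*n%n≡0 (m + marksC (snoc c f)) (3 + δ) ⟩
      0                                            ∎)
      where open ≡-Reasoning

private
  double : ∀ {N} μ → suc N ≡ 2 * suc μ → suc N ≡ suc μ + suc μ
  double μ eq = trans eq (cong (suc μ +_) (+-identityʳ (suc μ)))

  2a≢2b+1 : ∀ a b → 2 * a ≢ 2 * b + 1
  2a≢2b+1 a b eq = even≢odd a b (trans eq (+-comm (2 * b) 1))

  arcs₀ : Stack 0 1 → Arc
  arcs₀ (_ , f ∷ []) = f

  con₂ : Stack 1 2 → Con
  con₂ (c ∷ [] , f ∷ _) = snoc c f

  arc₂ : Stack 1 2 → Arc
  arc₂ (_ , _ ∷ f ∷ []) = f

-- An odd k forces a diameter, and then the whole tree is one arc of span m = μ + 1.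
diameters : ∀ μ N (n≡ : suc N ≡ 2 * suc μ) t k → k + 1 ≡ 2 * (suc μ + t) →
  Listing (λ A → InX (suc N) k A × FixedBy (suc μ) A) (arcSum 0 0 μ t)
diameters μ N n≡ t k k≡ = subst (Listing _) (∑-arcSpan 0 0 μ t Fin.zero)
  (subst (Listing _) (∑-cong ss (λ { {[] , f ∷ []} _ → refl }))
    (pointed-listing k (λ _ → nil) arcs₀ ss (stacks-unique 0 1 μ t) inj spans count cover))
  where
  open Period μ 0 N n≡
  open Pointed μ 0 N n≡
  ss = stacks 0 1 μ t
  inj : ∀ {s s′} → snoc nil (arcs₀ s) ≡ snoc nil (arcs₀ s′) → s ≡ s′
  inj {[] , f ∷ []} {[] , f′ ∷ []} refl = refl
  spans : ∀ {s} → s ∈ ss → span (snoc nil (arcs₀ s)) ≡ m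
  spans {[] , f ∷ []} s∈ = cong suc (trans (sym (+-identityʳ (excess f))) (proj₁ (stacks-sound 0 1 μ t s∈)))
  count : ∀ {s v} → s ∈ ss → v < suc (excess (arcs₀ s)) → edgeCount (decodeP (snoc nil (arcs₀ s)) v) ≡ k
  count {[] , f ∷ []} {v} s∈ v< = +-cancelʳ-≡ 1 _ _ (trans (edges-diameter f v (spans s∈) v< (double μ n≡))
    (trans (cong (λ z → 2 * (suc μ + z)) (trans (sym (+-identityʳ (marksA f))) (proj₂ (stacks-sound 0 1 μ t s∈)))) (sym k≡)))
  cover : ∀ c f v → span (snoc c f) ≡ m → v < suc (excess f) → edgeCount (decodeP (snoc c f) v) ≡ k → ∃ λ s → s ∈ ss × c ≡ nil × f ≡ arcs₀ s
  cover nil f v sp v< ec = ([] , f ∷ []) , stacks-complete 0 1 μ t _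
    (trans (+-identityʳ (excess f)) (suc-injective sp) ,
     trans (+-identityʳ (marksA f)) (+-cancelˡ-≡ (suc μ) _ _ (*-cancelˡ-≡ _ _ 2 (trans (sym (edges-diameter f v sp v< (double μ n≡))) (trans (cong (_+ 1) ec) k≡))))) ,
    refl , refl
  cover c@(snoc _ _) f v sp v< ec = ⊥-elim (2a≢2b+1 (suc μ + t) (m + marksC (snoc c f)) (trans (sym k≡) (cong (_+ 1) (trans (sym ec) (edges-polygon c f v sp v< (λ _ ()))))))

-- An even k excludes the diameter, so there are at least two arcs: stacks of one piece and two
-- arcs, pointed under the second. Each arc takes one unit of length, whence m = μ + 2.
even-polygons : ∀ μ N (n≡ : suc N ≡ 2 * suc (suc μ)) t →
  Listing (λ A → InX (suc N) (2 * (suc (suc μ) + t)) A × FixedBy (suc (suc μ)) A) (arcSum 1 1 μ t)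
even-polygons μ N n≡ t = subst (Listing _) (∑-arcSpan 1 1 μ t (Fin.suc Fin.zero))
  (subst (Listing _) (∑-cong ss (λ { {c ∷ [] , f ∷ f′ ∷ []} _ → refl }))
    (pointed-listing k con₂ arc₂ ss (stacks-unique 1 2 μ t) inj spans count cover))
  where
  open Period (suc μ) 0 N n≡
  open Pointed (suc μ) 0 N n≡
  k = 2 * (suc (suc μ) + t)
  ss = stacks 1 2 μ t
  shape₁ : ∀ a b c → a + suc b + suc c ≡ suc (suc (a + 0 + (b + (c + 0))))
  shape₁ = solve-∀
  shape₂ : ∀ a b c → a + b + c ≡ a + 0 + (b + (c + 0))
  shape₂ = solve-∀
  inj : ∀ {s s′} → snoc (con₂ s) (arc₂ s) ≡ snoc (con₂ s′) (arc₂ s′) → s ≡ s′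
  inj {c ∷ [] , f ∷ f₁ ∷ []} {c′ ∷ [] , f′ ∷ f₁′ ∷ []} refl = refl
  spans : ∀ {s} → s ∈ ss → span (snoc (con₂ s) (arc₂ s)) ≡ m
  spans {c ∷ [] , f ∷ f′ ∷ []} s∈ = trans (shape₁ (span c) (excess f) (excess f′)) (cong (λ z → suc (suc z)) (proj₁ (stacks-sound 1 2 μ t s∈)))
  count : ∀ {s v} → s ∈ ss → v < suc (excess (arc₂ s)) → edgeCount (decodeP (snoc (con₂ s) (arc₂ s)) v) ≡ k
  count {c ∷ [] , f ∷ f′ ∷ []} {v} s∈ v< = trans (edges-polygon (snoc c f) f′ v (spans s∈) v< (λ _ ()))
    (cong (λ z → 2 * (suc (suc μ) + z)) (trans (shape₂ (marksC c) (marksA f) (marksA f′)) (proj₂ (stacks-sound 1 2 μ t s∈))))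
  cover : ∀ c f v → span (snoc c f) ≡ m → v < suc (excess f) → edgeCount (decodeP (snoc c f) v) ≡ k → ∃ λ s → s ∈ ss × c ≡ con₂ s × f ≡ arc₂ s
  cover nil f v sp v< ec = ⊥-elim (2a≢2b+1 (m + marksC (snoc nil f)) (suc (suc μ) + t) (trans (sym (edges-diameter f v sp v< (double (suc μ) n≡))) (cong (_+ 1) ec)))
  cover (snoc c f) f′ v sp v< ec = (c ∷ [] , f ∷ f′ ∷ []) , stacks-complete 1 2 μ t _
    (suc-injective (suc-injective (trans (sym (shape₁ (span c) (excess f) (excess f′))) sp)) ,
     trans (sym (shape₂ (marksC c) (marksA f) (marksA f′))) (+-cancelˡ-≡ (suc (suc μ)) _ _ (*-cancelˡ-≡ _ _ 2 (trans (sym (edges-polygon (snoc c f) f′ v sp v< (λ _ ()))) ec)))) ,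
    refl , refl

listing-⇔ : ∀ {n len} {P Q : Adj n → Set} → (∀ A → P A → Q A) → (∀ A → Q A → P A) → Listing P len → Listing Q len
listing-⇔ to from (mkListing L u c s) = mkListing L u
  (λ A → mk⇔ (λ A∈ → to A (Equivalence.to (c A) A∈)) (λ q → Equivalence.from (c A) (from A q))) s

fixed-by-n : ∀ N (A : Adj (suc N)) q → suc N ≡ q * 1 → FixedBy q A
fixed-by-n N A q eq i j = cong₂ (entry A) (rot-id i) (rot-id j)
  where
  rot-id : ∀ i → rot q i ≡ i
  rot-id i = trans (cong (λ z → rot z i) (trans (sym (*-identityʳ q)) (sym eq)))
    (trans (mod-cong N {toℕ i + suc N} {toℕ i} ([m+n]%n≡m%n (toℕ i) (suc N))) (mod-toℕ N i))

-- Matching the counts with the values at roots of unity.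

private
  binom-cong : ∀ {a a′ b b′} → a ≡ a′ → b ≡ b′ → binom a b ≡ binom a′ b′
  binom-cong refl refl = refl

  -- `total` for i = j = 0: a single piece, whose span N is counted once per stack.
  count-d=1 : ∀ M t → suc M * length (stacks 1 0 (suc M) t) ≡ binom (3 * suc M) (suc M + suc (suc (M + t))) * binom (M + t) M
  count-d=1 M t = trans (total 0 0 (suc M) t) (trans (+-identityʳ (conSum 0 0 (suc M) t))
    (trans (*-comm (multichoose (suc M) t) _) (cong₂ _*_ (binom-cong {3 * suc M} refl (shape M t)) (multichoose-binom M t))))
    where
    shape : ∀ M t → suc (2 * suc M + t) ≡ suc M + suc (suc (M + t))
    shape = solve-∀

  -- The right-hand side is the q-Lucas value for n = (μ + 1) d and k = (μ + 1 + t) d.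
  count-polygons : ∀ μ t → arcSum 1 0 μ t ≡ binom (3 * μ + 2) (suc μ + suc (μ + t)) * binom (μ + t) μ
  count-polygons μ t = trans (*-comm (multichoose (suc μ) t) _) (cong₂ _*_ (binom-cong (shape₁ μ) (shape₂ μ t)) (multichoose-binom μ t))
    where
    shape₁ : ∀ μ → suc (1 + 3 * μ) ≡ 3 * μ + 2
    shape₁ = solve-∀
    shape₂ : ∀ μ t → suc (1 + 2 * μ + t) ≡ suc μ + suc (μ + t)
    shape₂ = solve-∀

  count-diameters : ∀ μ t → arcSum 0 0 μ t ≡ binom (3 * μ + 1) (suc μ + (μ + t)) * binom (μ + t) μ
  count-diameters μ t = trans (*-comm (multichoose (suc μ) t) _) (cong₂ _*_ (binom-cong (shape₁ μ) (shape₂ μ t)) (multichoose-binom μ t))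
    where
    shape₁ : ∀ μ → suc (3 * μ) ≡ 3 * μ + 1
    shape₁ = solve-∀
    shape₂ : ∀ μ t → suc (2 * μ + t) ≡ suc μ + (μ + t)
    shape₂ = solve-∀

  count-even-polygons : ∀ μ t → arcSum 1 1 μ t ≡ binom (3 * suc μ + 1) (suc (suc μ) + suc (suc μ + t)) * binom (suc μ + t) (suc μ)
  count-even-polygons μ t = trans (*-comm (multichoose (suc (suc μ)) t) _) (cong₂ _*_ (binom-cong (shape₁ μ) (shape₂ μ t)) (multichoose-binom (suc μ) t))
    where
    shape₁ : ∀ μ → suc (3 + 3 * μ) ≡ 3 * suc μ + 1
    shape₁ = solve-∀
    shape₂ : ∀ μ t → suc (3 + 2 * μ + t) ≡ suc (suc μ) + suc (suc μ + t)
    shape₂ = solve-∀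

  divide : ∀ k d → ∃ λ e → ∃ λ r → r < suc d × k ≡ e * suc d + r
  divide k d = k / suc d , k % suc d , m%n<n k (suc d) , trans (m≡m%n+[m/n]*n k (suc d)) (+-comm (k % suc d) _)

Sieving : ∀ (c ℓ : Level) (M K d q : ℕ) → Set (Level.suc (c Level.⊔ ℓ))
Sieving c ℓ M K d q = Σ (List (Adj (2 + M))) (λ L → Unique L × (∀ A → (A ∈ L) ⇔ (InX (2 + M) (suc K) A × FixedBy q A)) ×
  ((R : CommutativeRing c ℓ) → IsDomainChar0 R → (ω : CommutativeRing.Carrier R) → PrimitiveRoot R d ω →
    CommutativeRing._≈_ R (evalP R (PG.cPoly M K) ω) (natR R (length L))))

sieving : ∀ {c ℓ} M K d q {len} → Listing (λ A → InX (2 + M) (suc K) A × FixedBy q A) len →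
  ((R : CommutativeRing c ℓ) → IsDomainChar0 R → (ω : CommutativeRing.Carrier R) → PrimitiveRoot R d ω →
    CommutativeRing._≈_ R (GaussianBinomials.cPoly R ω M K) (natR R len)) → Sieving c ℓ M K d q
sieving M K d q (mkListing L u c refl) value = L , u , c , λ R dom ω prim →
  CommutativeRing.trans R (Evaluation.ev-cPoly R ω M K) (value R dom ω prim)

module _ {c ℓ : Level} (M K : ℕ) (M≤K : M ≤ K) (bound : suc K + 3 ≤ 2 * (2 + M)) where
  private
    N = suc M

    natR-cong : ∀ (R : CommutativeRing c ℓ) {x a b} → CommutativeRing._≈_ R x (natR R b) → a ≡ b → CommutativeRing._≈_ R x (natR R a)
    natR-cong R p refl = p

  sieving-1 : ∀ q → 2 + M ≡ q * 1 → Sieving c ℓ M K 1 q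
  sieving-1 q eq with m≤n⇒∃[o]m+o≡n M≤K
  ... | t , refl = sieving M (M + t) 1 q
    (listing-⇔ (λ A g → g , fixed-by-n N A q eq) (λ A → proj₁) (linear-listing N t))
    (λ R dom ω prim → cPoly-at-1 R dom ω prim M (M + t) _ (count-d=1 M t))

  private
    -- k is a multiple of the divisor and at least n - 1. As the divisor is at least 2, this forces
    -- k ≥ n.
    at-least : ∀ d e μ → 2 + M ≡ suc μ * suc (suc d) → suc K ≡ e * suc (suc d) → ∃ λ t → e ≡ suc μ + t
    at-least d e μ n≡ k≡ with suc μ ≤? e
    ... | yes p = let (t , eq) = m≤n⇒∃[o]m+o≡n p in t , sym eq
    ... | no ¬p = ⊥-elim (n≮n (2 + M) (begin-strict
      2 + M                       ≤⟨ s≤s (s≤s M≤K) ⟩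
      1 + suc K                   ≡⟨ cong suc k≡ ⟩
      1 + e * suc (suc d)         <⟨ s≤s (s≤s (m≤n+m (e * suc (suc d)) d)) ⟩
      suc e * suc (suc d)         ≤⟨ *-monoˡ-≤ (suc (suc d)) (≰⇒> ¬p) ⟩
      suc μ * suc (suc d)         ≡⟨ n≡ ⟨
      2 + M                       ∎))
      where open ≤-Reasoning

  sieving-2 : ∀ μ → 2 + M ≡ suc μ * 2 → Sieving c ℓ M K 2 (suc μ)
  sieving-2 μ n≡ with divide (suc K) 1
  ... | e , suc (suc _) , s≤s (s≤s ()) , _
  ... | e , zero , _ , k≡′ = even e (trans k≡′ (+-identityʳ (e * 2)))
    where
    even : ∀ e → suc K ≡ e * 2 → Sieving c ℓ M K 2 (suc μ)
    even e k≡ with at-least 0 e μ n≡ k≡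
    ... | t , refl = go μ n≡ k≡
      where
      go : ∀ μ → 2 + M ≡ suc μ * 2 → suc K ≡ (suc μ + t) * 2 → Sieving c ℓ M K 2 (suc μ)
      -- For n = 2 no even k is left: k ≥ 2 contradicts k + 3 ≤ 4.
      go zero n≡ k≡ = ⊥-elim (n≮n 4 (begin-strict
        4                     <⟨ s≤s (s≤s (m≤n+m 3 (t * 2))) ⟩
        2 + t * 2 + 3         ≡⟨ cong (_+ 3) k≡ ⟨
        suc K + 3             ≤⟨ bound ⟩
        2 * (2 + M)           ≡⟨ cong (2 *_) n≡ ⟩
        4                     ∎))
        where open ≤-Reasoning
      go (suc μ) n≡ k≡ = sieving M K 2 (suc (suc μ))
        (listing-⇔ (λ A → subst (λ k → InX (2 + M) k A × FixedBy (suc (suc μ)) A) (trans (*-comm 2 (suc (suc μ) + t)) (sym k≡)))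
                   (λ A → subst (λ k → InX (2 + M) k A × FixedBy (suc (suc μ)) A) (sym (trans (*-comm 2 (suc (suc μ) + t)) (sym k≡))))
                   (even-polygons μ N (trans n≡ (*-comm (suc (suc μ)) 2)) t))
        (λ R dom ω prim → natR-cong R (cPoly-at-2-even R dom ω prim (suc μ) (suc μ + t) n≡ k≡) (count-even-polygons μ t))
  ... | e , suc zero , _ , k≡ with at-least′ e k≡
    where
    -- Comparison of k = 2e + 1 with n - 1 = 2μ + 1.
    at-least′ : ∀ e → suc K ≡ e * 2 + 1 → ∃ λ t → e ≡ μ + t
    at-least′ e k≡ with μ ≤? e
    ... | yes p = let (t , eq) = m≤n⇒∃[o]m+o≡n p in t , sym eq
    ... | no ¬p = ⊥-elim (n≮n (2 + M) (begin-strict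
      2 + M                  ≤⟨ s≤s (s≤s M≤K) ⟩
      1 + suc K              ≡⟨ cong suc k≡ ⟩
      1 + (e * 2 + 1)        ≡⟨ shape e ⟩
      suc e * 2              <⟨ *-monoˡ-< 2 (s≤s (≰⇒> ¬p)) ⟩
      suc μ * 2              ≡⟨ n≡ ⟨
      2 + M                  ∎))
      where
      open ≤-Reasoning
      shape : ∀ e → 1 + (e * 2 + 1) ≡ suc e * 2
      shape = solve-∀
  ...   | t , refl = sieving M K 2 (suc μ)
        (diameters μ N (trans n≡ (*-comm (suc μ) 2)) t (suc K) (trans (cong (_+ 1) k≡) (shape μ t)))
        (λ R dom ω prim → natR-cong R (cPoly-at-2-odd R dom ω prim μ (μ + t) n≡ k≡) (count-diameters μ t))
    where
    shape : ∀ μ t → (μ + t) * 2 + 1 + 1 ≡ 2 * (suc μ + t)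
    shape = solve-∀

  sieving-≥3 : ∀ δ μ → 2 + M ≡ suc μ * (3 + δ) → Sieving c ℓ M K (3 + δ) (suc μ)
  sieving-≥3 δ μ n≡ with divide (suc K) (2 + δ)
  ... | e , zero , _ , k≡′ with at-least (suc δ) e μ n≡ (trans k≡′ (+-identityʳ (e * (3 + δ))))
  ...   | t , refl = sieving M K (3 + δ) (suc μ)
        (listing-⇔ (λ A → subst (λ k → InX (2 + M) k A × FixedBy (suc μ) A) k-eq)
                   (λ A → subst (λ k → InX (2 + M) k A × FixedBy (suc μ) A) (sym k-eq))
                   (polygons μ δ N (trans n≡ (*-comm (suc μ) (3 + δ))) t))
        (λ R dom ω prim → natR-cong R (cPoly-at-≥3 R dom ω δ prim μ (μ + t) n≡ k≡) (count-polygons μ t))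
    where
    k≡ : suc K ≡ (suc μ + t) * (3 + δ)
    k≡ = trans k≡′ (+-identityʳ _)
    k-eq : (3 + δ) * (suc μ + t) ≡ suc K
    k-eq = trans (*-comm (3 + δ) (suc μ + t)) (sym k≡)
  sieving-≥3 δ μ n≡ | e , suc ρ , ρ< , k≡ = sieving M K (3 + δ) (suc μ)
    (listing-⇔ (λ A → subst (λ k → InX (2 + M) k A × FixedBy (suc μ) A) (sym k≡))
               (λ A → subst (λ k → InX (2 + M) k A × FixedBy (suc μ) A) k≡)
               (no-polygons μ δ N (trans n≡ (*-comm (suc μ) (3 + δ))) e ρ ρ<))
    (λ R dom ω prim → cPoly-at-≥3-zero R dom ω δ prim μ e ρ n≡ k≡ ρ<)

theorem1p1 : {c ℓ : Level} (n k : ℕ) → 1 ≤ n → n ≤ k + 1 → k + 3 ≤ 2 * n →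
    Σ Poly (λ C →
    (∀ i → coeff (cDenom n k *ₚ C) i ≡ coeff (cNumer n k) i) ×
    (∀ d → 1 ≤ d → (dv : d ∣ n) →
    Σ (List (Adj n)) (λ L →
    Unique L ×
    (∀ A → (A ∈ L) ⇔ (InX n k A × FixedBy (quotient dv) A)) ×
    ((R : CommutativeRing c ℓ) → IsDomainChar0 R → (ω : CommutativeRing.Carrier R) →
    PrimitiveRoot R d ω →
    CommutativeRing._≈_ R (evalP R C ω) (natR R (length L))))))
theorem1p1 zero k ()
-- n = 1 would require k + 3 ≤ 2.
theorem1p1 (suc zero) k _ _ bound = ⊥-elim (<⇒≱ (s≤s (s≤s (s≤s z≤n))) (≤-trans (m≤n+m 3 k) bound))
theorem1p1 (suc (suc M)) zero _ (s≤s ()) _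
theorem1p1 {c} {ℓ} (suc (suc M)) (suc K) _ lower upper = PG.cPoly M K , _≋_.at (cDenom-cPoly M K M≤K b≤a) , fixed
  where
  M≤K : M ≤ K
  M≤K = ≤-pred (≤-pred (≤-trans lower (≤-reflexive (cong suc (+-comm K 1)))))
  shape₁ : ∀ M K → suc M + suc (suc K) ≡ K + 3 + M
  shape₁ = solve-∀
  shape₂ : ∀ M → suc (3 * suc M) ≡ 2 * (2 + M) + M
  shape₂ = solve-∀
  -- The bound k ≤ 2n - 3 in the form n + k ≤ 3n - 3.
  b≤a : suc M + suc (suc K) ≤ 3 * suc M
  b≤a = ≤-pred (≤-trans (≤-reflexive (cong suc (shape₁ M K))) (≤-trans (+-monoˡ-≤ M upper) (≤-reflexive (sym (shape₂ M)))))
  fixed : ∀ d → 1 ≤ d → (dv : d ∣ 2 + M) → Sieving c ℓ M K d (quotient dv)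
  fixed zero () _
  fixed (suc d) _ (divides zero ())
  fixed 1 _ (divides (suc μ) eq) = sieving-1 M K M≤K upper (suc μ) eq
  fixed 2 _ (divides (suc μ) eq) = sieving-2 M K M≤K upper μ eq
  fixed (suc (suc (suc δ))) _ (divides (suc μ) eq) = sieving-≥3 M K M≤K upper δ μ eq
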